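{- For all $k\in\mathbb{N}$ (that is, all integers $k\ge 1$) and all integers $m\ge 0$, $n\ge 0$, $$\int_{[0,+\infty)^k}(e_2(\mathbf{x}))^m\,(e_1(\mathbf{x}))^n\,e^{ -e_1(\mathbf{x})}\,d\mathbf{x}=\frac{m!\,(2m+n+k-1)!\,\left(\frac{k}{2}\right)_m}{(2m+k-1)!}\left(\frac{2(k-1)}{k}\right)^m T_k(m),$$ where $$T_k(m)-T_k(m-1)=\frac{(k(k-2))^m\,\left(\frac{k-1}{2}\right)_m}{(k-1)^{2m}\,\left(\frac{k}{2}\right)_m}\,T_{k-1}(m)\qquad\text{for all } k\ge 2,\ m\ge 1,$$ $T_1(m)=0$ for all integers $m\ge 0$, and $T_k(0)=1$ for all $k\ge 2$.
   Context: Here $\mathbf{x}=(x_1,\ldots,x_k)$, $d\mathbf{x}=dx_1\cdots dx_k$, $e_1(\mathbf{x})=\sum_{i=1}^k x_i$, $e_2(\mathbf{x})=\sum_{i<j}x_ix_j$ (sum over $1\le i<j\le k$), and $(y)_m=\prod_{i=0}^{m-1}(y+i)$ is the rising factorial. The numbers $T_k(m)$, for integers $k\ge 1$ and $m\ge 0$, are defined by the recurrence and initial conditions given in the claim.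
   Formalization: The case k = 1, m = 0 is excluded: there e_2^0 = 1, so the integral equals n!, while the right-hand side is 0 because T_1(0) = 0, so the printed identity fails for every n. -}

module Defs where

import Algebra.Definitions.RawSemiring as RawSemiringOps
open import Algebra.Bundles.Raw using (RawSemiring)
open import Data.Bool.Base using (if_then_else_)
open import Data.Fin.Base using (Fin; zero; suc; toℕ; fromℕ; inject₁)
import Data.Fin.Properties as Fin
open import Data.Integer.Base as ℤ using (+_)
import Data.Integer.Properties as ℤ
open import Data.Nat.Base as ℕ using (ℕ; zero; suc; _!; _∸_)
import Data.Nat.Properties as ℕ
open import Data.Product.Base using (Σ-syntax; _×_; _,_; proj₁; proj₂)
open import Data.Rational.Base as ℚ
  using (ℚ; 0ℚ; 1ℚ; ½; _+_; _*_; -_; _-_; _/_; _÷_; ∣_∣; _≤_; _<_; Positive)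
import Data.Rational.Properties as ℚ
import Data.Rational.Unnormalised.Base as ℚᵘ
import Data.Rational.Unnormalised.Properties as ℚᵘ
open import Data.Rational.Solver using (module +-*-Solver)
open import Data.Sum.Base using (_⊎_; inj₁; inj₂)
open import Data.Vec.Functional using (Vector)
open import Level using (0ℓ)
open import Relation.Binary.PropositionalEquality
open import Relation.Nullary.Decidable.Core using (does)

open +-*-Solver using (solve; _:=_; _:+_; _:*_; _:-_; :-_; con)

module ℚ-Ops = RawSemiringOps ℚ.+-*-rawSemiring
open ℚ-Ops public using () renaming (_^_ to _^ℚ_; product to productℚ)

infix 8 1/_!

fromℕℚ : ℕ → ℚ
fromℕℚ n = + n / 1

1/_! : ℕ → ℚ
1/ n ! = (+ 1 / n !) {{n ℕ.!≢0}}

------------------------------------------------------------------------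
-- Auxiliary facts about ℚ

∣∣-bound : ∀ {p q} → p ≤ q → - p ≤ q → ∣ p ∣ ≤ q
∣∣-bound {p} {q} a b with ℚ.∣p∣≡p∨∣p∣≡-p p
... | inj₁ e = subst (_≤ q) (sym e) a
... | inj₂ e = subst (_≤ q) (sym e) b

∣∣-swap : ∀ p q → ∣ p - q ∣ ≡ ∣ q - p ∣
∣∣-swap p q = trans (cong ∣_∣ (solve 2 (λ p q → p :- q := :- (q :- p)) refl p q))
                    (ℚ.∣-p∣≡∣p∣ (q - p))

∣∣-triangle : ∀ p q r → ∣ p - r ∣ ≤ ∣ p - q ∣ + ∣ q - r ∣
∣∣-triangle p q r = subst (λ z → ∣ z ∣ ≤ ∣ p - q ∣ + ∣ q - r ∣)
  (solve 3 (λ p q r → (p :- q) :+ (q :- r) := p :- r) refl p q r)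
  (ℚ.∣p+q∣≤∣p∣+∣q∣ (p - q) (q - r))

∣p∣≤∣p-q∣+∣q∣ : ∀ p q → ∣ p ∣ ≤ ∣ p - q ∣ + ∣ q ∣
∣p∣≤∣p-q∣+∣q∣ p q = subst (λ z → ∣ z ∣ ≤ ∣ p - q ∣ + ∣ q ∣)
  (solve 2 (λ p q → (p :- q) :+ q := p) refl p q)
  (ℚ.∣p+q∣≤∣p∣+∣q∣ (p - q) q)

≤+⇒-≤ : ∀ {a b c} → a ≤ b + c → a - c ≤ b
≤+⇒-≤ {a} {b} {c} h = subst (a - c ≤_)
  (solve 2 (λ b c → (b :+ c) :- c := b) refl b c) (ℚ.+-monoˡ-≤ (- c) h)

∣∣-reverse : ∀ p q → ∣ ∣ p ∣ - ∣ q ∣ ∣ ≤ ∣ p - q ∣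
∣∣-reverse p q = ∣∣-bound (≤+⇒-≤ (∣p∣≤∣p-q∣+∣q∣ p q))
  (subst₂ _≤_ (solve 2 (λ a b → b :- a := :- (a :- b)) refl ∣ p ∣ ∣ q ∣)
              (∣∣-swap q p)
              (≤+⇒-≤ (∣p∣≤∣p-q∣+∣q∣ q p)))

*-mono-≤ : ∀ {a b c d} → 0ℚ ≤ a → 0ℚ ≤ d → a ≤ b → c ≤ d → a * c ≤ b * d
*-mono-≤ {a} {b} {c} {d} 0≤a 0≤d a≤b c≤d = ℚ.≤-trans
  (ℚ.*-monoˡ-≤-nonNeg a {{ℚ.nonNegative 0≤a}} c≤d)
  (ℚ.*-monoʳ-≤-nonNeg d {{ℚ.nonNegative 0≤d}} a≤b)

*-nonneg : ∀ {a b} → 0ℚ ≤ a → 0ℚ ≤ b → 0ℚ ≤ a * b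
*-nonneg {a} {b} 0≤a 0≤b =
  subst (_≤ a * b) (ℚ.*-zeroˡ 0ℚ) (*-mono-≤ ℚ.≤-refl 0≤b 0≤a 0≤b)

+-nonneg : ∀ {a b} → 0ℚ ≤ a → 0ℚ ≤ b → 0ℚ ≤ a + b
+-nonneg {a} {b} 0≤a 0≤b = subst (_≤ a + b) (ℚ.+-identityˡ 0ℚ) (ℚ.+-mono-≤ 0≤a 0≤b)

≤-+ʳ : ∀ {a b} → 0ℚ ≤ b → a ≤ a + b
≤-+ʳ {a} {b} 0≤b = subst (_≤ a + b) (ℚ.+-identityʳ a) (ℚ.+-monoʳ-≤ a 0≤b)

≤-+ˡ : ∀ {a b} → 0ℚ ≤ a → b ≤ a + b
≤-+ˡ {a} {b} 0≤a = subst (_≤ a + b) (ℚ.+-identityˡ b) (ℚ.+-monoˡ-≤ b 0≤a)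

0<1 : 0ℚ < 1ℚ
0<1 = ℚ.positive⁻¹ 1ℚ

+-interchange : ∀ a b c d → (a - c) + (b - d) ≡ (a + b) - (c + d)
+-interchange = solve 4 (λ a b c d → (a :- c) :+ (b :- d) := (a :+ b) :- (c :+ d)) refl

neg-swap : ∀ a b → b - a ≡ (- a) - (- b)
neg-swap = solve 2 (λ a b → b :- a := (:- a) :- (:- b)) refl

product-difference : ∀ a b c d → a * b - c * d ≡ a * (b - d) + d * (a - c)
product-difference =
  solve 4 (λ a b c d → a :* b :- c :* d := a :* (b :- d) :+ d :* (a :- c)) refl

product-close : ∀ {a b c d A B δ} → 0ℚ ≤ δ → ∣ a ∣ ≤ A → ∣ d ∣ ≤ B →
  ∣ b - d ∣ ≤ δ → ∣ a - c ∣ ≤ δ → ∣ a * b - c * d ∣ ≤ (A + B) * δ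
product-close {a} {b} {c} {d} {A} {B} {δ} 0≤δ a≤A d≤B bd ac = begin
  ∣ a * b - c * d ∣
    ≡⟨ cong ∣_∣ (product-difference a b c d) ⟩
  ∣ a * (b - d) + d * (a - c) ∣
    ≤⟨ ℚ.∣p+q∣≤∣p∣+∣q∣ (a * (b - d)) (d * (a - c)) ⟩
  ∣ a * (b - d) ∣ + ∣ d * (a - c) ∣
    ≡⟨ cong₂ _+_ (ℚ.∣p*q∣≡∣p∣*∣q∣ a (b - d)) (ℚ.∣p*q∣≡∣p∣*∣q∣ d (a - c)) ⟩
  ∣ a ∣ * ∣ b - d ∣ + ∣ d ∣ * ∣ a - c ∣
    ≤⟨ ℚ.+-mono-≤ (*-mono-≤ (ℚ.0≤∣p∣ a) 0≤δ a≤A bd) (*-mono-≤ (ℚ.0≤∣p∣ d) 0≤δ d≤B ac) ⟩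
  A * δ + B * δ
    ≡⟨ sym (ℚ.*-distribʳ-+ δ A B) ⟩
  (A + B) * δ ∎
  where open ℚ.≤-Reasoning

½ε>0 : ∀ {ε} → 0ℚ < ε → 0ℚ < ½ * ε
½ε>0 {ε} h = ℚ.positive⁻¹ _ {{ℚ.pos*pos⇒pos ½ ε {{ℚ.positive h}}}}

½+½ : ∀ ε → ½ * ε + ½ * ε ≡ ε
½+½ = solve 1 (λ e → con ½ :* e :+ con ½ :* e := e) refl

scale : ∀ {ε K} → 0ℚ < ε → 0ℚ < K → Σ[ δ ∈ ℚ ] 0ℚ < δ × K * δ ≡ ε
scale {ε} {K} 0<ε 0<K = ε * K⁻¹ , ℚ.positive⁻¹ _ {{ℚ.pos*pos⇒pos ε K⁻¹}} , eq
  where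
  instance
    _ = ℚ.positive 0<ε
    K⁺ = ℚ.positive 0<K
    K≢0 = ℚ.pos⇒nonZero K
  K⁻¹ = ℚ.1/ K
  instance _ = ℚ.1/pos⇒pos K
  eq : K * (ε * K⁻¹) ≡ ε
  eq = trans (solve 3 (λ k e i → k :* (e :* i) := e :* (k :* i)) refl K ε K⁻¹)
             (trans (cong (ε *_) (ℚ.*-inverseʳ K)) (ℚ.*-identityʳ ε))

fromℚᵘ-homo-* : ∀ p q → ℚ.fromℚᵘ (p ℚᵘ.* q) ≡ ℚ.fromℚᵘ p * ℚ.fromℚᵘ q
fromℚᵘ-homo-* p q = ℚ.toℚᵘ-injective (ℚᵘ.≃-trans (ℚ.toℚᵘ-fromℚᵘ (p ℚᵘ.* q))
  (ℚᵘ.≃-sym (ℚᵘ.≃-trans (ℚ.toℚᵘ-homo-* (ℚ.fromℚᵘ p) (ℚ.fromℚᵘ q))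
    (ℚᵘ.*-cong (ℚ.toℚᵘ-fromℚᵘ p) (ℚ.toℚᵘ-fromℚᵘ q)))))

fromℚᵘ-homo-+ : ∀ p q → ℚ.fromℚᵘ (p ℚᵘ.+ q) ≡ ℚ.fromℚᵘ p + ℚ.fromℚᵘ q
fromℚᵘ-homo-+ p q = ℚ.toℚᵘ-injective (ℚᵘ.≃-trans (ℚ.toℚᵘ-fromℚᵘ (p ℚᵘ.+ q))
  (ℚᵘ.≃-sym (ℚᵘ.≃-trans (ℚ.toℚᵘ-homo-+ (ℚ.fromℚᵘ p) (ℚ.fromℚᵘ q))
    (ℚᵘ.+-cong (ℚ.toℚᵘ-fromℚᵘ p) (ℚ.toℚᵘ-fromℚᵘ q)))))

fromℚᵘ-mono-≤ : ∀ {p q} → p ℚᵘ.≤ q → ℚ.fromℚᵘ p ≤ ℚ.fromℚᵘ q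
fromℚᵘ-mono-≤ {p} {q} h = ℚ.toℚᵘ-cancel-≤
  (ℚᵘ.≤-respˡ-≃ (ℚᵘ.≃-sym (ℚ.toℚᵘ-fromℚᵘ p))
    (ℚᵘ.≤-respʳ-≃ (ℚᵘ.≃-sym (ℚ.toℚᵘ-fromℚᵘ q)) h))

fromℕℚ-pos : ∀ n → 0ℚ < fromℕℚ (suc n)
fromℕℚ-pos n = ℚ.positive⁻¹ _ {{ℚ.normalize-pos (suc n) 1}}

fromℕℚ-suc : ∀ n → fromℕℚ (suc n) ≡ 1ℚ + fromℕℚ n
fromℕℚ-suc n = trans (cong (λ z → ℚ.fromℚᵘ (ℚᵘ.mkℚᵘ z 0))
                           (sym (cong (λ z → + 1 ℤ.+ z) (ℤ.*-identityʳ (+ n)))))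
                     (fromℚᵘ-homo-+ (ℚᵘ.mkℚᵘ (+ 1) 0) (ℚᵘ.mkℚᵘ (+ n) 0))

fromℕℚ-mono : ∀ {m n} → m ℕ.≤ n → fromℕℚ m ≤ fromℕℚ n
fromℕℚ-mono {m} {n} m≤n = fromℚᵘ-mono-≤ {ℚᵘ.mkℚᵘ (+ m) 0} {ℚᵘ.mkℚᵘ (+ n) 0}
  (ℚᵘ.*≤* (ℤ.*-monoʳ-≤-nonNeg (+ 1) (ℤ.+≤+ m≤n)))

archimedean : ∀ q → Σ[ n ∈ ℕ ] q ≤ fromℕℚ n
archimedean q@(ℚ.mkℚ i d c) = ℤ.∣ i ∣ , subst (_≤ fromℕℚ ℤ.∣ i ∣) (ℚ.fromℚᵘ-toℚᵘ q)
  (fromℚᵘ-mono-≤ {ℚᵘ.mkℚᵘ i d} {ℚᵘ.mkℚᵘ (+ ℤ.∣ i ∣) 0} (ℚᵘ.*≤* (lem i)))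
  where
  lem : ∀ i → i ℤ.* + 1 ℤ.≤ + ℤ.∣ i ∣ ℤ.* + suc d
  lem i = ℤ.≤-trans (ℤ.≤-reflexive (ℤ.*-identityʳ i)) (ℤ.≤-trans (i≤∣i∣ i)
    (subst (+ ℤ.∣ i ∣ ℤ.≤_) (ℤ.pos-* ℤ.∣ i ∣ (suc d))
      (ℤ.+≤+ (ℕ.m≤m*n ℤ.∣ i ∣ (suc d)))))
    where
    i≤∣i∣ : ∀ i → i ℤ.≤ + ℤ.∣ i ∣
    i≤∣i∣ (+ n) = ℤ.≤-refl
    i≤∣i∣ ℤ.-[1+ n ] = ℤ.-≤+

1/!-suc : ∀ n → fromℕℚ (suc n) * 1/ (suc n) ! ≡ 1/ n !
1/!-suc n = lem (n !) {{n ℕ.!≢0}} {{suc n ℕ.!≢0}}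
  where
  lem : ∀ b .{{_ : ℕ.NonZero b}} .{{_ : ℕ.NonZero (suc n ℕ.* b)}} →
        fromℕℚ (suc n) * (+ 1 / (suc n ℕ.* b)) ≡ + 1 / b
  lem (suc b) = trans
    (sym (fromℚᵘ-homo-* (ℚᵘ.mkℚᵘ (+ suc n) 0) (ℚᵘ.mkℚᵘ (+ 1) (b ℕ.+ n ℕ.* suc b))))
    (ℚ.fromℚᵘ-cong {ℚᵘ.mkℚᵘ (+ suc n) 0 ℚᵘ.* ℚᵘ.mkℚᵘ (+ 1) (b ℕ.+ n ℕ.* suc b)}
                   {ℚᵘ.mkℚᵘ (+ 1) b} (ℚᵘ.*≡* (cong +_ nat)))
    where
    nat : suc n ℕ.* 1 ℕ.* suc b ≡ 1 ℕ.* (1 ℕ.* (suc n ℕ.* suc b))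
    nat = trans (cong (ℕ._* suc b) (ℕ.*-identityʳ (suc n)))
                (sym (trans (ℕ.*-identityˡ _) (ℕ.*-identityˡ _)))

1/!-pos : ∀ n → 0ℚ < 1/ n !
1/!-pos n = ℚ.positive⁻¹ _ {{ℚ.normalize-pos 1 (n !) {{n ℕ.!≢0}}}}

------------------------------------------------------------------------
-- The real numbers, as Cauchy sequences of rationals

Cauchy : (ℕ → ℚ) → Set
Cauchy x = ∀ ε → 0ℚ < ε →
  Σ[ N ∈ ℕ ] (∀ {m n} → N ℕ.≤ m → N ℕ.≤ n → ∣ x m - x n ∣ ≤ ε)

record ℝ : Set where
  constructor mkℝ
  field
    seq    : ℕ → ℚ
    cauchy : Cauchy seq

open ℝ public

infix 4 _≤ℝ_ _≃_

_≤ℝ_ : ℝ → ℝ → Set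
x ≤ℝ y = ∀ ε → 0ℚ < ε → Σ[ N ∈ ℕ ] (∀ {n} → N ℕ.≤ n → seq x n ≤ seq y n + ε)

_≃_ : ℝ → ℝ → Set
x ≃ y = x ≤ℝ y × y ≤ℝ x

bounded : ∀ (x : ℕ → ℚ) → Cauchy x →
  Σ[ N ∈ ℕ ] Σ[ B ∈ ℚ ] 0ℚ < B × (∀ {n} → N ℕ.≤ n → ∣ x n ∣ ≤ B)
bounded x c with c 1ℚ 0<1
... | N , h = N , 1ℚ + ∣ x N ∣
            , ℚ.<-≤-trans 0<1 (≤-+ʳ (ℚ.0≤∣p∣ (x N)))
            , λ {n} N≤n → ℚ.≤-trans (∣p∣≤∣p-q∣+∣q∣ (x n) (x N))
                                    (ℚ.+-monoˡ-≤ ∣ x N ∣ (h N≤n ℕ.≤-refl))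

fromℚ : ℚ → ℝ
fromℚ q = mkℝ (λ _ → q) λ ε 0<ε → 0 , λ _ _ →
  ℚ.≤-trans (ℚ.≤-reflexive (cong ∣_∣ (ℚ.+-inverseʳ q))) (ℚ.<⇒≤ 0<ε)

0ℝ 1ℝ : ℝ
0ℝ = fromℚ 0ℚ
1ℝ = fromℚ 1ℚ

infixl 6 _+ℝ_ _-ℝ_
infixl 7 _*ℝ_
infix  8 -ℝ_

_+ℝ_ : ℝ → ℝ → ℝ
x +ℝ y = mkℝ (λ n → seq x n + seq y n) prf
  where
  prf : Cauchy (λ n → seq x n + seq y n)
  prf ε 0<ε with cauchy x (½ * ε) (½ε>0 0<ε) | cauchy y (½ * ε) (½ε>0 0<ε)
  ... | N , hx | M , hy = N ℕ.⊔ M , λ {m} {n} p q →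
    subst₂ _≤_ (cong ∣_∣ (+-interchange (seq x m) (seq y m) (seq x n) (seq y n)))
               (½+½ ε)
      (ℚ.≤-trans (ℚ.∣p+q∣≤∣p∣+∣q∣ (seq x m - seq x n) (seq y m - seq y n))
        (ℚ.+-mono-≤ (hx (ℕ.m⊔n≤o⇒m≤o N M p) (ℕ.m⊔n≤o⇒m≤o N M q))
                    (hy (ℕ.m⊔n≤o⇒n≤o N M p) (ℕ.m⊔n≤o⇒n≤o N M q))))

-ℝ_ : ℝ → ℝ
-ℝ x = mkℝ (λ n → - seq x n) prf
  where
  prf : Cauchy (λ n → - seq x n)
  prf ε 0<ε with cauchy x ε 0<ε
  ... | N , h = N , λ {m} {n} p q → subst (_≤ ε)
    (cong ∣_∣ (neg-swap (seq x m) (seq x n)))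
    (h q p)

_-ℝ_ : ℝ → ℝ → ℝ
x -ℝ y = x +ℝ (-ℝ y)

_*ℝ_ : ℝ → ℝ → ℝ
x *ℝ y = mkℝ (λ n → seq x n * seq y n) prf
  where
  prf : Cauchy (λ n → seq x n * seq y n)
  prf ε 0<ε = N , close
    where
    bx = bounded (seq x) (cauchy x)
    by = bounded (seq y) (cauchy y)
    Nx = proj₁ bx
    Ny = proj₁ by
    A = proj₁ (proj₂ bx)
    B = proj₁ (proj₂ by)
    0<A = proj₁ (proj₂ (proj₂ bx))
    0<B = proj₁ (proj₂ (proj₂ by))
    hA = proj₂ (proj₂ (proj₂ bx))
    hB = proj₂ (proj₂ (proj₂ by))
    δ,h = scale {ε} {A + B} 0<ε (ℚ.<-≤-trans 0<A (≤-+ʳ (ℚ.<⇒≤ 0<B)))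
    δ = proj₁ δ,h
    x,h = cauchy x δ (proj₁ (proj₂ δ,h))
    y,h = cauchy y δ (proj₁ (proj₂ δ,h))
    N₁ = Nx ℕ.⊔ Ny
    N₂ = proj₁ x,h ℕ.⊔ proj₁ y,h
    N = N₁ ℕ.⊔ N₂
    close : ∀ {m n} → N ℕ.≤ m → N ℕ.≤ n → ∣ seq x m * seq y m - seq x n * seq y n ∣ ≤ ε
    close {m} {n} p q = subst (_ ≤_) (proj₂ (proj₂ δ,h))
      (product-close (ℚ.<⇒≤ (proj₁ (proj₂ δ,h)))
        (hA (ℕ.m⊔n≤o⇒m≤o Nx Ny (ℕ.m⊔n≤o⇒m≤o N₁ N₂ p)))
        (hB (ℕ.m⊔n≤o⇒n≤o Nx Ny (ℕ.m⊔n≤o⇒m≤o N₁ N₂ q)))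
        (proj₂ y,h (ℕ.m⊔n≤o⇒n≤o _ _ (ℕ.m⊔n≤o⇒n≤o N₁ N₂ p)) (ℕ.m⊔n≤o⇒n≤o _ _ (ℕ.m⊔n≤o⇒n≤o N₁ N₂ q)))
        (proj₂ x,h (ℕ.m⊔n≤o⇒m≤o _ _ (ℕ.m⊔n≤o⇒n≤o N₁ N₂ p)) (ℕ.m⊔n≤o⇒m≤o _ _ (ℕ.m⊔n≤o⇒n≤o N₁ N₂ q))))

∣_∣ℝ : ℝ → ℝ
∣ x ∣ℝ = mkℝ (λ n → ∣ seq x n ∣) prf
  where
  prf : Cauchy (λ n → ∣ seq x n ∣)
  prf ε 0<ε with cauchy x ε 0<ε
  ... | N , h = N , λ {m} {n} p q → ℚ.≤-trans (∣∣-reverse (seq x m) (seq x n)) (h p q)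

ℝ-rawSemiring : RawSemiring 0ℓ 0ℓ
ℝ-rawSemiring = record { _≈_ = _≃_ ; _+_ = _+ℝ_ ; _*_ = _*ℝ_ ; 0# = 0ℝ ; 1# = 1ℝ }

module ℝ-Ops = RawSemiringOps ℝ-rawSemiring
open ℝ-Ops public using () renaming (_^_ to _^ℝ_; sum to sumℝ; product to productℝ)

------------------------------------------------------------------------
-- The exponential function

expTerm : ℚ → ℕ → ℚ
expTerm q j = q ^ℚ j * 1/ j !

expSum : ℚ → ℕ → ℚ
expSum q zero    = 0ℚ
expSum q (suc n) = expSum q n + expTerm q n

expTerm-suc : ∀ q j → fromℕℚ (suc j) * expTerm q (suc j) ≡ q * expTerm q j
expTerm-suc q j = begin
  s * ((q * q ^ℚ j) * 1/ (suc j) !)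
    ≡⟨ solve 4 (λ s q p f → s :* ((q :* p) :* f) := q :* (p :* (s :* f))) refl
         s q (q ^ℚ j) (1/ (suc j) !) ⟩
  q * (q ^ℚ j * (s * 1/ (suc j) !))
    ≡⟨ cong (λ z → q * (q ^ℚ j * z)) (1/!-suc j) ⟩
  q * (q ^ℚ j * 1/ j !) ∎
  where
  open ≡-Reasoning
  s = fromℕℚ (suc j)

module ExpBound {B : ℚ} (0≤B : 0ℚ ≤ B) where

  u : ℕ → ℚ
  u = expTerm B

  S : ℕ → ℚ
  S = expSum B

  ^-nonneg : ∀ j → 0ℚ ≤ B ^ℚ j
  ^-nonneg zero    = ℚ.<⇒≤ 0<1
  ^-nonneg (suc j) = *-nonneg 0≤B (^-nonneg j)

  u-nonneg : ∀ j → 0ℚ ≤ u j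
  u-nonneg j = *-nonneg (^-nonneg j) (ℚ.<⇒≤ (1/!-pos j))

  S-mono : ∀ {m n} → m ℕ.≤′ n → S m ≤ S n
  S-mono ℕ.≤′-refl       = ℚ.≤-refl
  S-mono (ℕ.≤′-step {n} m≤n) = ℚ.≤-trans (S-mono m≤n) (≤-+ʳ (u-nonneg n))

  cancel-suc : ∀ j {a b} → fromℕℚ (suc j) * a ≤ fromℕℚ (suc j) * b → a ≤ b
  cancel-suc j = ℚ.*-cancelˡ-≤-pos (fromℕℚ (suc j)) {{ℚ.positive (fromℕℚ-pos j)}}

  ^-bound : ∀ {q} → ∣ q ∣ ≤ B → ∀ j → ∣ q ^ℚ j ∣ ≤ B ^ℚ j
  ^-bound {q} q≤B zero    = ℚ.≤-refl
  ^-bound {q} q≤B (suc j) =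
    ℚ.≤-trans (ℚ.≤-reflexive (ℚ.∣p*q∣≡∣p∣*∣q∣ q (q ^ℚ j)))
              (*-mono-≤ (ℚ.0≤∣p∣ q) (^-nonneg j) q≤B (^-bound q≤B j))

  term-bound : ∀ {q} → ∣ q ∣ ≤ B → ∀ j → ∣ expTerm q j ∣ ≤ u j
  term-bound {q} q≤B j = ℚ.≤-trans
    (ℚ.≤-reflexive (trans (ℚ.∣p*q∣≡∣p∣*∣q∣ (q ^ℚ j) (1/ j !))
      (cong (∣ q ^ℚ j ∣ *_) (ℚ.0≤p⇒∣p∣≡p (ℚ.<⇒≤ (1/!-pos j))))))
    (*-mono-≤ (ℚ.0≤∣p∣ _) (ℚ.<⇒≤ (1/!-pos j)) (^-bound q≤B j) ℚ.≤-refl)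

  tail : ∀ {q} → ∣ q ∣ ≤ B → ∀ {m n} → m ℕ.≤′ n → ∣ expSum q n - expSum q m ∣ ≤ S n - S m
  tail {q} q≤B {m} ℕ.≤′-refl =
    ℚ.≤-reflexive (trans (cong ∣_∣ (ℚ.+-inverseʳ (expSum q m))) (sym (ℚ.+-inverseʳ (S m))))
  tail {q} q≤B {m} (ℕ.≤′-step {n} m≤n) = begin
    ∣ (expSum q n + t) - expSum q m ∣
      ≡⟨ cong ∣_∣ (solve 3 (λ a t b → (a :+ t) :- b := (a :- b) :+ t) refl
                     (expSum q n) t (expSum q m)) ⟩
    ∣ (expSum q n - expSum q m) + t ∣
      ≤⟨ ℚ.∣p+q∣≤∣p∣+∣q∣ (expSum q n - expSum q m) t ⟩
    ∣ expSum q n - expSum q m ∣ + ∣ t ∣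
      ≤⟨ ℚ.+-mono-≤ (tail q≤B m≤n) (term-bound q≤B n) ⟩
    (S n - S m) + u n
      ≡⟨ solve 3 (λ a t b → (a :- b) :+ t := (a :+ t) :- b) refl (S n) (u n) (S m) ⟩
    (S n + u n) - S m ∎
    where
    open ℚ.≤-Reasoning
    t = expTerm q n

  lipschitz-term : ∀ {p q} → ∣ p ∣ ≤ B → ∣ q ∣ ≤ B →
    ∀ j → ∣ expTerm p (suc j) - expTerm q (suc j) ∣ ≤ ∣ p - q ∣ * u j
  lipschitz-sum-step : ∀ {p q} → ∣ p ∣ ≤ B → ∣ q ∣ ≤ B →
    ∀ j → B * ∣ expTerm p j - expTerm q j ∣ ≤ fromℕℚ j * (∣ p - q ∣ * u j)

  lipschitz-sum-step {p} {q} p≤B q≤B zero =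
    ℚ.≤-reflexive (trans (ℚ.*-zeroʳ B) (sym (ℚ.*-zeroˡ (∣ p - q ∣ * u 0))))
  lipschitz-sum-step {p} {q} p≤B q≤B (suc j) = begin
    B * ∣ expTerm p (suc j) - expTerm q (suc j) ∣
      ≤⟨ ℚ.*-monoˡ-≤-nonNeg B {{ℚ.nonNegative 0≤B}} (lipschitz-term p≤B q≤B j) ⟩
    B * (d * u j)
      ≡⟨ solve 3 (λ B d u → B :* (d :* u) := d :* (B :* u)) refl B d (u j) ⟩
    d * (B * u j)
      ≡⟨ cong (d *_) (sym (expTerm-suc B j)) ⟩
    d * (fromℕℚ (suc j) * u (suc j))
      ≡⟨ solve 3 (λ d s u → d :* (s :* u) := s :* (d :* u)) refl d (fromℕℚ (suc j)) (u (suc j)) ⟩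
    fromℕℚ (suc j) * (d * u (suc j)) ∎
    where
    open ℚ.≤-Reasoning
    d = ∣ p - q ∣

  lipschitz-term {p} {q} p≤B q≤B j = cancel-suc j (begin
    s * ∣ tp′ - tq′ ∣
      ≡⟨ cong (_* ∣ tp′ - tq′ ∣) (sym (ℚ.0≤p⇒∣p∣≡p (ℚ.<⇒≤ (fromℕℚ-pos j)))) ⟩
    ∣ s ∣ * ∣ tp′ - tq′ ∣
      ≡⟨ sym (ℚ.∣p*q∣≡∣p∣*∣q∣ s (tp′ - tq′)) ⟩
    ∣ s * (tp′ - tq′) ∣
      ≡⟨ cong ∣_∣ (trans (solve 3 (λ s a b → s :* (a :- b) := s :* a :- s :* b) refl s tp′ tq′)
                         (cong₂ _-_ (expTerm-suc p j) (expTerm-suc q j))) ⟩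
    ∣ p * tp - q * tq ∣
      ≡⟨ cong ∣_∣ (solve 4 (λ p a q b → p :* a :- q :* b := (p :- q) :* a :+ q :* (a :- b))
                     refl p tp q tq) ⟩
    ∣ (p - q) * tp + q * (tp - tq) ∣
      ≤⟨ ℚ.∣p+q∣≤∣p∣+∣q∣ ((p - q) * tp) (q * (tp - tq)) ⟩
    ∣ (p - q) * tp ∣ + ∣ q * (tp - tq) ∣
      ≡⟨ cong₂ _+_ (ℚ.∣p*q∣≡∣p∣*∣q∣ (p - q) tp) (ℚ.∣p*q∣≡∣p∣*∣q∣ q (tp - tq)) ⟩
    d * ∣ tp ∣ + ∣ q ∣ * ∣ tp - tq ∣
      ≤⟨ ℚ.+-mono-≤
           (ℚ.*-monoˡ-≤-nonNeg d {{ℚ.nonNegative (ℚ.0≤∣p∣ (p - q))}} (term-bound p≤B j))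
           (ℚ.≤-trans
             (ℚ.*-monoʳ-≤-nonNeg ∣ tp - tq ∣ {{ℚ.nonNegative (ℚ.0≤∣p∣ (tp - tq))}} q≤B)
             (lipschitz-sum-step p≤B q≤B j)) ⟩
    d * u j + fromℕℚ j * (d * u j)
      ≡⟨ solve 2 (λ a i → a :+ i :* a := (con 1ℚ :+ i) :* a) refl (d * u j) (fromℕℚ j) ⟩
    (1ℚ + fromℕℚ j) * (d * u j)
      ≡⟨ cong (_* (d * u j)) (sym (fromℕℚ-suc j)) ⟩
    s * (d * u j) ∎)
    where
    open ℚ.≤-Reasoning
    d = ∣ p - q ∣
    s = fromℕℚ (suc j)
    tp = expTerm p j
    tq = expTerm q j
    tp′ = expTerm p (suc j)
    tq′ = expTerm q (suc j)

  lipschitz : ∀ {p q} → ∣ p ∣ ≤ B → ∣ q ∣ ≤ B →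
    ∀ n → ∣ expSum p n - expSum q n ∣ ≤ ∣ p - q ∣ * S n
  lipschitz {p} {q} p≤B q≤B n = ℚ.≤-trans (go n)
    (ℚ.*-monoˡ-≤-nonNeg ∣ p - q ∣ {{ℚ.nonNegative (ℚ.0≤∣p∣ (p - q))}} (S-mono (pred≤′ n)))
    where
    open ℚ.≤-Reasoning
    pred≤′ : ∀ n → ℕ.pred n ℕ.≤′ n
    pred≤′ zero    = ℕ.≤′-refl
    pred≤′ (suc n) = ℕ.≤′-step ℕ.≤′-refl
    go : ∀ n → ∣ expSum p n - expSum q n ∣ ≤ ∣ p - q ∣ * S (ℕ.pred n)
    go zero          = ℚ.≤-reflexive (sym (ℚ.*-zeroʳ ∣ p - q ∣))
    go (suc zero)    = ℚ.≤-reflexive (sym (ℚ.*-zeroʳ ∣ p - q ∣))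
    go (suc (suc n)) = begin
      ∣ (expSum p (suc n) + expTerm p (suc n)) - (expSum q (suc n) + expTerm q (suc n)) ∣
        ≡⟨ cong ∣_∣ (solve 4 (λ a b c d → (a :+ b) :- (c :+ d) := (a :- c) :+ (b :- d)) refl
             (expSum p (suc n)) (expTerm p (suc n)) (expSum q (suc n)) (expTerm q (suc n))) ⟩
      ∣ (expSum p (suc n) - expSum q (suc n)) + (expTerm p (suc n) - expTerm q (suc n)) ∣
        ≤⟨ ℚ.∣p+q∣≤∣p∣+∣q∣ (expSum p (suc n) - expSum q (suc n))
                           (expTerm p (suc n) - expTerm q (suc n)) ⟩
      ∣ expSum p (suc n) - expSum q (suc n) ∣ + ∣ expTerm p (suc n) - expTerm q (suc n) ∣
        ≤⟨ ℚ.+-mono-≤ (go (suc n)) (lipschitz-term p≤B q≤B n) ⟩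
      ∣ p - q ∣ * S n + ∣ p - q ∣ * u n
        ≡⟨ sym (ℚ.*-distribˡ-+ ∣ p - q ∣ (S n) (u n)) ⟩
      ∣ p - q ∣ * (S n + u n) ∎

  -- From M on, where M + 1 ≥ 2B, the terms at least halve, so S n + 2 u n decreases.

  M : ℕ
  M = proj₁ (archimedean (B + B))

  D : ℕ → ℚ
  D n = S n + (u n + u n)

  halving : ∀ {n} → M ℕ.≤ n → u (suc n) + u (suc n) ≤ u n
  halving {n} M≤n = cancel-suc n (begin
    s * (u (suc n) + u (suc n))
      ≡⟨ ℚ.*-distribˡ-+ s (u (suc n)) (u (suc n)) ⟩
    s * u (suc n) + s * u (suc n)
      ≡⟨ cong₂ _+_ (expTerm-suc B n) (expTerm-suc B n) ⟩
    B * u n + B * u n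
      ≡⟨ sym (ℚ.*-distribʳ-+ (u n) B B) ⟩
    (B + B) * u n
      ≤⟨ ℚ.*-monoʳ-≤-nonNeg (u n) {{ℚ.nonNegative (u-nonneg n)}}
           (ℚ.≤-trans (proj₂ (archimedean (B + B))) (fromℕℚ-mono (ℕ.m≤n⇒m≤1+n M≤n))) ⟩
    s * u n ∎)
    where
    open ℚ.≤-Reasoning
    s = fromℕℚ (suc n)

  D-anti : ∀ {m n} → M ℕ.≤ m → m ℕ.≤′ n → D n ≤ D m
  D-anti M≤m ℕ.≤′-refl = ℚ.≤-refl
  D-anti {m} M≤m (ℕ.≤′-step {n} m≤n) = ℚ.≤-trans
    (subst (D (suc n) ≤_) (ℚ.+-assoc (S n) (u n) (u n))
      (ℚ.+-monoʳ-≤ (S n + u n) (halving (ℕ.≤-trans M≤m (ℕ.≤′⇒≤ m≤n)))))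
    (D-anti M≤m m≤n)

  S≤D : ∀ {m n} → M ℕ.≤ m → m ℕ.≤′ n → S n ≤ D m
  S≤D {n = n} M≤m m≤n = ℚ.≤-trans (≤-+ʳ (+-nonneg (u-nonneg n) (u-nonneg n))) (D-anti M≤m m≤n)

  tail≤2u : ∀ {m n} → M ℕ.≤ m → m ℕ.≤′ n → S n - S m ≤ u m + u m
  tail≤2u {m} {n} M≤m m≤n = ≤+⇒-≤ (subst (S n ≤_) (ℚ.+-comm (S m) (u m + u m)) (S≤D M≤m m≤n))

  u-anti : ∀ {m} → M ℕ.≤′ m → u m ≤ u M
  u-anti ℕ.≤′-refl         = ℚ.≤-refl
  u-anti (ℕ.≤′-step {m} h) = ℚ.≤-trans
    (ℚ.≤-trans (≤-+ʳ (u-nonneg (suc m))) (halving (ℕ.≤′⇒≤ h))) (u-anti h)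

  2u-small : ∀ ε → 0ℚ < ε → Σ[ N ∈ ℕ ] (∀ {m} → N ℕ.≤ m → M ℕ.≤ m × u m + u m ≤ ε)
  2u-small ε 0<ε = suc (M ℕ.⊔ k) , bound
    where
    C = (B * u M + B * u M) + 1ℚ
    0<C : 0ℚ < C
    0<C = ℚ.<-≤-trans 0<1 (≤-+ˡ (+-nonneg (*-nonneg 0≤B (u-nonneg M)) (*-nonneg 0≤B (u-nonneg M))))
    δ,h = scale {C} {ε} 0<C 0<ε
    δ = proj₁ δ,h
    εδ≡C = proj₂ (proj₂ δ,h)
    k = proj₁ (archimedean δ)
    δ≤k = proj₂ (archimedean δ)
    open ℚ.≤-Reasoning
    bound : ∀ {m} → suc (M ℕ.⊔ k) ℕ.≤ m → M ℕ.≤ m × u m + u m ≤ ε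
    bound {suc j} (ℕ.s≤s h) = ℕ.m≤n⇒m≤1+n M≤j , cancel-suc j (begin
      s * (u (suc j) + u (suc j))
        ≡⟨ ℚ.*-distribˡ-+ s (u (suc j)) (u (suc j)) ⟩
      s * u (suc j) + s * u (suc j)
        ≡⟨ cong₂ _+_ (expTerm-suc B j) (expTerm-suc B j) ⟩
      B * u j + B * u j
        ≤⟨ ℚ.+-mono-≤ Bu≤ Bu≤ ⟩
      B * u M + B * u M
        ≤⟨ ≤-+ʳ (ℚ.<⇒≤ 0<1) ⟩
      (B * u M + B * u M) + 1ℚ
        ≡⟨ sym εδ≡C ⟩
      ε * δ
        ≤⟨ ℚ.*-monoˡ-≤-nonNeg ε {{ℚ.nonNegative (ℚ.<⇒≤ 0<ε)}}
             (ℚ.≤-trans δ≤k (fromℕℚ-mono (ℕ.m≤n⇒m≤1+n (ℕ.m⊔n≤o⇒n≤o M k h)))) ⟩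
      ε * s
        ≡⟨ ℚ.*-comm ε s ⟩
      s * ε ∎)
      where
      s = fromℕℚ (suc j)
      M≤j = ℕ.m⊔n≤o⇒m≤o M k h
      Bu≤ : B * u j ≤ B * u M
      Bu≤ = ℚ.*-monoˡ-≤-nonNeg B {{ℚ.nonNegative 0≤B}} (u-anti (ℕ.≤⇒≤′ M≤j))

-- The n-th approximant is the n-th partial sum of the exponential series,
-- evaluated at the n-th approximant of x.

exp : ℝ → ℝ
exp x = mkℝ (λ n → expSum (seq x n) n) prf
  where
  prf : Cauchy (λ n → expSum (seq x n) n)
  prf ε 0<ε = N , close
    where
    bx = bounded (seq x) (cauchy x)
    N₀ = proj₁ bx
    x≤B = proj₂ (proj₂ (proj₂ bx))

    open ExpBound (ℚ.<⇒≤ (proj₁ (proj₂ (proj₂ bx))))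

    0≤S : ∀ n → 0ℚ ≤ S n
    0≤S n = S-mono {0} {n} ℕ.z≤′n

    0≤D : 0ℚ ≤ D M
    0≤D = +-nonneg (0≤S M) (+-nonneg (u-nonneg M) (u-nonneg M))

    K = D M + 1ℚ

    δ,h = scale {½ * ε} {K} (½ε>0 0<ε) (ℚ.<-≤-trans 0<1 (≤-+ˡ 0≤D))
    δ = proj₁ δ,h
    N₁,h = cauchy x δ (proj₁ (proj₂ δ,h))
    N₂,h = 2u-small (½ * ε) (½ε>0 0<ε)

    N = N₀ ℕ.⊔ (proj₁ N₁,h ℕ.⊔ proj₁ N₂,h)

    open ℚ.≤-Reasoning

    ordered : ∀ {m n} → N ℕ.≤ m → N ℕ.≤ n → m ℕ.≤ n →
              ∣ expSum (seq x n) n - expSum (seq x m) m ∣ ≤ ε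
    ordered {m} {n} N≤m N≤n m≤n = begin
      ∣ expSum q n - expSum p m ∣
        ≤⟨ ∣∣-triangle (expSum q n) (expSum q m) (expSum p m) ⟩
      ∣ expSum q n - expSum q m ∣ + ∣ expSum q m - expSum p m ∣
        ≤⟨ ℚ.+-mono-≤
             (ℚ.≤-trans (tail q≤B (ℕ.≤⇒≤′ m≤n))
               (ℚ.≤-trans (tail≤2u M≤m (ℕ.≤⇒≤′ m≤n)) 2u≤))
             (ℚ.≤-trans (lipschitz q≤B p≤B m)
               (*-mono-≤ (ℚ.0≤∣p∣ (q - p)) 0≤K
                 (proj₂ N₁,h (ℕ.m⊔n≤o⇒m≤o _ (proj₁ N₂,h) n₁₂) (ℕ.m⊔n≤o⇒m≤o _ (proj₁ N₂,h) m₁₂))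
                 S≤K)) ⟩
      ½ * ε + δ * K
        ≡⟨ cong (λ z → ½ * ε + z) (trans (ℚ.*-comm δ K) (proj₂ (proj₂ δ,h))) ⟩
      ½ * ε + ½ * ε
        ≡⟨ ½+½ ε ⟩
      ε ∎
      where
      p = seq x m
      q = seq x n
      p≤B = x≤B (ℕ.m⊔n≤o⇒m≤o N₀ _ N≤m)
      q≤B = x≤B (ℕ.m⊔n≤o⇒m≤o N₀ _ N≤n)
      m₁₂ = ℕ.m⊔n≤o⇒n≤o N₀ _ N≤m
      n₁₂ = ℕ.m⊔n≤o⇒n≤o N₀ _ N≤n
      small = proj₂ N₂,h (ℕ.m⊔n≤o⇒n≤o (proj₁ N₁,h) _ m₁₂)
      M≤m = proj₁ small
      2u≤ = proj₂ small
      0≤K = +-nonneg 0≤D (ℚ.<⇒≤ 0<1)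
      S≤K : S m ≤ K
      S≤K = ℚ.≤-trans (S≤D ℕ.≤-refl (ℕ.≤⇒≤′ M≤m)) (≤-+ʳ (ℚ.<⇒≤ 0<1))

    close : ∀ {m n} → N ℕ.≤ m → N ℕ.≤ n → ∣ expSum (seq x m) m - expSum (seq x n) n ∣ ≤ ε
    close {m} {n} N≤m N≤n = by-cases (ℕ.≤-total m n)
      where
      by-cases : m ℕ.≤ n ⊎ n ℕ.≤ m → ∣ expSum (seq x m) m - expSum (seq x n) n ∣ ≤ ε
      by-cases (inj₁ m≤n) = subst (_≤ ε) (∣∣-swap (expSum (seq x n) n) (expSum (seq x m) m))
                                  (ordered N≤m N≤n m≤n)
      by-cases (inj₂ n≤m) = ordered N≤n N≤m n≤m

------------------------------------------------------------------------
-- Riemann integrals over cubes, and improper integrals over [0,+∞)ᵏ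

record Partition (a b : ℝ) : Set where
  field
    size  : ℕ
    point : Vector ℝ (suc size)
    first : point zero ≃ a
    last  : point (fromℕ size) ≃ b
    mono  : ∀ (i : Fin size) → point (inject₁ i) ≤ℝ point (suc i)

  lower upper width : Vector ℝ size
  lower i = point (inject₁ i)
  upper i = point (suc i)
  width i = upper i -ℝ lower i

open Partition public

-- A partition of every edge of the cube [a,b]ᵏ; a cell is a choice of one
-- subinterval on every edge.

Grid : ℕ → ℝ → ℝ → Set
Grid k a b = Fin k → Partition a b

Cell : ∀ {k a b} → Grid k a b → Set
Cell P = ∀ i → Fin (size (P i))

volume : ∀ {k a b} (P : Grid k a b) → Cell P → ℝ
volume P c = productℝ (λ i → width (P i) (c i))

Mesh≤ : ∀ {k a b} → Grid k a b → ℚ → Set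
Mesh≤ P δ = ∀ i j → width (P i) j ≤ℝ fromℚ δ

_∈Cell_ : ∀ {k a b} {P : Grid k a b} → Vector ℝ k → Cell P → Set
_∈Cell_ {P = P} x c = ∀ i → lower (P i) (c i) ≤ℝ x i × x i ≤ℝ upper (P i) (c i)

sumCells : ∀ {k} (n : Fin k → ℕ) → ((∀ i → Fin (n i)) → ℝ) → ℝ
sumCells {zero}  n F = F (λ ())
sumCells {suc k} n F =
  sumℝ (λ j → sumCells (λ i → n (suc i)) (λ c → F (Fin.∀-cons j c)))

riemannSum : ∀ {k a b} → (Vector ℝ k → ℝ) → (P : Grid k a b) → (Cell P → Vector ℝ k) → ℝ
riemannSum f P tag = sumCells (λ i → size (P i)) (λ c → f (tag c) *ℝ volume P c)

IsIntegralOverCube : ∀ {k} → (Vector ℝ k → ℝ) → ℝ → ℝ → ℝ → Set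
IsIntegralOverCube {k} f a b I =
  ∀ ε → 0ℚ < ε → Σ[ δ ∈ ℚ ] 0ℚ < δ ×
    ((P : Grid k a b) → Mesh≤ P δ →
     (tag : Cell P → Vector ℝ k) → (∀ c → _∈Cell_ {P = P} (tag c) c) →
     ∣ riemannSum f P tag -ℝ I ∣ℝ ≤ℝ fromℚ ε)

TendsTo : (ℝ → ℝ) → ℝ → Set
TendsTo g L = ∀ ε → 0ℚ < ε →
  Σ[ M ∈ ℚ ] (∀ R → fromℚ M ≤ℝ R → ∣ g R -ℝ L ∣ℝ ≤ℝ fromℚ ε)

-- ∫_{[0,+∞)ᵏ} f = lim_{R→+∞} ∫_{[0,R]ᵏ} f.  For continuous f ≥ 0 this is the
-- Lebesgue integral, by monotone convergence; for f of variable sign,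
-- exhausting the orthant by cubes only would be weaker than integrability.

IsIntegralOverOrthant : ∀ {k} → (Vector ℝ k → ℝ) → ℝ → Set
IsIntegralOverOrthant f L = Σ[ I ∈ (ℝ → ℝ) ]
  (∀ R → 0ℝ ≤ℝ R → IsIntegralOverCube f 0ℝ R (I R)) × TendsTo I L

------------------------------------------------------------------------
-- Both sides of the formula

e₁ : ∀ {k} → Vector ℝ k → ℝ
e₁ x = sumℝ x

e₂ : ∀ {k} → Vector ℝ k → ℝ
e₂ x = sumℝ λ i → sumℝ λ j → if does (i Fin.<? j) then x i *ℝ x j else 0ℝ

rising : ℚ → ℕ → ℚ
rising y m = productℚ {m} (λ i → y + fromℕℚ (toℕ i))

productℚ-pos : ∀ {n} (v : Vector ℚ n) → (∀ i → 0ℚ < v i) → 0ℚ < productℚ v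
productℚ-pos {zero}  v h = 0<1
productℚ-pos {suc n} v h = ℚ.positive⁻¹ _ {{ℚ.pos*pos⇒pos (v zero) (productℚ (λ i → v (suc i)))}}
  where
  instance
    _ = ℚ.positive (h zero)
    _ = ℚ.positive (productℚ-pos (λ i → v (suc i)) (λ i → h (suc i)))

0≤fromℕℚ : ∀ n → 0ℚ ≤ fromℕℚ n
0≤fromℕℚ n = fromℕℚ-mono {0} {n} ℕ.z≤n

rising-nonZero : ∀ k .{{_ : ℕ.NonZero k}} m → ℚ.NonZero (rising (+ k / 2) m)
rising-nonZero k m = ℚ.>-nonZero {rising (+ k / 2) m} (productℚ-pos {m} _
  (λ i → ℚ.<-≤-trans {0ℚ} {+ k / 2} (ℚ.positive⁻¹ (+ k / 2) {{ℚ.normalize-pos k 2}})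
                     (≤-+ʳ {+ k / 2} (0≤fromℕℚ (toℕ i)))))

-- (k(k-2))ᵐ ((k-1)/2)ₘ / ((k-1)²ᵐ (k/2)ₘ) for k = 2 + j.

ratio : ℕ → ℕ → ℚ
ratio j m =
  (+ (((2 ℕ.+ j) ℕ.* j) ℕ.^ m) / (suc j ℕ.^ (2 ℕ.* m))) {{ℕ.m^n≢0 (suc j) (2 ℕ.* m)}}
  * (rising (+ suc j / 2) m ÷ rising (+ (2 ℕ.+ j) / 2) m) {{rising-nonZero (2 ℕ.+ j) m}}

-- T k m is T_k(m); the value at k = 0 is a placeholder.  The value T_1(0) = 0
-- never enters the recurrence.  With it the integral formula fails at k = 1,
-- m = 0, where e₂⁰ = 1 gives the integral n! but the right-hand side is 0.

T : ℕ → ℕ → ℚ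
T zero          m       = 0ℚ
T (suc zero)    m       = 0ℚ
T (suc (suc j)) zero    = 1ℚ
T (suc (suc j)) (suc m) = T (suc (suc j)) m + ratio j (suc m) * T (suc j) (suc m)

{-# OPTIONS --safe #-}
-- Splitting off one variable t turns e₂ into e₂ + t e₁ and e₁ into e₁ + t, so the
-- integrals of e₂ᵐ e₁ⁿ exp(-e₁) over the orthants of successive dimensions are
-- linked by one-dimensional gamma integrals ∫ tᵃ e⁻ᵗ dt = a!, obtained from explicit
-- antiderivatives.  Two identities determine the resulting rational moments:
-- Euler's, by homogeneity, and integration by parts for ∂₁ + ⋯ + ∂ₖ, which maps
-- e₁ to k and e₂ to (k-1) e₁ and whose boundary terms are integrals in
-- dimension k-1.  Writing J k m for the integral of e₂ᵐ exp(-e₁), they give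
-- k J k m = m (k-1) (2m+k-2) J k (m-1) + k J (k-1) m, which is the recurrence
-- for T after rescaling.
module Submission where

open import Defs
open import Data.Integer.Base using (+_)
open import Data.Nat.Base using (ℕ; NonZero; _+_; _*_; _∸_; _!)
open import Data.Nat.Properties using (_!≢0)
open import Data.Product.Base using (_×_)
open import Data.Rational.Base using (_/_) renaming (_*_ to _*ℚ_)
open import Relation.Binary.PropositionalEquality using (_≡_)
open import Relation.Nullary using (¬_)

open import Algebra.Bundles.Raw using (RawSemiring)
import Algebra.Definitions.RawSemiring as RawSemiringOps
import Algebra.Solver.Ring as RingSolver
open import Algebra.Solver.Ring.AlmostCommutativeRing using (AlmostCommutativeRing; _-Raw-AlmostCommutative⟶_)
import Algebra.Structures.Biased
open import Data.Bool.Base using (if_then_else_)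
open import Data.Empty using (⊥-elim)
open import Data.Fin.Base using (Fin; zero; suc; toℕ; fromℕ; inject₁)
import Data.Fin.Properties as Fin
import Data.Integer.Base as ℤ
import Data.Integer.Properties as ℤ
open import Data.Maybe.Base as Maybe using (Maybe)
open import Data.Nat.Base as ℕ using (zero; suc)
import Data.Nat.Properties as ℕ
import Data.Nat.Solver as ℕ
open import Data.Product.Base using (Σ-syntax; _,_; proj₁; proj₂)
open import Data.Rational.Base as ℚ
  using (ℚ; 0ℚ; 1ℚ; ½; ∣_∣; _÷_)
  renaming (_+_ to _+ℚ_; _-_ to _-ℚ_; -_ to -ℚ_; _≤_ to _≤ℚ_; _<_ to _<ℚ_)
import Data.Rational.Properties as ℚ
import Data.Rational.Unnormalised.Base as ℚᵘ
open import Data.Rational.Solver using (module +-*-Solver)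
open import Data.Sum.Base using (_⊎_; inj₁; inj₂)
open import Data.Vec.Functional using (Vector)
open import Level using (0ℓ)
open import Relation.Binary.Bundles using (Preorder)
open import Relation.Binary.Structures using (IsEquivalence)
open import Relation.Binary.PropositionalEquality using (refl; sym; trans; cong; cong₂; subst; subst₂; module ≡-Reasoning)
import Relation.Binary.Reasoning.Preorder as PreorderReasoning
open import Relation.Nullary.Decidable.Core using (dec⇒maybe; does)

open +-*-Solver using (solve; _:=_; _:+_; _:*_; _:-_; :-_; con)
open ℕ.+-*-Solver using () renaming (solve to ℕ-solve; _:=_ to _≗_; _:+_ to _∔_; _:*_ to _∙_; con to ℕ-con)

-- The ordered ring of real numbers

-- No general Fubini theorem and no integration by parts in several variables is carried out on
-- functions. After expansion every integrand is a finite sum of products of a gamma density in `t`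
-- and an integrand of the previous dimension, so the only multidimensional analytic input is a
-- product rule for Riemann sums, with uniform error bounds. The moments then become rational
-- numbers defined by recursion on the dimension, and Euler's identity and integration by parts are
-- algebraic identities between these numbers, proved by induction on the dimension. For that
-- induction both have to be stated for the product of (E₂ + t E₁)ᵐ (E₁ + t)ⁿ with an arbitrary
-- monomial E₂ⁱ E₁ʲ tᵃ. Splitting off one factor at a time moves it into the monomial, so no
-- binomial coefficients occur. Since reals are Cauchy sequences, neither compactness nor mean
-- values are used: bounds, Lipschitz constants and quadratic remainders are explicit data.

Eventually : (ℕ → Set) → Set
Eventually P = Σ[ N ∈ ℕ ] (∀ {n} → N ℕ.≤ n → P n)

eventually₂ : ∀ {P Q R : ℕ → Set} → (∀ n → P n → Q n → R n) →
  Eventually P → Eventually Q → Eventually R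
eventually₂ f (N , p) (M , q) = N ℕ.⊔ M , λ {n} h →
  f n (p (ℕ.m⊔n≤o⇒m≤o N M h)) (q (ℕ.m⊔n≤o⇒n≤o N M h))

eventually₁ : ∀ {P Q : ℕ → Set} → (∀ n → P n → Q n) → Eventually P → Eventually Q
eventually₁ f (N , p) = N , λ {n} h → f n (p h)

lower-bound : ∀ {p q} → 0ℚ <ℚ p → 0ℚ <ℚ q → Σ[ r ∈ ℚ ] 0ℚ <ℚ r × r ≤ℚ p × r ≤ℚ q
lower-bound {p} {q} 0<p 0<q with ℚ.≤-total p q
... | inj₁ p≤q = p , 0<p , ℚ.≤-refl , p≤q
... | inj₂ q≤p = q , 0<q , q≤p , ℚ.≤-refl

≤ℚ-via-0≤ : ∀ {p q} → 0ℚ ≤ℚ q -ℚ p → p ≤ℚ q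
≤ℚ-via-0≤ {p} {q} h = subst₂ _≤ℚ_ (ℚ.+-identityˡ p)
  (solve 2 (λ p q → (q :- p) :+ p := q) refl p q) (ℚ.+-monoˡ-≤ p h)

0≤-via-≤ℚ : ∀ {p q} → p ≤ℚ q → 0ℚ ≤ℚ q -ℚ p
0≤-via-≤ℚ {p} {q} h = subst (_≤ℚ q -ℚ p) (ℚ.+-inverseʳ p) (ℚ.+-monoˡ-≤ (-ℚ p) h)

p≤∣p∣ : ∀ p → p ≤ℚ ∣ p ∣
p≤∣p∣ p = subst₂ _≤ℚ_ (ℚ.+-identityʳ p)
  (solve 2 (λ p q → p :+ (q :- p) := q) refl p ∣ p ∣)
  (ℚ.+-monoʳ-≤ p (lem (ℚ.≤-total 0ℚ p)))
  where
  lem : 0ℚ ≤ℚ p ⊎ p ≤ℚ 0ℚ → 0ℚ ≤ℚ ∣ p ∣ -ℚ p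
  lem (inj₁ 0≤p) = ℚ.≤-reflexive (sym (trans (cong (_-ℚ p) (ℚ.0≤p⇒∣p∣≡p 0≤p)) (ℚ.+-inverseʳ p)))
  lem (inj₂ p≤0) = +-nonneg (ℚ.0≤∣p∣ p)
    (subst (0ℚ ≤ℚ_) (ℚ.+-identityˡ (-ℚ p)) (0≤-via-≤ℚ p≤0))

≤ℝ-pointwise : ∀ x y → (∀ n → seq x n ≤ℚ seq y n) → x ≤ℝ y
≤ℝ-pointwise x y h ε 0<ε = 0 , λ {n} _ → ℚ.≤-trans (h n) (≤-+ʳ (ℚ.<⇒≤ 0<ε))

-- Ring identities hold on the nose for the approximating sequences.
≃-pointwise : ∀ x y → (∀ n → seq x n ≡ seq y n) → x ≃ y
≃-pointwise x y h = ≤ℝ-pointwise x y (λ n → ℚ.≤-reflexive (h n)) ,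
                    ≤ℝ-pointwise y x (λ n → ℚ.≤-reflexive (sym (h n)))

≤ℝ-trans : ∀ x y z → x ≤ℝ y → y ≤ℝ z → x ≤ℝ z
≤ℝ-trans x y z f g ε 0<ε = eventually₂
  (λ n p q → ℚ.≤-trans p (subst (seq y n +ℚ ½ *ℚ ε ≤ℚ_)
     (trans (ℚ.+-assoc (seq z n) _ _) (cong (seq z n +ℚ_) (½+½ ε))) (ℚ.+-monoˡ-≤ (½ *ℚ ε) q)))
  (f _ (½ε>0 0<ε)) (g _ (½ε>0 0<ε))

+ℝ-mono-≤ : ∀ x y u v → x ≤ℝ y → u ≤ℝ v → x +ℝ u ≤ℝ y +ℝ v
+ℝ-mono-≤ x y u v f g ε 0<ε = eventually₂
  (λ n p q → subst (seq x n +ℚ seq u n ≤ℚ_)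
    (trans (solve 3 (λ y v h → (y :+ h) :+ (v :+ h) := (y :+ v) :+ (h :+ h)) refl
             (seq y n) (seq v n) (½ *ℚ ε))
           (cong (seq y n +ℚ seq v n +ℚ_) (½+½ ε)))
    (ℚ.+-mono-≤ p q))
  (f _ (½ε>0 0<ε)) (g _ (½ε>0 0<ε))

-ℝ-anti-≤ : ∀ x y → x ≤ℝ y → (-ℝ y) ≤ℝ (-ℝ x)
-ℝ-anti-≤ x y f ε 0<ε = eventually₁ (λ n p → ≤ℚ-via-0≤
  (subst (0ℚ ≤ℚ_)
    (solve 3 (λ x y e → (y :+ e) :- x := ((:- x) :+ e) :- (:- y)) refl (seq x n) (seq y n) ε)
    (0≤-via-≤ℚ p))) (f ε 0<ε)

bound : ∀ x → Σ[ B ∈ ℚ ] 0ℚ <ℚ B × Eventually (λ n → ∣ seq x n ∣ ≤ℚ B)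
bound x = let N , B , 0<B , h = bounded (seq x) (cauchy x) in B , 0<B , N , h

-- Approximants of nonnegative reals may be slightly negative. Shifting both by η makes the product
-- nonnegative, and the shift costs (a + b + η) η, which is at most (A + B + 1) δ once η ≤ 1 and η ≤
-- δ.
nonneg-product-error : ∀ {A B} → 0ℚ <ℚ A → 0ℚ <ℚ B → ∀ ε → 0ℚ <ℚ ε → Σ[ η ∈ ℚ ] 0ℚ <ℚ η ×
  (∀ a b → ∣ a ∣ ≤ℚ A → ∣ b ∣ ≤ℚ B → 0ℚ ≤ℚ a +ℚ η → 0ℚ ≤ℚ b +ℚ η → 0ℚ ≤ℚ a *ℚ b +ℚ ε)
nonneg-product-error {A} {B} 0<A 0<B ε 0<ε = η , 0<η , claim
  where
  open ℚ.≤-Reasoning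
  δ,h = scale {ε} {(A +ℚ B) +ℚ 1ℚ} 0<ε
    (ℚ.<-≤-trans 0<1 (≤-+ˡ (+-nonneg (ℚ.<⇒≤ 0<A) (ℚ.<⇒≤ 0<B))))
  δ = proj₁ δ,h
  Kδ≡ε = proj₂ (proj₂ δ,h)
  η,h = lower-bound (proj₁ (proj₂ δ,h)) 0<1
  η = proj₁ η,h
  0<η = proj₁ (proj₂ η,h)
  η≤δ = proj₁ (proj₂ (proj₂ η,h))
  η≤1 = proj₂ (proj₂ (proj₂ η,h))
  claim : ∀ a b → ∣ a ∣ ≤ℚ A → ∣ b ∣ ≤ℚ B → 0ℚ ≤ℚ a +ℚ η → 0ℚ ≤ℚ b +ℚ η → 0ℚ ≤ℚ a *ℚ b +ℚ ε
  claim a b a≤A b≤B p q = begin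
    0ℚ ≤⟨ *-nonneg p q ⟩
    (a +ℚ η) *ℚ (b +ℚ η)
      ≡⟨ solve 3 (λ a b h → (a :+ h) :* (b :+ h) := a :* b :+ ((a :+ b) :+ h) :* h) refl a b η ⟩
    a *ℚ b +ℚ ((a +ℚ b) +ℚ η) *ℚ η
      ≤⟨ ℚ.+-monoʳ-≤ (a *ℚ b) (ℚ.*-monoʳ-≤-nonNeg η {{ℚ.nonNegative (ℚ.<⇒≤ 0<η)}}
           (ℚ.+-mono-≤ (ℚ.+-mono-≤ (ℚ.≤-trans (p≤∣p∣ a) a≤A) (ℚ.≤-trans (p≤∣p∣ b) b≤B)) η≤1)) ⟩
    a *ℚ b +ℚ ((A +ℚ B) +ℚ 1ℚ) *ℚ η
      ≤⟨ ℚ.+-monoʳ-≤ (a *ℚ b) (ℚ.*-monoˡ-≤-nonNeg ((A +ℚ B) +ℚ 1ℚ)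
           {{ℚ.nonNegative (+-nonneg (+-nonneg (ℚ.<⇒≤ 0<A) (ℚ.<⇒≤ 0<B)) (ℚ.<⇒≤ 0<1))}} η≤δ) ⟩
    a *ℚ b +ℚ ((A +ℚ B) +ℚ 1ℚ) *ℚ δ ≡⟨ cong (a *ℚ b +ℚ_) Kδ≡ε ⟩
    a *ℚ b +ℚ ε ∎

*ℝ-nonneg : ∀ x y → 0ℝ ≤ℝ x → 0ℝ ≤ℝ y → 0ℝ ≤ℝ x *ℝ y
*ℝ-nonneg x y 0≤x 0≤y ε 0<ε =
  let A , 0<A , x≤A = bound x
      B , 0<B , y≤B = bound y
      η , 0<η , claim = nonneg-product-error 0<A 0<B ε 0<ε
  in eventually₂ (λ n (a , b) (p , q) → claim (seq x n) (seq y n) a b p q)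
       (eventually₂ (λ n → _,_) x≤A y≤B) (eventually₂ (λ n → _,_) (0≤x η 0<η) (0≤y η 0<η))

∣-∣-≤ : ∀ {p q ε} → p ≤ℚ q +ℚ ε → q ≤ℚ p +ℚ ε → ∣ p -ℚ q ∣ ≤ℚ ε
∣-∣-≤ {p} {q} {ε} a b = ∣∣-bound
  (≤+⇒-≤ (subst (p ≤ℚ_) (ℚ.+-comm q ε) a))
  (subst (_≤ℚ ε) (solve 2 (λ p q → q :- p := :- (p :- q)) refl p q)
    (≤+⇒-≤ (subst (q ≤ℚ_) (ℚ.+-comm p ε) b)))

∣-∣≤⇒≤+ : ∀ {p q ε} → ∣ p -ℚ q ∣ ≤ℚ ε → p ≤ℚ q +ℚ ε
∣-∣≤⇒≤+ {p} {q} {ε} h = subst (_≤ℚ q +ℚ ε) (solve 2 (λ p q → q :+ (p :- q) := p) refl p q)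
  (ℚ.+-monoʳ-≤ q (ℚ.≤-trans (p≤∣p∣ (p -ℚ q)) h))

≃⇒close : ∀ x y → x ≃ y → ∀ ε → 0ℚ <ℚ ε → Eventually (λ n → ∣ seq x n -ℚ seq y n ∣ ≤ℚ ε)
≃⇒close x y (p , q) ε 0<ε = eventually₂ (λ n → ∣-∣-≤) (p ε 0<ε) (q ε 0<ε)

close⇒≃ : ∀ x y → (∀ ε → 0ℚ <ℚ ε → Eventually (λ n → ∣ seq x n -ℚ seq y n ∣ ≤ℚ ε)) → x ≃ y
close⇒≃ x y h =
  (λ ε 0<ε → eventually₁ (λ n → ∣-∣≤⇒≤+) (h ε 0<ε)) ,
  (λ ε 0<ε → eventually₁ (λ n p → ∣-∣≤⇒≤+ (subst (_≤ℚ ε) (∣∣-swap (seq x n) (seq y n)) p)) (h ε 0<ε))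

*ℝ-congˡ : ∀ x y z → y ≃ z → x *ℝ y ≃ x *ℝ z
*ℝ-congˡ x y z y≃z = close⇒≃ (x *ℝ y) (x *ℝ z) λ ε 0<ε →
  let B , 0<B , x≤B = bound x
      δ , 0<δ , Bδ≡ε = scale {ε} {B} 0<ε 0<B
  in eventually₂ (λ n b c → subst₂ _≤ℚ_
      (trans (sym (ℚ.∣p*q∣≡∣p∣*∣q∣ (seq x n) (seq y n -ℚ seq z n)))
        (cong ∣_∣ (solve 3 (λ x y z → x :* (y :- z) := x :* y :- x :* z) refl
          (seq x n) (seq y n) (seq z n))))
      Bδ≡ε
      (*-mono-≤ (ℚ.0≤∣p∣ (seq x n)) (ℚ.<⇒≤ 0<δ) b c))
    x≤B (≃⇒close y z y≃z δ 0<δ)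

-- Opacity keeps the Cauchy proofs inside real numbers from being compared.
infix  4 _≤ʳ_ _≃ʳ_
infixl 6 _+ʳ_ _-ʳ_
infixl 7 _*ʳ_
infix  8 -ʳ_

opaque
  _≤ʳ_ : ℝ → ℝ → Set
  _≤ʳ_ = _≤ℝ_

  _+ʳ_ _*ʳ_ : ℝ → ℝ → ℝ
  _+ʳ_ = _+ℝ_
  _*ʳ_ = _*ℝ_

  -ʳ_ ∣_∣ʳ expʳ : ℝ → ℝ
  -ʳ_ = -ℝ_
  ∣_∣ʳ = ∣_∣ℝ
  expʳ = exp

  ι : ℚ → ℝ
  ι = fromℚ

_≃ʳ_ : ℝ → ℝ → Set
x ≃ʳ y = x ≤ʳ y × y ≤ʳ x

_-ʳ_ : ℝ → ℝ → ℝ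
x -ʳ y = x +ʳ -ʳ y

0ʳ 1ʳ : ℝ
0ʳ = ι 0ℚ
1ʳ = ι 1ℚ

opaque
  unfolding _≤ʳ_ _+ʳ_ _*ʳ_ -ʳ_ ∣_∣ʳ ι

  ≤ʳ-refl : ∀ {x} → x ≤ʳ x
  ≤ʳ-refl {x} = ≤ℝ-pointwise x x (λ n → ℚ.≤-refl)

  ≤ʳ-trans : ∀ {x y z} → x ≤ʳ y → y ≤ʳ z → x ≤ʳ z
  ≤ʳ-trans {x} {y} {z} = ≤ℝ-trans x y z

  +ʳ-mono-≤ : ∀ {x y u v} → x ≤ʳ y → u ≤ʳ v → x +ʳ u ≤ʳ y +ʳ v
  +ʳ-mono-≤ {x} {y} {u} {v} = +ℝ-mono-≤ x y u v

  -ʳ-anti-≤ : ∀ {x y} → x ≤ʳ y → -ʳ y ≤ʳ -ʳ x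
  -ʳ-anti-≤ {x} {y} = -ℝ-anti-≤ x y

  *ʳ-nonneg : ∀ {x y} → 0ʳ ≤ʳ x → 0ʳ ≤ʳ y → 0ʳ ≤ʳ x *ʳ y
  *ʳ-nonneg {x} {y} = *ℝ-nonneg x y

  *ʳ-congˡ : ∀ x {y z} → y ≃ʳ z → x *ʳ y ≃ʳ x *ʳ z
  *ʳ-congˡ x {y} {z} = *ℝ-congˡ x y z

  +ʳ-assoc : ∀ x y z → (x +ʳ y) +ʳ z ≃ʳ x +ʳ (y +ʳ z)
  +ʳ-assoc x y z = ≃-pointwise ((x +ʳ y) +ʳ z) (x +ʳ (y +ʳ z)) (λ n → ℚ.+-assoc (seq x n) (seq y n) (seq z n))

  +ʳ-comm : ∀ x y → x +ʳ y ≃ʳ y +ʳ x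
  +ʳ-comm x y = ≃-pointwise (x +ʳ y) (y +ʳ x) (λ n → ℚ.+-comm (seq x n) (seq y n))

  +ʳ-identityˡ : ∀ x → 0ʳ +ʳ x ≃ʳ x
  +ʳ-identityˡ x = ≃-pointwise (0ʳ +ʳ x) x (λ n → ℚ.+-identityˡ (seq x n))

  *ʳ-assoc : ∀ x y z → (x *ʳ y) *ʳ z ≃ʳ x *ʳ (y *ʳ z)
  *ʳ-assoc x y z = ≃-pointwise ((x *ʳ y) *ʳ z) (x *ʳ (y *ʳ z)) (λ n → ℚ.*-assoc (seq x n) (seq y n) (seq z n))

  *ʳ-comm : ∀ x y → x *ʳ y ≃ʳ y *ʳ x
  *ʳ-comm x y = ≃-pointwise (x *ʳ y) (y *ʳ x) (λ n → ℚ.*-comm (seq x n) (seq y n))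

  *ʳ-identityˡ : ∀ x → 1ʳ *ʳ x ≃ʳ x
  *ʳ-identityˡ x = ≃-pointwise (1ʳ *ʳ x) x (λ n → ℚ.*-identityˡ (seq x n))

  *ʳ-zeroˡ : ∀ x → 0ʳ *ʳ x ≃ʳ 0ʳ
  *ʳ-zeroˡ x = ≃-pointwise (0ʳ *ʳ x) 0ʳ (λ n → ℚ.*-zeroˡ (seq x n))

  *ʳ-distribʳ : ∀ x y z → (y +ʳ z) *ʳ x ≃ʳ y *ʳ x +ʳ z *ʳ x
  *ʳ-distribʳ x y z = ≃-pointwise ((y +ʳ z) *ʳ x) (y *ʳ x +ʳ z *ʳ x) (λ n → ℚ.*-distribʳ-+ (seq x n) (seq y n) (seq z n))

  -ʳ-*ˡ : ∀ x y → -ʳ x *ʳ y ≃ʳ -ʳ (x *ʳ y)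
  -ʳ-*ˡ x y = ≃-pointwise (-ʳ x *ʳ y) (-ʳ (x *ʳ y)) (λ n → sym (ℚ.neg-distribˡ-* (seq x n) (seq y n)))

  -ʳ-+ : ∀ x y → -ʳ x +ʳ -ʳ y ≃ʳ -ʳ (x +ʳ y)
  -ʳ-+ x y = ≃-pointwise (-ʳ x +ʳ -ʳ y) (-ʳ (x +ʳ y)) (λ n → sym (ℚ.neg-distrib-+ (seq x n) (seq y n)))

  ι-mono : ∀ {p q} → p ≤ℚ q → ι p ≤ʳ ι q
  ι-mono {p} {q} p≤q = ≤ℝ-pointwise (fromℚ p) (fromℚ q) (λ _ → p≤q)

  ι-+ : ∀ p q → ι (p +ℚ q) ≃ʳ ι p +ʳ ι q
  ι-+ p q = ≃-pointwise (ι (p +ℚ q)) (ι p +ʳ ι q) (λ _ → refl)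

  ι-* : ∀ p q → ι (p *ℚ q) ≃ʳ ι p *ʳ ι q
  ι-* p q = ≃-pointwise (ι (p *ℚ q)) (ι p *ʳ ι q) (λ _ → refl)

  ι-neg : ∀ p → ι (-ℚ p) ≃ʳ -ʳ ι p
  ι-neg p = ≃-pointwise (ι (-ℚ p)) (-ʳ ι p) (λ _ → refl)

  ∣∣-intro : ∀ {x y} → x ≤ʳ y → -ʳ x ≤ʳ y → ∣ x ∣ʳ ≤ʳ y
  ∣∣-intro f g ε 0<ε = eventually₂ (λ n → ∣∣-bound) (f ε 0<ε) (g ε 0<ε)

  x≤∣x∣ : ∀ x → x ≤ʳ ∣ x ∣ʳ
  x≤∣x∣ x = ≤ℝ-pointwise x ∣ x ∣ℝ (λ n → p≤∣p∣ (seq x n))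

  0≤∣x∣ : ∀ x → 0ʳ ≤ʳ ∣ x ∣ʳ
  0≤∣x∣ x = ≤ℝ-pointwise 0ℝ ∣ x ∣ℝ (λ n → ℚ.0≤∣p∣ (seq x n))

  ∣x+y∣≤∣x∣+∣y∣ : ∀ x y → ∣ x +ʳ y ∣ʳ ≤ʳ ∣ x ∣ʳ +ʳ ∣ y ∣ʳ
  ∣x+y∣≤∣x∣+∣y∣ x y =
    ≤ℝ-pointwise ∣ x +ℝ y ∣ℝ (∣ x ∣ℝ +ℝ ∣ y ∣ℝ) (λ n → ℚ.∣p+q∣≤∣p∣+∣q∣ (seq x n) (seq y n))

  ∣x*y∣≃∣x∣*∣y∣ : ∀ x y → ∣ x *ʳ y ∣ʳ ≃ʳ ∣ x ∣ʳ *ʳ ∣ y ∣ʳ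
  ∣x*y∣≃∣x∣*∣y∣ x y = ≃-pointwise (∣ x *ʳ y ∣ʳ) (∣ x ∣ʳ *ʳ ∣ y ∣ʳ) (λ n → ℚ.∣p*q∣≡∣p∣*∣q∣ (seq x n) (seq y n))

  ∣-x∣≃∣x∣ : ∀ x → ∣ -ʳ x ∣ʳ ≃ʳ ∣ x ∣ʳ
  ∣-x∣≃∣x∣ x = ≃-pointwise (∣ -ʳ x ∣ʳ) (∣ x ∣ʳ) (λ n → ℚ.∣-p∣≡∣p∣ (seq x n))

  rational-bound : ∀ x → Σ[ B ∈ ℚ ] 0ℚ <ℚ B × ∣ x ∣ʳ ≤ʳ ι B
  rational-bound x = let B , 0<B , N , h = bound x in B , 0<B ,
    λ ε 0<ε → N , λ N≤n → ℚ.≤-trans (h N≤n) (≤-+ʳ (ℚ.<⇒≤ 0<ε))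

≃ʳ-refl : ∀ {x} → x ≃ʳ x
≃ʳ-refl = ≤ʳ-refl , ≤ʳ-refl

≃ʳ-sym : ∀ {x y} → x ≃ʳ y → y ≃ʳ x
≃ʳ-sym (p , q) = q , p

≃ʳ-trans : ∀ {x y z} → x ≃ʳ y → y ≃ʳ z → x ≃ʳ z
≃ʳ-trans (p , q) (r , s) = ≤ʳ-trans p r , ≤ʳ-trans s q

+ʳ-cong : ∀ {x y u v} → x ≃ʳ y → u ≃ʳ v → x +ʳ u ≃ʳ y +ʳ v
+ʳ-cong (p , q) (r , s) = +ʳ-mono-≤ p r , +ʳ-mono-≤ q s

-ʳ-cong : ∀ {x y} → x ≃ʳ y → -ʳ x ≃ʳ -ʳ y
-ʳ-cong (p , q) = -ʳ-anti-≤ q , -ʳ-anti-≤ p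

*ʳ-cong : ∀ {x y u v} → x ≃ʳ y → u ≃ʳ v → x *ʳ u ≃ʳ y *ʳ v
*ʳ-cong {x} {y} {u} {v} p q = ≃ʳ-trans (*ʳ-congˡ x q)
  (≃ʳ-trans (*ʳ-comm x v) (≃ʳ-trans (*ʳ-congˡ v p) (*ʳ-comm v y)))

≃ʳ-isEquivalence : IsEquivalence _≃ʳ_
≃ʳ-isEquivalence = record { refl = ≃ʳ-refl ; sym = ≃ʳ-sym ; trans = ≃ʳ-trans }

≤ʳ-preorder : Preorder 0ℓ 0ℓ 0ℓ
≤ʳ-preorder = record
  { Carrier = ℝ ; _≈_ = _≃ʳ_ ; _≲_ = _≤ʳ_
  ; isPreorder = record
    { isEquivalence = ≃ʳ-isEquivalence ; reflexive = proj₁ ; trans = ≤ʳ-trans } }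

module ≤ʳ-Reasoning = PreorderReasoning ≤ʳ-preorder

ℝ-almostCommutativeRing : AlmostCommutativeRing 0ℓ 0ℓ
ℝ-almostCommutativeRing = record
  { Carrier = ℝ ; _≈_ = _≃ʳ_ ; _+_ = _+ʳ_ ; _*_ = _*ʳ_ ; -_ = -ʳ_ ; 0# = 0ʳ ; 1# = 1ʳ
  ; isAlmostCommutativeRing = record
    { isCommutativeSemiring = isCommutativeSemiringˡ (record
      { +-isCommutativeMonoid = isCommutativeMonoidˡ (record
        { isSemigroup = record
          { isMagma = record { isEquivalence = ≃ʳ-isEquivalence ; ∙-cong = +ʳ-cong }
          ; assoc = +ʳ-assoc }
        ; identityˡ = +ʳ-identityˡ ; comm = +ʳ-comm })
      ; *-isCommutativeMonoid = isCommutativeMonoidˡ (record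
        { isSemigroup = record
          { isMagma = record { isEquivalence = ≃ʳ-isEquivalence ; ∙-cong = *ʳ-cong }
          ; assoc = *ʳ-assoc }
        ; identityˡ = *ʳ-identityˡ ; comm = *ʳ-comm })
      ; distribʳ = *ʳ-distribʳ ; zeroˡ = *ʳ-zeroˡ })
    ; -‿cong = -ʳ-cong ; -‿*-distribˡ = -ʳ-*ˡ ; -‿+-comm = -ʳ-+ } }
  where
  open Algebra.Structures.Biased _≃ʳ_

-- The ring solver must compare coefficients, and equality of reals is undecidable; therefore its
-- coefficients are rational.
ι-homomorphism : ℚ.+-*-rawRing -Raw-AlmostCommutative⟶ ℝ-almostCommutativeRing
ι-homomorphism = record
  { ⟦_⟧ = ι ; +-homo = ι-+ ; *-homo = ι-* ; -‿homo = ι-neg ; 0-homo = ≃ʳ-refl ; 1-homo = ≃ʳ-refl }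

ι-≟ : ∀ p q → Maybe (ι p ≃ʳ ι q)
ι-≟ p q = Maybe.map (λ { refl → ≃ʳ-refl }) (dec⇒maybe (p ℚ.≟ q))

module ℝ-Solver = RingSolver ℚ.+-*-rawRing ℝ-almostCommutativeRing ι-homomorphism ι-≟
open ℝ-Solver using () renaming (solve to solveʳ; _:=_ to _⊜_; _:+_ to _⊕_; _:*_ to _⊗_; :-_ to ⊝_; _:-_ to _⊖_; con to κ)

≤⇒0≤- : ∀ {x y} → x ≤ʳ y → 0ʳ ≤ʳ y -ʳ x
≤⇒0≤- {x} {y} h = begin
  0ʳ       ≈⟨ solveʳ 1 (λ x → κ 0ℚ ⊜ x ⊖ x) ≃ʳ-refl x ⟩
  x -ʳ x   ≲⟨ +ʳ-mono-≤ h ≤ʳ-refl ⟩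
  y -ʳ x ∎
  where open ≤ʳ-Reasoning

0≤-⇒≤ : ∀ {x y} → 0ʳ ≤ʳ y -ʳ x → x ≤ʳ y
0≤-⇒≤ {x} {y} h = begin
  x              ≈⟨ solveʳ 1 (λ x → x ⊜ κ 0ℚ ⊕ x) ≃ʳ-refl x ⟩
  0ʳ +ʳ x        ≲⟨ +ʳ-mono-≤ h ≤ʳ-refl ⟩
  y -ʳ x +ʳ x    ≈⟨ solveʳ 2 (λ x y → y ⊖ x ⊕ x ⊜ y) ≃ʳ-refl x y ⟩
  y ∎
  where open ≤ʳ-Reasoning

*ʳ-monoˡ-≤ : ∀ {x y z} → 0ʳ ≤ʳ x → y ≤ʳ z → x *ʳ y ≤ʳ x *ʳ z
*ʳ-monoˡ-≤ {x} {y} {z} 0≤x y≤z = 0≤-⇒≤ (begin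
  0ʳ               ≲⟨ *ʳ-nonneg 0≤x (≤⇒0≤- y≤z) ⟩
  x *ʳ (z -ʳ y)    ≈⟨ solveʳ 3 (λ x y z → x ⊗ (z ⊖ y) ⊜ x ⊗ z ⊖ x ⊗ y) ≃ʳ-refl x y z ⟩
  x *ʳ z -ʳ x *ʳ y ∎)
  where open ≤ʳ-Reasoning

*ʳ-monoʳ-≤ : ∀ {x y z} → 0ʳ ≤ʳ z → x ≤ʳ y → x *ʳ z ≤ʳ y *ʳ z
*ʳ-monoʳ-≤ {x} {y} {z} 0≤z x≤y =
  ≤ʳ-trans (proj₁ (*ʳ-comm x z)) (≤ʳ-trans (*ʳ-monoˡ-≤ 0≤z x≤y) (proj₁ (*ʳ-comm z y)))

*ʳ-mono-≤ : ∀ {x y u v} → 0ʳ ≤ʳ x → 0ʳ ≤ʳ v → x ≤ʳ y → u ≤ʳ v → x *ʳ u ≤ʳ y *ʳ v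
*ʳ-mono-≤ 0≤x 0≤v x≤y u≤v = ≤ʳ-trans (*ʳ-monoˡ-≤ 0≤x u≤v) (*ʳ-monoʳ-≤ 0≤v x≤y)

-x≤∣x∣ : ∀ x → -ʳ x ≤ʳ ∣ x ∣ʳ
-x≤∣x∣ x = ≤ʳ-trans (x≤∣x∣ (-ʳ x)) (proj₁ (∣-x∣≃∣x∣ x))

∣∣-cong : ∀ {x y} → x ≃ʳ y → ∣ x ∣ʳ ≃ʳ ∣ y ∣ʳ
∣∣-cong {x} {y} (p , q) =
  ∣∣-intro (≤ʳ-trans p (x≤∣x∣ y)) (≤ʳ-trans (-ʳ-anti-≤ q) (-x≤∣x∣ y)) ,
  ∣∣-intro (≤ʳ-trans q (x≤∣x∣ x)) (≤ʳ-trans (-ʳ-anti-≤ p) (-x≤∣x∣ x))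

-0≤0 : -ʳ 0ʳ ≤ʳ 0ʳ
-0≤0 = proj₁ (solveʳ 0 (⊝ κ 0ℚ ⊜ κ 0ℚ) ≃ʳ-refl)

∣x∣≤x : ∀ {x} → 0ʳ ≤ʳ x → ∣ x ∣ʳ ≤ʳ x
∣x∣≤x 0≤x = ∣∣-intro ≤ʳ-refl (≤ʳ-trans (-ʳ-anti-≤ 0≤x) (≤ʳ-trans -0≤0 0≤x))

∣+∣-mono : ∀ {x y u v} → ∣ x ∣ʳ ≤ʳ u → ∣ y ∣ʳ ≤ʳ v → ∣ x +ʳ y ∣ʳ ≤ʳ u +ʳ v
∣+∣-mono {x} {y} p q = ≤ʳ-trans (∣x+y∣≤∣x∣+∣y∣ x y) (+ʳ-mono-≤ p q)

∣*∣-mono : ∀ {x y u v} → ∣ x ∣ʳ ≤ʳ u → ∣ y ∣ʳ ≤ʳ v → ∣ x *ʳ y ∣ʳ ≤ʳ u *ʳ v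
∣*∣-mono {x} {y} p q = ≤ʳ-trans (proj₁ (∣x*y∣≃∣x∣*∣y∣ x y))
  (*ʳ-mono-≤ (0≤∣x∣ x) (≤ʳ-trans (0≤∣x∣ y) q) p q)

0≤ι : ∀ {q} → 0ℚ ≤ℚ q → 0ʳ ≤ʳ ι q
0≤ι = ι-mono

∣-∣≤0⇒≃ : ∀ {x y} → ∣ x -ʳ y ∣ʳ ≤ʳ 0ʳ → x ≃ʳ y
∣-∣≤0⇒≃ {x} {y} h =
  0≤-⇒≤ (≤ʳ-trans (0≤-neg (≤ʳ-trans (x≤∣x∣ _) h)) (proj₁ (solveʳ 2 (λ x y → ⊝ (x ⊖ y) ⊜ y ⊖ x) ≃ʳ-refl x y))) ,
  0≤-⇒≤ (≤ʳ-trans (0≤-neg (≤ʳ-trans (-x≤∣x∣ _) h)) (proj₁ (solveʳ 2 (λ x y → ⊝ ⊝ (x ⊖ y) ⊜ x ⊖ y) ≃ʳ-refl x y)))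
  where
  0≤-neg : ∀ {z} → z ≤ʳ 0ʳ → 0ʳ ≤ʳ -ʳ z
  0≤-neg p = ≤ʳ-trans (proj₁ (solveʳ 0 (κ 0ℚ ⊜ ⊝ κ 0ℚ) ≃ʳ-refl)) (-ʳ-anti-≤ p)

-- The exponential function

fromℕℚ-+ : ∀ m n → fromℕℚ (m + n) ≡ fromℕℚ m +ℚ fromℕℚ n
fromℕℚ-+ zero    n = sym (ℚ.+-identityˡ (fromℕℚ n))
fromℕℚ-+ (suc m) n = begin
  fromℕℚ (suc (m + n))            ≡⟨ fromℕℚ-suc (m + n) ⟩
  1ℚ +ℚ fromℕℚ (m + n)            ≡⟨ cong (1ℚ +ℚ_) (fromℕℚ-+ m n) ⟩
  1ℚ +ℚ (fromℕℚ m +ℚ fromℕℚ n)    ≡⟨ ℚ.+-assoc 1ℚ (fromℕℚ m) (fromℕℚ n) ⟨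
  1ℚ +ℚ fromℕℚ m +ℚ fromℕℚ n      ≡⟨ cong (_+ℚ fromℕℚ n) (fromℕℚ-suc m) ⟨
  fromℕℚ (suc m) +ℚ fromℕℚ n      ∎
  where open ≡-Reasoning

*-cancelˡ-suc : ∀ n {p q} → fromℕℚ (suc n) *ℚ p ≡ fromℕℚ (suc n) *ℚ q → p ≡ q
*-cancelˡ-suc n e = ℚ.≤-antisym (cancel (ℚ.≤-reflexive e)) (cancel (ℚ.≤-reflexive (sym e)))
  where
  cancel : ∀ {p q} → fromℕℚ (suc n) *ℚ p ≤ℚ fromℕℚ (suc n) *ℚ q → p ≤ℚ q
  cancel = ℚ.*-cancelˡ-≤-pos (fromℕℚ (suc n)) {{ℚ.positive (fromℕℚ-pos n)}}

-- Cauchy products of partial sums of the exponential series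

module _ (p q : ℚ) where

  -- Σ_{i<n} pⁱ/i! · qʲ⁺ⁿ⁻¹⁻ⁱ/(j+n-1-i)!
  convolution : ℕ → ℕ → ℚ
  convolution zero    j = 0ℚ
  convolution (suc n) j = convolution n (suc j) +ℚ expTerm p n *ℚ expTerm q j

  -- Every term has total degree n + j + 1. Writing this degree as the sum of the exponents of p and
  -- of q and applying `expTerm-suc` to each lowers one exponent and releases a factor p or q.
  convolution-suc : ∀ n j → fromℕℚ (n + suc j) *ℚ convolution (suc n) (suc j) ≡
    p *ℚ convolution n (suc j) +ℚ q *ℚ convolution (suc n) j
  convolution-suc zero j = begin
    s *ℚ (0ℚ +ℚ a *ℚ b′)          ≡⟨ solve 3 (λ s a b′ → s :* (con 0ℚ :+ a :* b′) := a :* (s :* b′)) refl s a b′ ⟩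
    a *ℚ (s *ℚ b′)                ≡⟨ cong (a *ℚ_) (expTerm-suc q j) ⟩
    a *ℚ (q *ℚ b)                 ≡⟨ solve 4 (λ p q a b → a :* (q :* b) := p :* con 0ℚ :+ q :* (con 0ℚ :+ a :* b)) refl p q a b ⟩
    p *ℚ 0ℚ +ℚ q *ℚ (0ℚ +ℚ a *ℚ b) ∎
    where
    open ≡-Reasoning
    s = fromℕℚ (suc j)
    a = expTerm p 0
    b = expTerm q j
    b′ = expTerm q (suc j)
  convolution-suc (suc n) j = begin
    fromℕℚ (suc n + suc j) *ℚ (C₁ +ℚ a′ *ℚ b′)
      ≡⟨ ℚ.*-distribˡ-+ (fromℕℚ (suc n + suc j)) C₁ (a′ *ℚ b′) ⟩
    fromℕℚ (suc n + suc j) *ℚ C₁ +ℚ fromℕℚ (suc n + suc j) *ℚ (a′ *ℚ b′)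
      ≡⟨ cong₂ _+ℚ_ (trans (cong (λ z → fromℕℚ z *ℚ C₁) (sym (ℕ.+-suc n (suc j)))) (convolution-suc n (suc j)))
                    (cong (_*ℚ (a′ *ℚ b′)) (fromℕℚ-+ (suc n) (suc j))) ⟩
    (p *ℚ C₂ +ℚ q *ℚ C₃) +ℚ (s +ℚ r) *ℚ (a′ *ℚ b′)
      ≡⟨ solve 5 (λ X s r a′ b′ → X :+ (s :+ r) :* (a′ :* b′) := X :+ ((s :* a′) :* b′ :+ a′ :* (r :* b′))) refl
           (p *ℚ C₂ +ℚ q *ℚ C₃) s r a′ b′ ⟩
    (p *ℚ C₂ +ℚ q *ℚ C₃) +ℚ ((s *ℚ a′) *ℚ b′ +ℚ a′ *ℚ (r *ℚ b′))
      ≡⟨ cong₂ (λ x y → (p *ℚ C₂ +ℚ q *ℚ C₃) +ℚ (x *ℚ b′ +ℚ a′ *ℚ y)) (expTerm-suc p n) (expTerm-suc q j) ⟩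
    (p *ℚ C₂ +ℚ q *ℚ C₃) +ℚ ((p *ℚ a) *ℚ b′ +ℚ a′ *ℚ (q *ℚ b))
      ≡⟨ solve 8 (λ p q C₂ C₃ a a′ b b′ →
           (p :* C₂ :+ q :* C₃) :+ ((p :* a) :* b′ :+ a′ :* (q :* b)) :=
           p :* (C₂ :+ a :* b′) :+ q :* (C₃ :+ a′ :* b)) refl p q C₂ C₃ a a′ b b′ ⟩
    p *ℚ (C₂ +ℚ a *ℚ b′) +ℚ q *ℚ (C₃ +ℚ a′ *ℚ b) ∎
    where
    open ≡-Reasoning
    s = fromℕℚ (suc n)
    r = fromℕℚ (suc j)
    a = expTerm p n
    a′ = expTerm p (suc n)
    b = expTerm q j
    b′ = expTerm q (suc j)
    C₁ = convolution (suc n) (suc (suc j))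
    C₂ = convolution n (suc (suc j))
    C₃ = convolution (suc n) (suc j)

  -- The binomial theorem for divided powers: both sides satisfy (n + 1) xₙ₊₁ = (p + q) xₙ, and the
  -- factor n + 1 cancels.
  convolution≡expTerm : ∀ n → convolution (suc n) 0 ≡ expTerm (p +ℚ q) n
  convolution≡expTerm zero    = refl
  convolution≡expTerm (suc n) = *-cancelˡ-suc n (begin
    s *ℚ (C₁ +ℚ a′ *ℚ b)
      ≡⟨ solve 4 (λ s C a′ b → s :* (C :+ a′ :* b) := s :* C :+ (s :* a′) :* b) refl s C₁ a′ b ⟩
    s *ℚ C₁ +ℚ (s *ℚ a′) *ℚ b
      ≡⟨ cong₂ (λ x y → x +ℚ y *ℚ b)
           (trans (cong (λ z → fromℕℚ z *ℚ C₁) (ℕ.+-comm 1 n)) (convolution-suc n 0)) (expTerm-suc p n) ⟩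
    (p *ℚ C₂ +ℚ q *ℚ (C₂ +ℚ a *ℚ b)) +ℚ (p *ℚ a) *ℚ b
      ≡⟨ solve 5 (λ p q C a b → (p :* C :+ q :* (C :+ a :* b)) :+ (p :* a) :* b := (p :+ q) :* (C :+ a :* b))
           refl p q C₂ a b ⟩
    (p +ℚ q) *ℚ convolution (suc n) 0
      ≡⟨ cong ((p +ℚ q) *ℚ_) (convolution≡expTerm n) ⟩
    (p +ℚ q) *ℚ expTerm (p +ℚ q) n
      ≡⟨ expTerm-suc (p +ℚ q) n ⟨
    s *ℚ expTerm (p +ℚ q) (suc n) ∎)
    where
    open ≡-Reasoning
    s = fromℕℚ (suc n)
    a = expTerm p n
    a′ = expTerm p (suc n)
    b = expTerm q 0
    C₁ = convolution (suc n) 1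
    C₂ = convolution n 1

  -- Σ_{i<N} pⁱ/i! · expSum q (j+N-i)
  triangleSum : ℕ → ℕ → ℚ
  triangleSum zero    j = 0ℚ
  triangleSum (suc N) j = triangleSum N (suc j) +ℚ expTerm p N *ℚ expSum q (suc j)

  -- Raising `j` adds one term to each inner sum; together these form the antidiagonal of total
  -- degree N + j.
  triangleSum-suc : ∀ N j → triangleSum N (suc j) ≡ triangleSum N j +ℚ convolution N (suc j)
  triangleSum-suc zero    j = refl
  triangleSum-suc (suc N) j = trans
    (cong (_+ℚ expTerm p N *ℚ (expSum q (suc j) +ℚ expTerm q (suc j))) (triangleSum-suc N (suc j)))
    (solve 5 (λ T C a S b → (T :+ C) :+ a :* (S :+ b) := (T :+ a :* S) :+ (C :+ a :* b)) refl
      (triangleSum N (suc j)) (convolution N (suc (suc j))) (expTerm p N) (expSum q (suc j)) (expTerm q (suc j)))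

  triangleSum≡expSum : ∀ N → triangleSum N 0 ≡ expSum (p +ℚ q) N
  triangleSum≡expSum zero    = refl
  triangleSum≡expSum (suc N) = begin
    triangleSum N 1 +ℚ a *ℚ (0ℚ +ℚ b)
      ≡⟨ cong (_+ℚ a *ℚ (0ℚ +ℚ b)) (triangleSum-suc N 0) ⟩
    (triangleSum N 0 +ℚ convolution N 1) +ℚ a *ℚ (0ℚ +ℚ b)
      ≡⟨ solve 4 (λ T C a b → (T :+ C) :+ a :* (con 0ℚ :+ b) := T :+ (C :+ a :* b)) refl
           (triangleSum N 0) (convolution N 1) a b ⟩
    triangleSum N 0 +ℚ convolution (suc N) 0
      ≡⟨ cong₂ _+ℚ_ (triangleSum≡expSum N) (convolution≡expTerm N) ⟩
    expSum (p +ℚ q) N +ℚ expTerm (p +ℚ q) N ∎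
    where
    open ≡-Reasoning
    a = expTerm p N
    b = expTerm q 0

module ExpSumEstimates {B : ℚ} (0≤B : 0ℚ ≤ℚ B) where
  open ExpBound 0≤B

  S-nonneg : ∀ n → 0ℚ ≤ℚ S n
  S-nonneg n = S-mono {0} {n} ℕ.z≤′n

  -- `S` increases, `D` dominates it and decreases from `M` on, so `D M` bounds every `S n`.
  K : ℚ
  K = D M

  S≤K : ∀ n → S n ≤ℚ K
  S≤K n = ℚ.≤-trans (S-mono (ℕ.≤⇒≤′ (ℕ.m≤n⊔m M n))) (S≤D ℕ.≤-refl (ℕ.≤⇒≤′ (ℕ.m≤m⊔n M n)))

  K-nonneg : 0ℚ ≤ℚ K
  K-nonneg = S≤K 0

  expSum-bounded : ∀ {h} → ∣ h ∣ ≤ℚ B → ∀ n → ∣ expSum h n ∣ ≤ℚ K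
  expSum-bounded {h} h≤B n = ℚ.≤-trans (subst₂ _≤ℚ_
    (cong ∣_∣ (ℚ.+-identityʳ (expSum h n))) (ℚ.+-identityʳ (S n)) (tail h≤B {0} {n} ℕ.z≤′n)) (S≤K n)

  -- The factor 1/(j + 1) ≤ 1 is given away. Two applications extract ∣h∣² from every term of degree
  -- at least 2.
  ∣expTerm-suc∣ : ∀ h j → ∣ expTerm h (suc j) ∣ ≤ℚ ∣ h ∣ *ℚ ∣ expTerm h j ∣
  ∣expTerm-suc∣ h j = begin
    ∣ t′ ∣                   ≡⟨ ℚ.*-identityˡ ∣ t′ ∣ ⟨
    1ℚ *ℚ ∣ t′ ∣             ≤⟨ ℚ.*-monoʳ-≤-nonNeg ∣ t′ ∣ {{ℚ.nonNegative (ℚ.0≤∣p∣ t′)}} (fromℕℚ-mono {1} {suc j} (ℕ.s≤s ℕ.z≤n)) ⟩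
    s *ℚ ∣ t′ ∣              ≡⟨ cong (_*ℚ ∣ t′ ∣) (ℚ.0≤p⇒∣p∣≡p (0≤fromℕℚ (suc j))) ⟨
    ∣ s ∣ *ℚ ∣ t′ ∣          ≡⟨ ℚ.∣p*q∣≡∣p∣*∣q∣ s t′ ⟨
    ∣ s *ℚ t′ ∣              ≡⟨ cong ∣_∣ (expTerm-suc h j) ⟩
    ∣ h *ℚ expTerm h j ∣     ≡⟨ ℚ.∣p*q∣≡∣p∣*∣q∣ h (expTerm h j) ⟩
    ∣ h ∣ *ℚ ∣ expTerm h j ∣ ∎
    where
    open ℚ.≤-Reasoning
    s = fromℕℚ (suc j)
    t′ = expTerm h (suc j)

  expSum-quadratic : ∀ {h} → ∣ h ∣ ≤ℚ B → ∀ m →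
    ∣ expSum h (suc (suc m)) -ℚ 1ℚ -ℚ h ∣ ≤ℚ (∣ h ∣ *ℚ ∣ h ∣) *ℚ S m
  expSum-quadratic {h} h≤B zero = ℚ.≤-reflexive (trans
    (cong ∣_∣ (solve 1 (λ h → (con 0ℚ :+ con 1ℚ :* con (1/ 0 !) :+ (h :* con 1ℚ) :* con (1/ 1 !)) :- con 1ℚ :- h := con 0ℚ) refl h))
    (sym (ℚ.*-zeroʳ (∣ h ∣ *ℚ ∣ h ∣))))
  expSum-quadratic {h} h≤B (suc m) = begin
    ∣ (E +ℚ t) -ℚ 1ℚ -ℚ h ∣
      ≡⟨ cong ∣_∣ (solve 3 (λ E t h → (E :+ t) :- con 1ℚ :- h := (E :- con 1ℚ :- h) :+ t) refl E t h) ⟩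
    ∣ (E -ℚ 1ℚ -ℚ h) +ℚ t ∣
      ≤⟨ ℚ.∣p+q∣≤∣p∣+∣q∣ (E -ℚ 1ℚ -ℚ h) t ⟩
    ∣ E -ℚ 1ℚ -ℚ h ∣ +ℚ ∣ t ∣
      ≤⟨ ℚ.+-mono-≤ (expSum-quadratic h≤B m) (ℚ.≤-trans (∣expTerm-suc∣ h (suc m))
           (ℚ.*-monoˡ-≤-nonNeg ∣ h ∣ {{ℚ.nonNegative (ℚ.0≤∣p∣ h)}} (ℚ.≤-trans (∣expTerm-suc∣ h m)
             (ℚ.*-monoˡ-≤-nonNeg ∣ h ∣ {{ℚ.nonNegative (ℚ.0≤∣p∣ h)}} (term-bound h≤B m))))) ⟩
    (∣ h ∣ *ℚ ∣ h ∣) *ℚ S m +ℚ ∣ h ∣ *ℚ (∣ h ∣ *ℚ u m)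
      ≡⟨ solve 3 (λ h S u → (h :* h) :* S :+ h :* (h :* u) := (h :* h) :* (S :+ u)) refl ∣ h ∣ (S m) (u m) ⟩
    (∣ h ∣ *ℚ ∣ h ∣) *ℚ (S m +ℚ u m) ∎
    where
    open ℚ.≤-Reasoning
    E = expSum h (suc (suc m))
    t = expTerm h (suc (suc m))

  -- Product minus triangle is a sum of products of one term in p and one in q. Each is dominated by
  -- the corresponding product at B, so the case p = q = B is the worst.
  product-triangleSum : ∀ {p q} → ∣ p ∣ ≤ℚ B → ∣ q ∣ ≤ℚ B → ∀ N j L → j + N ℕ.≤ L →
    ∣ expSum p N *ℚ expSum q L -ℚ triangleSum p q N j ∣ ≤ℚ S N *ℚ S L -ℚ triangleSum B B N j
  product-triangleSum {p} {q} p≤B q≤B zero j L _ = ℚ.≤-reflexive (trans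
    (cong ∣_∣ (solve 1 (λ x → con 0ℚ :* x :- con 0ℚ := con 0ℚ) refl (expSum q L)))
    (sym (solve 1 (λ x → con 0ℚ :* x :- con 0ℚ := con 0ℚ) refl (S L))))
  product-triangleSum {p} {q} p≤B q≤B (suc N) j L j+N<L = begin
    ∣ (P +ℚ a) *ℚ Q -ℚ (T₀ +ℚ a *ℚ Q′) ∣
      ≡⟨ cong ∣_∣ (rearrange P a Q T₀ Q′) ⟩
    ∣ (P *ℚ Q -ℚ T₀) +ℚ a *ℚ (Q -ℚ Q′) ∣
      ≤⟨ ℚ.∣p+q∣≤∣p∣+∣q∣ (P *ℚ Q -ℚ T₀) (a *ℚ (Q -ℚ Q′)) ⟩
    ∣ P *ℚ Q -ℚ T₀ ∣ +ℚ ∣ a *ℚ (Q -ℚ Q′) ∣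
      ≡⟨ cong (∣ P *ℚ Q -ℚ T₀ ∣ +ℚ_) (ℚ.∣p*q∣≡∣p∣*∣q∣ a (Q -ℚ Q′)) ⟩
    ∣ P *ℚ Q -ℚ T₀ ∣ +ℚ ∣ a ∣ *ℚ ∣ Q -ℚ Q′ ∣
      ≤⟨ ℚ.+-mono-≤
           (product-triangleSum p≤B q≤B N (suc j) L (subst (ℕ._≤ L) (ℕ.+-suc j N) j+N<L))
           (*-mono-≤ (ℚ.0≤∣p∣ a) (0≤-via-≤ℚ (S-mono sj≤L)) (term-bound p≤B N) (tail q≤B sj≤L)) ⟩
    (S N *ℚ S L -ℚ T₁) +ℚ u N *ℚ (S L -ℚ S (suc j))
      ≡⟨ rearrange (S N) (u N) (S L) T₁ (S (suc j)) ⟨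
    (S N +ℚ u N) *ℚ S L -ℚ (T₁ +ℚ u N *ℚ S (suc j)) ∎
    where
    open ℚ.≤-Reasoning
    P = expSum p N
    Q = expSum q L
    Q′ = expSum q (suc j)
    a = expTerm p N
    T₀ = triangleSum p q N (suc j)
    T₁ = triangleSum B B N (suc j)
    sj≤L : suc j ℕ.≤′ L
    sj≤L = ℕ.≤⇒≤′ (ℕ.≤-trans (subst (suc j ℕ.≤_) (sym (ℕ.+-suc j N)) (ℕ.s≤s (ℕ.m≤m+n j N))) j+N<L)
    rearrange : ∀ P a Q T Q′ → (P +ℚ a) *ℚ Q -ℚ (T +ℚ a *ℚ Q′) ≡ (P *ℚ Q -ℚ T) +ℚ a *ℚ (Q -ℚ Q′)
    rearrange = solve 5 (λ P a Q T Q′ → (P :+ a) :* Q :- (T :+ a :* Q′) := (P :* Q :- T) :+ a :* (Q :- Q′)) refl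

  -- The rectangle i < N, l ≤ j lies in the region i < N, i + l < N + j, and all terms are
  -- nonnegative.
  S*S≤triangleSum : ∀ N j → S N *ℚ S (suc j) ≤ℚ triangleSum B B N j
  S*S≤triangleSum zero    j = ℚ.≤-reflexive (ℚ.*-zeroˡ (S (suc j)))
  S*S≤triangleSum (suc N) j = ℚ.≤-trans (ℚ.≤-reflexive (ℚ.*-distribʳ-+ (S (suc j)) (S N) (u N)))
    (ℚ.+-monoˡ-≤ (u N *ℚ S (suc j)) (ℚ.≤-trans
      (ℚ.*-monoˡ-≤-nonNeg (S N) {{ℚ.nonNegative (S-nonneg N)}} (S-mono {suc j} (ℕ.≤′-step ℕ.≤′-refl)))
      (S*S≤triangleSum N (suc j))))

  triangleSum-mono : ∀ K N j → triangleSum B B N (K + j) ≤ℚ triangleSum B B (K + N) j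
  triangleSum-mono zero    N j = ℚ.≤-refl
  triangleSum-mono (suc K) N j = ℚ.≤-trans
    (subst (λ z → triangleSum B B N z ≤ℚ triangleSum B B (K + N) (suc j)) (ℕ.+-suc K j) (triangleSum-mono K N (suc j)))
    (≤-+ʳ (*-nonneg (u-nonneg (K + N)) (S-nonneg (suc j))))

  S*S≤expSum : ∀ N → S N *ℚ S N ≤ℚ expSum (B +ℚ B) (N + N)
  S*S≤expSum N = begin
    S N *ℚ S N                 ≤⟨ ℚ.*-monoˡ-≤-nonNeg (S N) {{ℚ.nonNegative (S-nonneg N)}} (S-mono {N} (ℕ.≤′-step ℕ.≤′-refl)) ⟩
    S N *ℚ S (suc N)           ≤⟨ S*S≤triangleSum N N ⟩
    triangleSum B B N N        ≡⟨ cong (triangleSum B B N) (ℕ.+-identityʳ N) ⟨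
    triangleSum B B N (N + 0)  ≤⟨ triangleSum-mono N N 0 ⟩
    triangleSum B B (N + N) 0  ≡⟨ triangleSum≡expSum B B (N + N) ⟩
    expSum (B +ℚ B) (N + N)    ∎
    where open ℚ.≤-Reasoning

  -- The square of side N lies between the triangles of sides N and 2N. Hence the error is at most a
  -- piece of the exponential series at 2B between N and 2N, which the halving of terms controls.
  expSum-product : ∀ ε → 0ℚ <ℚ ε → Eventually λ n → ∀ {p q} → ∣ p ∣ ≤ℚ B → ∣ q ∣ ≤ℚ B →
    ∣ expSum (p +ℚ q) n -ℚ expSum p n *ℚ expSum q n ∣ ≤ℚ ε
  expSum-product ε 0<ε = proj₁ small , λ {N} N≥ {p} {q} p≤B q≤B →
    let M≤N , 2u≤ε = proj₂ small N≥ in begin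
    ∣ expSum (p +ℚ q) N -ℚ expSum p N *ℚ expSum q N ∣
      ≡⟨ ∣∣-swap (expSum (p +ℚ q) N) (expSum p N *ℚ expSum q N) ⟩
    ∣ expSum p N *ℚ expSum q N -ℚ expSum (p +ℚ q) N ∣
      ≡⟨ cong (λ z → ∣ expSum p N *ℚ expSum q N -ℚ z ∣) (triangleSum≡expSum p q N) ⟨
    ∣ expSum p N *ℚ expSum q N -ℚ triangleSum p q N 0 ∣
      ≤⟨ product-triangleSum p≤B q≤B N 0 N ℕ.≤-refl ⟩
    S N *ℚ S N -ℚ triangleSum B B N 0
      ≡⟨ cong (λ z → S N *ℚ S N -ℚ z) (triangleSum≡expSum B B N) ⟩
    S N *ℚ S N -ℚ expSum (B +ℚ B) N
      ≤⟨ ℚ.+-monoˡ-≤ (-ℚ expSum (B +ℚ B) N) (S*S≤expSum N) ⟩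
    expSum (B +ℚ B) (N + N) -ℚ expSum (B +ℚ B) N
      ≤⟨ 2B.tail≤2u M≤N (ℕ.≤⇒≤′ (ℕ.m≤m+n N N)) ⟩
    2B.u N +ℚ 2B.u N
      ≤⟨ 2u≤ε ⟩
    ε ∎
    where
    open ℚ.≤-Reasoning
    module 2B = ExpBound (+-nonneg 0≤B 0≤B)
    small = 2B.2u-small ε 0<ε

exp-cong : ∀ x y → x ≃ y → exp x ≃ exp y
exp-cong x y x≃y = close⇒≃ (exp x) (exp y) λ ε 0<ε →
  let δ , 0<δ , Kδ≡ε = scale {ε} {K +ℚ 1ℚ} 0<ε (ℚ.<-≤-trans 0<1 (≤-+ˡ K-nonneg))
  in eventually₂ (λ n (p≤A , q≤A′) d → ℚ.≤-trans
       (lipschitz (ℚ.≤-trans p≤A (≤-+ʳ 0≤A′)) (ℚ.≤-trans q≤A′ (≤-+ˡ 0≤A)) n)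
       (subst (_ ≤ℚ_) (trans (ℚ.*-comm δ (K +ℚ 1ℚ)) Kδ≡ε)
         (*-mono-≤ (ℚ.0≤∣p∣ (seq x n -ℚ seq y n)) (+-nonneg K-nonneg (ℚ.<⇒≤ 0<1)) d
           (ℚ.≤-trans (S≤K n) (≤-+ʳ (ℚ.<⇒≤ 0<1))))))
     (eventually₂ (λ n → _,_) (proj₂ (proj₂ (bound x))) (proj₂ (proj₂ (bound y))))
     (≃⇒close x y x≃y δ 0<δ)
  where
  0≤A = ℚ.<⇒≤ (proj₁ (proj₂ (bound x)))
  0≤A′ = ℚ.<⇒≤ (proj₁ (proj₂ (bound y)))
  open ExpBound (+-nonneg 0≤A 0≤A′)
  open ExpSumEstimates (+-nonneg 0≤A 0≤A′)

exp-+ : ∀ x y → exp (x +ℝ y) ≃ exp x *ℝ exp y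
exp-+ x y = close⇒≃ (exp (x +ℝ y)) (exp x *ℝ exp y) λ ε 0<ε →
  eventually₂ (λ n (p≤A , q≤A′) h → h {seq x n} {seq y n}
      (ℚ.≤-trans p≤A (≤-+ʳ 0≤A′)) (ℚ.≤-trans q≤A′ (≤-+ˡ 0≤A)))
    (eventually₂ (λ n → _,_) (proj₂ (proj₂ (bound x))) (proj₂ (proj₂ (bound y))))
    (expSum-product ε 0<ε)
  where
  0≤A = ℚ.<⇒≤ (proj₁ (proj₂ (bound x)))
  0≤A′ = ℚ.<⇒≤ (proj₁ (proj₂ (bound y)))
  open ExpSumEstimates (+-nonneg 0≤A 0≤A′)

∣∣-eventually : ∀ {b} x → ∣ x ∣ℝ ≤ℝ fromℚ b → Eventually (λ n → ∣ seq x n ∣ ≤ℚ b +ℚ 1ℚ)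
∣∣-eventually x h = h 1ℚ 0<1

seq-^ : ∀ x N n → seq (x ^ℝ N) n ≡ seq x n ^ℚ N
seq-^ x zero    n = refl
seq-^ x (suc N) n = cong (seq x n *ℚ_) (seq-^ x N n)

-- The hypothesis 1 ≤ x keeps the approximants eventually above ½, so no term of the partial sums is
-- negative and the term of degree N is below the whole sum once n > N.
exp-≥-term : ∀ N x → 1ℝ ≤ℝ x → x ^ℝ N *ℝ fromℚ (1/ N !) ≤ℝ exp x
exp-≥-term N x 1≤x ε 0<ε = eventually₂
  (λ n 1≤xₙ+½ N<n → ℚ.≤-trans (subst (λ z → z *ℚ 1/ N ! ≤ℚ expSum (seq x n) n) (sym (seq-^ x N n))
    (term≤sum (≤ℚ-via-0≤ (ℚ.≤-trans (ℚ.<⇒≤ (ℚ.positive⁻¹ ½)) (½≤ (seq x n) 1≤xₙ+½))) N<n))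
    (≤-+ʳ (ℚ.<⇒≤ 0<ε)))
  (1≤x ½ (ℚ.positive⁻¹ ½)) (suc N , λ h → h)
  where
  ½≤ : ∀ q → 1ℚ ≤ℚ q +ℚ ½ → ½ ≤ℚ q -ℚ 0ℚ
  ½≤ q h = subst (½ ≤ℚ_) (solve 1 (λ q → (q :+ con ½) :- con ½ := q :- con 0ℚ) refl q) (ℚ.+-monoˡ-≤ (-ℚ ½) h)
  term≤sum : ∀ {q n} → 0ℚ ≤ℚ q → N ℕ.< n → expTerm q N ≤ℚ expSum q n
  term≤sum {q} {n} 0≤q N<n = ℚ.≤-trans
    (≤-+ˡ (ExpBound.S-mono 0≤q {0} {N} ℕ.z≤′n)) (ExpBound.S-mono 0≤q (ℕ.≤⇒≤′ N<n))

ℝʳ-rawSemiring : RawSemiring 0ℓ 0ℓ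
ℝʳ-rawSemiring = record { _≈_ = _≃ʳ_ ; _+_ = _+ʳ_ ; _*_ = _*ʳ_ ; 0# = 0ʳ ; 1# = 1ʳ }

open RawSemiringOps ℝʳ-rawSemiring using () renaming (_^_ to _^ʳ_; sum to sumʳ; product to productʳ)

opaque
  unfolding _≤ʳ_ _+ʳ_ _*ʳ_ -ʳ_ ∣_∣ʳ expʳ ι

  expʳ-cong : ∀ {x y} → x ≃ʳ y → expʳ x ≃ʳ expʳ y
  expʳ-cong {x} {y} = exp-cong x y

  expʳ-+ : ∀ x y → expʳ (x +ʳ y) ≃ʳ expʳ x *ʳ expʳ y
  expʳ-+ = exp-+

  expʳ-bounded : ∀ {b} → 0ℚ ≤ℚ b → Σ[ K ∈ ℚ ] 0ℚ ≤ℚ K × (∀ x → ∣ x ∣ʳ ≤ʳ ι b → ∣ expʳ x ∣ʳ ≤ʳ ι K)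
  expʳ-bounded {b} 0≤b = K , K-nonneg , λ x x≤b ε 0<ε →
    eventually₁ (λ n h → ℚ.≤-trans (expSum-bounded h n) (≤-+ʳ (ℚ.<⇒≤ 0<ε))) (∣∣-eventually {b} x x≤b)
    where open ExpSumEstimates (+-nonneg 0≤b (ℚ.<⇒≤ 0<1))

  expʳ-quadratic : ∀ {b} → 0ℚ ≤ℚ b → Σ[ K ∈ ℚ ] 0ℚ ≤ℚ K × (∀ h → ∣ h ∣ʳ ≤ʳ ι b →
    ∣ expʳ h -ʳ 1ʳ -ʳ h ∣ʳ ≤ʳ ι K *ʳ (∣ h ∣ʳ *ʳ ∣ h ∣ʳ))
  expʳ-quadratic {b} 0≤b = K , K-nonneg , λ h h≤b ε 0<ε →
    -- Only partial sums with at least two terms contain the subtracted 1 + h, so the index is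
    -- restricted to n ≥ 2.
    eventually₂ (λ { (suc (suc m)) hₙ (ℕ.s≤s (ℕ.s≤s _)) → ℚ.≤-trans
        (ℚ.≤-trans (expSum-quadratic hₙ m)
          (ℚ.≤-trans (ℚ.*-monoˡ-≤-nonNeg (h² h (suc (suc m))) {{ℚ.nonNegative (*-nonneg (ℚ.0≤∣p∣ (seq h (suc (suc m)))) (ℚ.0≤∣p∣ (seq h (suc (suc m)))))}} (S≤K m))
            (ℚ.≤-reflexive (ℚ.*-comm (h² h (suc (suc m))) K))))
        (≤-+ʳ (ℚ.<⇒≤ 0<ε)) })
      (∣∣-eventually {b} h h≤b) (2 , λ le → le)
    where
    open ExpSumEstimates (+-nonneg 0≤b (ℚ.<⇒≤ 0<1))
    h² : ℝ → ℕ → ℚ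
    h² h n = ∣ seq h n ∣ *ℚ ∣ seq h n ∣

  expʳ-≥-term : ∀ N {x} → 1ʳ ≤ʳ x → x ^ʳ N *ʳ ι (1/ N !) ≤ʳ expʳ x
  expʳ-≥-term N {x} = exp-≥-term N x

  x*x-nonneg : ∀ x → 0ʳ ≤ʳ x *ʳ x
  x*x-nonneg x = ≤ℝ-pointwise 0ℝ (x *ℝ x) (λ n → subst (0ℚ ≤ℚ_)
    (trans (sym (ℚ.∣p*q∣≡∣p∣*∣q∣ (seq x n) (seq x n))) (abs-square (seq x n)))
    (*-nonneg (ℚ.0≤∣p∣ (seq x n)) (ℚ.0≤∣p∣ (seq x n))))
    where
    abs-square : ∀ p → ∣ p *ℚ p ∣ ≡ p *ℚ p
    abs-square p with ℚ.≤-total 0ℚ p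
    ... | inj₁ 0≤p = ℚ.0≤p⇒∣p∣≡p (*-nonneg 0≤p 0≤p)
    ... | inj₂ p≤0 = ℚ.0≤p⇒∣p∣≡p (subst (0ℚ ≤ℚ_) (solve 1 (λ p → (con 0ℚ :- p) :* (con 0ℚ :- p) := p :* p) refl p)
      (*-nonneg (0≤-via-≤ℚ p≤0) (0≤-via-≤ℚ p≤0)))

-- The value is the square of exp(x/2); partial sums at negative arguments may themselves be
-- negative.
expʳ-nonneg : ∀ x → 0ʳ ≤ʳ expʳ x
expʳ-nonneg x = begin
  0ʳ                             ≲⟨ x*x-nonneg (expʳ (ι ½ *ʳ x)) ⟩
  expʳ (ι ½ *ʳ x) *ʳ expʳ (ι ½ *ʳ x) ≈⟨ expʳ-+ (ι ½ *ʳ x) (ι ½ *ʳ x) ⟨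
  expʳ (ι ½ *ʳ x +ʳ ι ½ *ʳ x)    ≈⟨ expʳ-cong (solveʳ 1 (λ x → κ ½ ⊗ x ⊕ κ ½ ⊗ x ⊜ x) ≃ʳ-refl x) ⟩
  expʳ x                         ∎
  where open ≤ʳ-Reasoning

expʳ-0 : expʳ 0ʳ ≃ʳ 1ʳ
expʳ-0 = ∣-∣≤0⇒≃ (begin
  ∣ expʳ 0ʳ -ʳ 1ʳ ∣ʳ                 ≈⟨ ∣∣-cong (solveʳ 1 (λ e → e ⊖ κ 1ℚ ⊜ e ⊖ κ 1ℚ ⊖ κ 0ℚ) ≃ʳ-refl (expʳ 0ʳ)) ⟩
  ∣ expʳ 0ʳ -ʳ 1ʳ -ʳ 0ʳ ∣ʳ           ≲⟨ proj₂ (proj₂ quadratic) 0ʳ ∣0∣≤0 ⟩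
  ι K *ʳ (∣ 0ʳ ∣ʳ *ʳ ∣ 0ʳ ∣ʳ)        ≈⟨ *ʳ-congˡ (ι K) (*ʳ-cong ∣0∣≃0 ∣0∣≃0) ⟩
  ι K *ʳ (0ʳ *ʳ 0ʳ)                  ≈⟨ solveʳ 1 (λ K → K ⊗ (κ 0ℚ ⊗ κ 0ℚ) ⊜ κ 0ℚ) ≃ʳ-refl (ι K) ⟩
  0ʳ                                 ∎)
  where
  open ≤ʳ-Reasoning
  quadratic = expʳ-quadratic (ℚ.≤-refl {0ℚ})
  K = proj₁ quadratic
  ∣0∣≤0 : ∣ 0ʳ ∣ʳ ≤ʳ 0ʳ
  ∣0∣≤0 = ∣x∣≤x ≤ʳ-refl
  ∣0∣≃0 : ∣ 0ʳ ∣ʳ ≃ʳ 0ʳ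
  ∣0∣≃0 = ∣0∣≤0 , 0≤∣x∣ 0ʳ

expʳ-inverse : ∀ x → expʳ x *ʳ expʳ (-ʳ x) ≃ʳ 1ʳ
expʳ-inverse x = begin-equality
  expʳ x *ʳ expʳ (-ʳ x) ≈⟨ expʳ-+ x (-ʳ x) ⟨
  expʳ (x -ʳ x)         ≈⟨ expʳ-cong (solveʳ 1 (λ x → x ⊖ x ⊜ κ 0ℚ) ≃ʳ-refl x) ⟩
  expʳ 0ʳ               ≈⟨ expʳ-0 ⟩
  1ʳ                    ∎
  where open ≤ʳ-Reasoning

-- Finite sums

sum-cong : ∀ {n} {u v : Vector ℝ n} → (∀ i → u i ≃ʳ v i) → sumʳ u ≃ʳ sumʳ v
sum-cong {zero}  h = ≃ʳ-refl
sum-cong {suc n} h = +ʳ-cong (h zero) (sum-cong (λ i → h (suc i)))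

sum-* : ∀ {n} a (v : Vector ℝ n) → sumʳ (λ i → a *ʳ v i) ≃ʳ a *ʳ sumʳ v
sum-* {zero}  a v = solveʳ 1 (λ a → κ 0ℚ ⊜ a ⊗ κ 0ℚ) ≃ʳ-refl a
sum-* {suc n} a v = ≃ʳ-trans (+ʳ-cong ≃ʳ-refl (sum-* a (λ i → v (suc i))))
  (solveʳ 3 (λ a x y → a ⊗ x ⊕ a ⊗ y ⊜ a ⊗ (x ⊕ y)) ≃ʳ-refl a (v zero) _)

sum-+ : ∀ {n} (u v : Vector ℝ n) → sumʳ (λ i → u i +ʳ v i) ≃ʳ sumʳ u +ʳ sumʳ v
sum-+ {zero}  u v = solveʳ 0 (κ 0ℚ ⊜ κ 0ℚ ⊕ κ 0ℚ) ≃ʳ-refl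
sum-+ {suc n} u v = ≃ʳ-trans (+ʳ-cong ≃ʳ-refl (sum-+ (λ i → u (suc i)) (λ i → v (suc i))))
  (solveʳ 4 (λ a b x y → a ⊕ b ⊕ (x ⊕ y) ⊜ a ⊕ x ⊕ (b ⊕ y)) ≃ʳ-refl (u zero) (v zero) _ _)

∣0-0∣≤0 : ∣ 0ʳ -ʳ 0ʳ ∣ʳ ≤ʳ 0ʳ
∣0-0∣≤0 = ∣∣-intro (proj₁ (solveʳ 0 (κ 0ℚ ⊖ κ 0ℚ ⊜ κ 0ℚ) ≃ʳ-refl))
                   (proj₁ (solveʳ 0 (⊝ (κ 0ℚ ⊖ κ 0ℚ) ⊜ κ 0ℚ) ≃ʳ-refl))

∣-∣-triangle : ∀ {x y z u v} → ∣ x -ʳ y ∣ʳ ≤ʳ u → ∣ y -ʳ z ∣ʳ ≤ʳ v → ∣ x -ʳ z ∣ʳ ≤ʳ u +ʳ v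
∣-∣-triangle {x} {y} {z} p q = ≤ʳ-trans
  (proj₁ (∣∣-cong (solveʳ 3 (λ x y z → x ⊖ z ⊜ x ⊖ y ⊕ (y ⊖ z)) ≃ʳ-refl x y z))) (∣+∣-mono p q)

∣-∣-+ : ∀ {x y x′ y′ u v} → ∣ x -ʳ x′ ∣ʳ ≤ʳ u → ∣ y -ʳ y′ ∣ʳ ≤ʳ v →
  ∣ (x +ʳ y) -ʳ (x′ +ʳ y′) ∣ʳ ≤ʳ u +ʳ v
∣-∣-+ {x} {y} {x′} {y′} p q = ≤ʳ-trans
  (proj₁ (∣∣-cong (solveʳ 4 (λ x y x′ y′ → (x ⊕ y) ⊖ (x′ ⊕ y′) ⊜ x ⊖ x′ ⊕ (y ⊖ y′)) ≃ʳ-refl x y x′ y′)))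
  (∣+∣-mono p q)

∣-∣-resp : ∀ {x y x′ y′ u} → x ≃ʳ x′ → y ≃ʳ y′ → ∣ x -ʳ y ∣ʳ ≤ʳ u → ∣ x′ -ʳ y′ ∣ʳ ≤ʳ u
∣-∣-resp p q h = ≤ʳ-trans (proj₂ (∣∣-cong (+ʳ-cong p (-ʳ-cong q)))) h

sum-close : ∀ {n} {u v w : Vector ℝ n} → (∀ i → ∣ u i -ʳ v i ∣ʳ ≤ʳ w i) →
  ∣ sumʳ u -ʳ sumʳ v ∣ʳ ≤ʳ sumʳ w
sum-close {zero}  h = ∣0-0∣≤0
sum-close {suc n} h = ∣-∣-+ (h zero) (sum-close (λ i → h (suc i)))

telescope : ∀ {n} (v : Vector ℝ (suc n)) →
  sumʳ (λ i → v (suc i) -ʳ v (inject₁ i)) ≃ʳ v (fromℕ n) -ʳ v zero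
telescope {zero}  v = solveʳ 1 (λ x → κ 0ℚ ⊜ x ⊖ x) ≃ʳ-refl (v zero)
telescope {suc n} v = ≃ʳ-trans (+ʳ-cong ≃ʳ-refl (telescope (λ i → v (suc i))))
  (solveʳ 3 (λ x y z → y ⊖ x ⊕ (z ⊖ y) ⊜ z ⊖ x) ≃ʳ-refl (v zero) (v (suc zero)) (v (suc (fromℕ n))))

-- The base case reuses `sumCells`, so that both sums evaluate `F` at the same empty cell.
sumCellsʳ : ∀ {k} (n : Fin k → ℕ) → ((∀ i → Fin (n i)) → ℝ) → ℝ
sumCellsʳ {zero}  n F = sumCells n F
sumCellsʳ {suc k} n F =
  sumʳ (λ j → sumCellsʳ (λ i → n (suc i)) (λ c → F (Fin.∀-cons j c)))

sumCells-cong : ∀ {k} (n : Fin k → ℕ) {F G} → (∀ c → F c ≃ʳ G c) → sumCellsʳ n F ≃ʳ sumCellsʳ n G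
sumCells-cong {zero}  n h = h _
sumCells-cong {suc k} n h = sum-cong {n zero} (λ j → sumCells-cong (λ i → n (suc i)) (λ c → h (Fin.∀-cons j c)))

sumCells-* : ∀ {k} (n : Fin k → ℕ) a F → sumCellsʳ n (λ c → a *ʳ F c) ≃ʳ a *ʳ sumCellsʳ n F
sumCells-* {zero}  n a F = ≃ʳ-refl
sumCells-* {suc k} n a F = ≃ʳ-trans 
  (sum-cong {n zero} (λ j → sumCells-* (λ i → n (suc i)) a (λ c → F (Fin.∀-cons j c))))
  (sum-* {n zero} a (λ j → sumCellsʳ (λ i → n (suc i)) (λ c → F (Fin.∀-cons j c))))

sumCells-+ : ∀ {k} (n : Fin k → ℕ) F G →
  sumCellsʳ n (λ c → F c +ʳ G c) ≃ʳ sumCellsʳ n F +ʳ sumCellsʳ n G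
sumCells-+ {zero}  n F G = ≃ʳ-refl
sumCells-+ {suc k} n F G = ≃ʳ-trans 
  (sum-cong {n zero} (λ j → sumCells-+ (λ i → n (suc i)) (λ c → F (Fin.∀-cons j c)) (λ c → G (Fin.∀-cons j c))))
  (sum-+ {n zero} (λ j → sumCellsʳ (λ i → n (suc i)) (λ c → F (Fin.∀-cons j c)))
                  (λ j → sumCellsʳ (λ i → n (suc i)) (λ c → G (Fin.∀-cons j c))))

sumCells-close : ∀ {k} (n : Fin k → ℕ) {F G H} → (∀ c → ∣ F c -ʳ G c ∣ʳ ≤ʳ H c) →
  ∣ sumCellsʳ n F -ʳ sumCellsʳ n G ∣ʳ ≤ʳ sumCellsʳ n H
sumCells-close {zero}  n h = h _
sumCells-close {suc k} n h = sum-close {n zero} (λ j → sumCells-close (λ i → n (suc i)) (λ c → h (Fin.∀-cons j c)))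

-- Riemann sums

widthʳ : ∀ {a b} (P : Partition a b) → Vector ℝ (size P)
widthʳ P i = upper P i -ʳ lower P i

volumeʳ : ∀ {k a b} (P : Grid k a b) → Cell P → ℝ
volumeʳ P c = productʳ (λ i → widthʳ (P i) (c i))

riemannSumʳ : ∀ {k a b} → (Vector ℝ k → ℝ) → (P : Grid k a b) → (Cell P → Vector ℝ k) → ℝ
riemannSumʳ f P tag = sumCellsʳ (λ i → size (P i)) (λ c → f (tag c) *ʳ volumeʳ P c)

Tagged : ∀ {k a b} (P : Grid k a b) → (Cell P → Vector ℝ k) → Set
Tagged P tag = ∀ c i → lower (P i) (c i) ≤ʳ tag c i × tag c i ≤ʳ upper (P i) (c i)

IsIntegralʳ : ∀ {k} → (Vector ℝ k → ℝ) → ℝ → ℝ → Set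
IsIntegralʳ {k} f R I =
  ∀ ε → 0ℚ <ℚ ε → Σ[ δ ∈ ℚ ] 0ℚ <ℚ δ ×
    ((P : Grid k 0ʳ R) → (∀ i j → widthʳ (P i) j ≤ʳ ι δ) →
     (tag : Cell P → Vector ℝ k) → Tagged P tag → ∣ riemannSumʳ f P tag -ʳ I ∣ʳ ≤ʳ ι ε)

-- Tags are fixed at left endpoints: over a slab of a grid the tags vary from cell to cell, and the
-- Lipschitz bound moves all of them to the common left endpoint.
IsIntegral₁ : (ℝ → ℝ) → ℝ → ℝ → Set
IsIntegral₁ φ R I =
  ∀ ε → 0ℚ <ℚ ε → Σ[ δ ∈ ℚ ] 0ℚ <ℚ δ ×
    ((P : Partition 0ʳ R) → (∀ j → widthʳ P j ≤ʳ ι δ) →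
     ∣ sumʳ (λ j → φ (lower P j) *ʳ widthʳ P j) -ʳ I ∣ʳ ≤ʳ ι ε)

opaque
  unfolding _≤ʳ_

  point-first : ∀ {a b} (P : Partition a b) → point P zero ≃ʳ a
  point-first P = first P

  point-last : ∀ {a b} (P : Partition a b) → point P (fromℕ (size P)) ≃ʳ b
  point-last P = last P

  lower≤upper : ∀ {a b} (P : Partition a b) i → lower P i ≤ʳ upper P i
  lower≤upper P = mono P

width-nonneg : ∀ {a b} (P : Partition a b) i → 0ʳ ≤ʳ widthʳ P i
width-nonneg P i = ≤⇒0≤- (lower≤upper P i)

sum-width : ∀ {R} (P : Partition 0ʳ R) → sumʳ (widthʳ P) ≃ʳ R
sum-width {R} P = ≃ʳ-trans (telescope (point P))
  (≃ʳ-trans (+ʳ-cong (point-last P) (-ʳ-cong (point-first P)))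
    (solveʳ 1 (λ x → x ⊖ κ 0ℚ ⊜ x) ≃ʳ-refl R))

monotone-≥-first : ∀ {n} (v : Vector ℝ (suc n)) → (∀ i → v (inject₁ i) ≤ʳ v (suc i)) →
  ∀ i → v zero ≤ʳ v i
monotone-≥-first v h zero = ≤ʳ-refl
monotone-≥-first {suc n} v h (suc i) =
  ≤ʳ-trans (h zero) (monotone-≥-first (λ i → v (suc i)) (λ i → h (suc i)) i)

monotone-≤-last : ∀ {n} (v : Vector ℝ (suc n)) → (∀ i → v (inject₁ i) ≤ʳ v (suc i)) →
  ∀ i → v i ≤ʳ v (fromℕ n)
monotone-≤-last {zero}  v h zero = ≤ʳ-refl
monotone-≤-last {suc n} v h zero =
  ≤ʳ-trans (h zero) (monotone-≤-last (λ i → v (suc i)) (λ i → h (suc i)) zero)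
monotone-≤-last {suc n} v h (suc i) = monotone-≤-last (λ i → v (suc i)) (λ i → h (suc i)) i

point≥ : ∀ {a b} (P : Partition a b) i → a ≤ʳ point P i
point≥ P i = ≤ʳ-trans (proj₂ (point-first P)) (monotone-≥-first (point P) (lower≤upper P) i)

point≤ : ∀ {a b} (P : Partition a b) i → point P i ≤ʳ b
point≤ P i = ≤ʳ-trans (monotone-≤-last (point P) (lower≤upper P) i) (proj₁ (point-last P))

∣∣≤-interval : ∀ {x R} → 0ʳ ≤ʳ x → x ≤ʳ R → ∣ x ∣ʳ ≤ʳ R
∣∣≤-interval 0≤x x≤R = ≤ʳ-trans (∣x∣≤x 0≤x) x≤R

∣∣≤-cell : ∀ {R x} (P : Partition 0ʳ R) i → lower P i ≤ʳ x → x ≤ʳ upper P i → ∣ x ∣ʳ ≤ʳ R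
∣∣≤-cell P i l≤x x≤u = ∣∣≤-interval (≤ʳ-trans (point≥ P (inject₁ i)) l≤x) (≤ʳ-trans x≤u (point≤ P (suc i)))

volume-nonneg : ∀ {k a b} (P : Grid k a b) c → 0ʳ ≤ʳ volumeʳ P c
volume-nonneg {zero}  P c = 0≤ι (ℚ.<⇒≤ 0<1)
volume-nonneg {suc k} P c = *ʳ-nonneg (width-nonneg (P zero) (c zero))
  (volume-nonneg (λ i → P (suc i)) (λ i → c (suc i)))

sum-volume : ∀ {k R} (P : Grid k 0ʳ R) → sumCellsʳ (λ i → size (P i)) (volumeʳ P) ≃ʳ R ^ʳ k
sum-volume {zero}  P = ≃ʳ-refl
sum-volume {suc k} {R} P = begin-equality
  sumʳ (λ j → sumCellsʳ _ (λ c → widthʳ (P zero) j *ʳ volumeʳ P′ c))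
    ≈⟨ sum-cong {size (P zero)} (λ j → ≃ʳ-trans (sumCells-* (λ i → size (P′ i)) (widthʳ (P zero) j) (volumeʳ P′))
         (≃ʳ-trans (*ʳ-congˡ _ (sum-volume P′)) (*ʳ-comm _ _))) ⟩
  sumʳ (λ j → R ^ʳ k *ʳ widthʳ (P zero) j)
    ≈⟨ sum-* (R ^ʳ k) (widthʳ (P zero)) ⟩
  R ^ʳ k *ʳ sumʳ (widthʳ (P zero))
    ≈⟨ ≃ʳ-trans (*ʳ-congˡ _ (sum-width (P zero))) (*ʳ-comm _ _) ⟩
  R *ʳ R ^ʳ k ∎
  where
  open ≤ʳ-Reasoning
  P′ = λ i → P (suc i)

-- A rational upper bound of ∣K∣ is inverted in place of K, so no reciprocal of a real is formed.
real-scale : ∀ K ε → 0ℚ <ℚ ε → Σ[ η ∈ ℚ ] 0ℚ <ℚ η × K *ʳ ι η ≤ʳ ι ε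
real-scale K ε 0<ε =
  let B , 0<B , ∣K∣≤B = rational-bound K
      η , 0<η , Bη≡ε = scale {ε} {B} 0<ε 0<B
  in η , 0<η , ≤ʳ-trans (*ʳ-monoʳ-≤ (0≤ι (ℚ.<⇒≤ 0<η)) (≤ʳ-trans (x≤∣x∣ K) ∣K∣≤B))
       (subst (λ z → ι B *ʳ ι η ≤ʳ ι z) Bη≡ε (proj₂ (ι-* B η)))

IsIntegralʳ-cong : ∀ {k R I} {f g : Vector ℝ k → ℝ} → (∀ x → f x ≃ʳ g x) →
  IsIntegralʳ f R I → IsIntegralʳ g R I
IsIntegralʳ-cong e If ε 0<ε =
  let δ , 0<δ , h = If ε 0<ε
  in δ , 0<δ , λ P mesh tag tagged → ∣-∣-resp
       (sumCells-cong (λ i → size (P i)) (λ c → *ʳ-cong (e (tag c)) ≃ʳ-refl)) ≃ʳ-refl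
       (h P mesh tag tagged)

IsIntegralʳ-+ : ∀ {k R I J} {f g : Vector ℝ k → ℝ} → IsIntegralʳ f R I → IsIntegralʳ g R J →
  IsIntegralʳ (λ x → f x +ʳ g x) R (I +ʳ J)
IsIntegralʳ-+ {I = I} {J} {f} {g} If Ig ε 0<ε =
  let δ₁ , 0<δ₁ , h₁ = If (½ *ℚ ε) (½ε>0 0<ε)
      δ₂ , 0<δ₂ , h₂ = Ig (½ *ℚ ε) (½ε>0 0<ε)
      δ , 0<δ , δ≤δ₁ , δ≤δ₂ = lower-bound 0<δ₁ 0<δ₂
  in δ , 0<δ , λ P mesh tag tagged → ≤ʳ-trans
       (∣-∣-resp (≃ʳ-sym (≃ʳ-trans
           (sumCells-cong (λ i → size (P i)) (λ c → *ʳ-distribʳ (volumeʳ P c) (f (tag c)) (g (tag c))))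
           (sumCells-+ (λ i → size (P i)) (λ c → f (tag c) *ʳ volumeʳ P c) (λ c → g (tag c) *ʳ volumeʳ P c)))) ≃ʳ-refl
         (∣-∣-+ (h₁ P (λ i j → ≤ʳ-trans (mesh i j) (ι-mono δ≤δ₁)) tag tagged)
                (h₂ P (λ i j → ≤ʳ-trans (mesh i j) (ι-mono δ≤δ₂)) tag tagged)))
       (subst (λ z → ι (½ *ℚ ε) +ʳ ι (½ *ℚ ε) ≤ʳ ι z) (½+½ ε) (proj₂ (ι-+ (½ *ℚ ε) (½ *ℚ ε))))

IsIntegralʳ-0 : ∀ {R I} {f : Vector ℝ 0 → ℝ} → (∀ x → f x ≃ʳ I) → IsIntegralʳ f R I
IsIntegralʳ-0 {R} {I} {f} f≃I ε 0<ε = 1ℚ , 0<1 , λ P mesh tag tagged → begin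
  ∣ riemannSumʳ f P tag -ʳ I ∣ʳ
    ≈⟨ ∣∣-cong (+ʳ-cong (≃ʳ-trans (*ʳ-cong (f≃I _) ≃ʳ-refl)
         (≃ʳ-trans (*ʳ-comm I 1ʳ) (*ʳ-identityˡ I))) ≃ʳ-refl) ⟩
  ∣ I -ʳ I ∣ʳ   ≈⟨ ∣∣-cong (solveʳ 1 (λ x → x ⊖ x ⊜ κ 0ℚ) ≃ʳ-refl I) ⟩
  ∣ 0ʳ ∣ʳ       ≲⟨ ∣x∣≤x ≤ʳ-refl ⟩
  0ʳ            ≲⟨ 0≤ι (ℚ.<⇒≤ 0<ε) ⟩
  ι ε           ∎
  where open ≤ʳ-Reasoning

Bounded : ∀ {k} → (Vector ℝ k → ℝ) → Set
Bounded f = ∀ b → Σ[ B ∈ ℝ ] 0ʳ ≤ʳ B × (∀ x → (∀ i → ∣ x i ∣ʳ ≤ʳ b) → ∣ f x ∣ʳ ≤ʳ B)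

Bounded₁ : (ℝ → ℝ) → Set
Bounded₁ φ = ∀ b → Σ[ B ∈ ℝ ] 0ʳ ≤ʳ B × (∀ x → ∣ x ∣ʳ ≤ʳ b → ∣ φ x ∣ʳ ≤ʳ B)

Lipschitz₁ : (ℝ → ℝ) → Set
Lipschitz₁ φ = ∀ b → Σ[ L ∈ ℝ ] 0ʳ ≤ʳ L ×
  (∀ x y → ∣ x ∣ʳ ≤ʳ b → ∣ y ∣ʳ ≤ʳ b → ∣ φ y -ʳ φ x ∣ʳ ≤ʳ L *ʳ ∣ y -ʳ x ∣ʳ)

infixr 7 _⊠_
_⊠_ : ∀ {k} → (ℝ → ℝ) → (Vector ℝ k → ℝ) → Vector ℝ (suc k) → ℝ
(φ ⊠ g) x = φ (x zero) *ʳ g (λ i → x (suc i))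

-- On every slab over a subinterval of the first edge, φ is nearly constant and
-- the remaining sum is a Riemann sum of g; the estimates are uniform in the slab.
IsIntegralʳ-⊠ : ∀ {k R φ I J} {g : Vector ℝ k → ℝ} →
  Bounded₁ φ → Lipschitz₁ φ → Bounded g →
  IsIntegral₁ φ R I → IsIntegralʳ g R J → IsIntegralʳ (φ ⊠ g) R (I *ʳ J)
IsIntegralʳ-⊠ {k} {R} {φ} {I} {J} {g} bφ lφ bg Iφ Ig ε 0<ε =
  δ , proj₁ (proj₂ δ,h) , main
  where
  open ≤ʳ-Reasoning
  Bφ = proj₁ (bφ R)
  L = proj₁ (lφ R)
  Bg = proj₁ (bg R)
  V = R ^ʳ k
  -- `L *ʳ Bg *ʳ V` pays for moving φ to the left endpoint, `Bφ` for replacing the inner sum by J.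
  -- Summation over the slabs multiplies both by R, and `∣ J ∣ʳ` pays for the error of the sum of φ.
  K = (L *ʳ Bg *ʳ V +ʳ Bφ) *ʳ R +ʳ ∣ J ∣ʳ
  η,h = real-scale K ε 0<ε
  η = proj₁ η,h
  0<η = proj₁ (proj₂ η,h)
  Iφ,h = Iφ η 0<η
  Ig,h = Ig η 0<η
  δ₁,h = lower-bound (proj₁ (proj₂ Iφ,h)) (proj₁ (proj₂ Ig,h))
  δ,h = lower-bound (proj₁ (proj₂ δ₁,h)) 0<η
  δ = proj₁ δ,h
  δ≤η : δ ≤ℚ η
  δ≤η = proj₂ (proj₂ (proj₂ δ,h))
  δ≤δφ = ℚ.≤-trans (proj₁ (proj₂ (proj₂ δ,h))) (proj₁ (proj₂ (proj₂ δ₁,h)))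
  δ≤δg = ℚ.≤-trans (proj₁ (proj₂ (proj₂ δ,h))) (proj₂ (proj₂ (proj₂ δ₁,h)))

  main : (P : Grid (suc k) 0ʳ R) → (∀ i j → widthʳ (P i) j ≤ʳ ι δ) →
    (tag : Cell P → Vector ℝ (suc k)) → Tagged P tag →
    ∣ riemannSumʳ (φ ⊠ g) P tag -ʳ I *ʳ J ∣ʳ ≤ʳ ι ε
  main P mesh tag tagged = begin
    ∣ riemannSumʳ (φ ⊠ g) P tag -ʳ I *ʳ J ∣ʳ
      ≲⟨ ∣-∣-triangle (sum-close {size P₀} slab) (∣-∣-resp (≃ʳ-sym (≃ʳ-trans (sum-cong {size P₀} (λ j → *ʳ-comm (φ (lower P₀ j) *ʳ w j) J)) (sum-* J (λ j → φ (lower P₀ j) *ʳ w j)))) (*ʳ-comm J I)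
           (≤ʳ-trans (proj₁ (∣∣-cong (solveʳ 3 (λ J S I → J ⊗ S ⊖ J ⊗ I ⊜ J ⊗ (S ⊖ I)) ≃ʳ-refl J _ I)))
             (∣*∣-mono ≤ʳ-refl (proj₂ (proj₂ Iφ,h) P₀ (λ j → ≤ʳ-trans (mesh zero j) (ι-mono δ≤δφ)))))) ⟩
    sumʳ (λ j → K₁ *ʳ w j) +ʳ ∣ J ∣ʳ *ʳ ι η
      ≈⟨ +ʳ-cong (≃ʳ-trans (sum-* K₁ w) (*ʳ-congˡ K₁ (sum-width P₀))) ≃ʳ-refl ⟩
    K₁ *ʳ R +ʳ ∣ J ∣ʳ *ʳ ι η
      ≈⟨ solveʳ 7 (λ L Bg V Bφ R J η → (L ⊗ Bg ⊗ V ⊕ Bφ) ⊗ η ⊗ R ⊕ J ⊗ η ⊜ ((L ⊗ Bg ⊗ V ⊕ Bφ) ⊗ R ⊕ J) ⊗ η)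
           ≃ʳ-refl L Bg V Bφ R ∣ J ∣ʳ (ι η) ⟩
    K *ʳ ι η
      ≲⟨ proj₂ (proj₂ η,h) ⟩
    ι ε ∎
    where
    K₁ = (L *ʳ Bg *ʳ V +ʳ Bφ) *ʳ ι η
    P₀ = P zero
    P′ : Grid k 0ʳ R
    P′ i = P (suc i)
    w = widthʳ P₀
    n = λ i → size (P′ i)

    slab : ∀ j → ∣ sumCellsʳ n (λ c → (φ ⊠ g) (tag (Fin.∀-cons j c)) *ʳ (w j *ʳ volumeʳ P′ c))
                   -ʳ (φ (lower P₀ j) *ʳ w j) *ʳ J ∣ʳ ≤ʳ K₁ *ʳ w j
    slab j = begin
      ∣ sumCellsʳ n (λ c → (φ ⊠ g) (tag (Fin.∀-cons j c)) *ʳ (w j *ʳ volumeʳ P′ c))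
                   -ʳ (φ (lower P₀ j) *ʳ w j) *ʳ J ∣ʳ
        -- First φ is frozen at the left endpoint cell by cell; what remains is a constant times a
        -- Riemann sum of g with the tags inherited from the slab.
        ≲⟨ ∣-∣-triangle (sumCells-close n cell) (∣-∣-resp (≃ʳ-sym (sumCells-* n (φ l *ʳ w j) gvol)) ≃ʳ-refl
             (≤ʳ-trans (proj₁ (∣∣-cong (solveʳ 3 (λ a S J → a ⊗ S ⊖ a ⊗ J ⊜ a ⊗ (S ⊖ J)) ≃ʳ-refl (φ l *ʳ w j) _ J)))
               (∣*∣-mono (∣*∣-mono (proj₂ (proj₂ (bφ R)) l ∣l∣≤R) (∣x∣≤x (width-nonneg P₀ j)))
                 (proj₂ (proj₂ Ig,h) P′ (λ i j → ≤ʳ-trans (mesh (suc i) j) (ι-mono δ≤δg))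
                   (λ c i → tag (Fin.∀-cons j c) (suc i)) (λ c i → tagged (Fin.∀-cons j c) (suc i)))))) ⟩
      sumCellsʳ n (λ c → (L *ʳ ι η *ʳ Bg *ʳ w j) *ʳ volumeʳ P′ c) +ʳ Bφ *ʳ w j *ʳ ι η
        ≈⟨ +ʳ-cong (≃ʳ-trans (sumCells-* n _ (volumeʳ P′)) (*ʳ-congˡ _ (sum-volume P′))) ≃ʳ-refl ⟩
      (L *ʳ ι η *ʳ Bg *ʳ w j) *ʳ V +ʳ Bφ *ʳ w j *ʳ ι η
        ≈⟨ solveʳ 6 (λ L η Bg w V Bφ → L ⊗ η ⊗ Bg ⊗ w ⊗ V ⊕ Bφ ⊗ w ⊗ η ⊜ (L ⊗ Bg ⊗ V ⊕ Bφ) ⊗ η ⊗ w)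
             ≃ʳ-refl L (ι η) Bg (w j) V Bφ ⟩
      K₁ *ʳ w j ∎
      where
      l = lower P₀ j
      gvol = λ c → g (λ i → tag (Fin.∀-cons j c) (suc i)) *ʳ volumeʳ P′ c
      ∣l∣≤R : ∣ l ∣ʳ ≤ʳ R
      ∣l∣≤R = ∣∣≤-cell P₀ j ≤ʳ-refl (lower≤upper P₀ j)
      cell : ∀ c → ∣ (φ ⊠ g) (tag (Fin.∀-cons j c)) *ʳ (w j *ʳ volumeʳ P′ c)
                     -ʳ (φ l *ʳ w j) *ʳ (g (λ i → tag (Fin.∀-cons j c) (suc i)) *ʳ volumeʳ P′ c) ∣ʳ
                   ≤ʳ (L *ʳ ι η *ʳ Bg *ʳ w j) *ʳ volumeʳ P′ c
      cell c = begin
        ∣ φ t *ʳ g y *ʳ (w j *ʳ v) -ʳ φ l *ʳ w j *ʳ (g y *ʳ v) ∣ʳ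
          ≈⟨ ∣∣-cong (solveʳ 5 (λ p g w v q → p ⊗ g ⊗ (w ⊗ v) ⊖ q ⊗ w ⊗ (g ⊗ v) ⊜ (p ⊖ q) ⊗ g ⊗ w ⊗ v)
               ≃ʳ-refl (φ t) (g y) (w j) v (φ l)) ⟩
        ∣ (φ t -ʳ φ l) *ʳ g y *ʳ w j *ʳ v ∣ʳ
          ≲⟨ ∣*∣-mono (∣*∣-mono (∣*∣-mono
               (≤ʳ-trans (proj₂ (proj₂ (lφ R)) l t ∣l∣≤R (∣∣≤-cell P₀ j l≤t t≤u))
                 (*ʳ-monoˡ-≤ (proj₁ (proj₂ (lφ R))) ∣t-l∣≤η))
               (proj₂ (proj₂ (bg R)) y (λ i → ∣∣≤-cell (P′ i) (c i) (proj₁ (tagged (Fin.∀-cons j c) (suc i))) (proj₂ (tagged (Fin.∀-cons j c) (suc i))))))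
               (∣x∣≤x (width-nonneg P₀ j)))
               (∣x∣≤x (volume-nonneg P′ c)) ⟩
        L *ʳ ι η *ʳ Bg *ʳ w j *ʳ v ∎
        where
        t = tag (Fin.∀-cons j c) zero
        y = λ i → tag (Fin.∀-cons j c) (suc i)
        v = volumeʳ P′ c
        l≤t = proj₁ (tagged (Fin.∀-cons j c) zero)
        t≤u = proj₂ (tagged (Fin.∀-cons j c) zero)
        ∣t-l∣≤η : ∣ t -ʳ l ∣ʳ ≤ʳ ι η
        ∣t-l∣≤η = ≤ʳ-trans (∣x∣≤x (≤⇒0≤- l≤t)) (≤ʳ-trans (+ʳ-mono-≤ t≤u ≤ʳ-refl)
          (≤ʳ-trans (mesh zero j) (ι-mono δ≤η)))

-- One-dimensional calculus

-- The remainder is quadratic and uniform on bounded sets. Summed over a partition of mesh δ such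
-- remainders total at most C R δ, which gives the fundamental theorem directly, and the condition
-- survives multiplication by x.
Derivative : (ℝ → ℝ) → (ℝ → ℝ) → Set
Derivative G φ = ∀ b → Σ[ C ∈ ℝ ] 0ʳ ≤ʳ C × (∀ x y → ∣ x ∣ʳ ≤ʳ b → ∣ y ∣ʳ ≤ʳ b →
  ∣ G y -ʳ G x -ʳ φ x *ʳ (y -ʳ x) ∣ʳ ≤ʳ C *ʳ (∣ y -ʳ x ∣ʳ *ʳ ∣ y -ʳ x ∣ʳ))

∣y-x∣≤b+b : ∀ {x y b} → ∣ x ∣ʳ ≤ʳ b → ∣ y ∣ʳ ≤ʳ b → ∣ y -ʳ x ∣ʳ ≤ʳ b +ʳ b
∣y-x∣≤b+b {x} x≤b y≤b = ∣+∣-mono y≤b (≤ʳ-trans (proj₁ (∣-x∣≃∣x∣ x)) x≤b)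

+ʳ-nonneg : ∀ {x y} → 0ʳ ≤ʳ x → 0ʳ ≤ʳ y → 0ʳ ≤ʳ x +ʳ y
+ʳ-nonneg p q = ≤ʳ-trans (proj₂ (+ʳ-identityˡ 0ʳ)) (+ʳ-mono-≤ p q)

Derivative-congʳ : ∀ {G φ ψ} → (∀ x → φ x ≃ʳ ψ x) → Derivative G φ → Derivative G ψ
Derivative-congʳ e D b = let C , 0≤C , h = D b in C , 0≤C , λ x y x≤b y≤b →
  ≤ʳ-trans (proj₂ (∣∣-cong (+ʳ-cong ≃ʳ-refl (-ʳ-cong (*ʳ-cong (e x) ≃ʳ-refl))))) (h x y x≤b y≤b)

Derivative-+ : ∀ {G φ H ψ} → Derivative G φ → Derivative H ψ →
  Derivative (λ x → G x +ʳ H x) (λ x → φ x +ʳ ψ x)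
Derivative-+ {G} {φ} {H} {ψ} DG DH b =
  let C , 0≤C , h = DG b
      C′ , 0≤C′ , h′ = DH b
  in C +ʳ C′ , +ʳ-nonneg 0≤C 0≤C′ , λ x y x≤b y≤b → begin
    ∣ (G y +ʳ H y) -ʳ (G x +ʳ H x) -ʳ (φ x +ʳ ψ x) *ʳ (y -ʳ x) ∣ʳ
      ≈⟨ ∣∣-cong (solveʳ 7 (λ Gy Hy Gx Hx p q d →
           (Gy ⊕ Hy) ⊖ (Gx ⊕ Hx) ⊖ (p ⊕ q) ⊗ d ⊜ (Gy ⊖ Gx ⊖ p ⊗ d) ⊕ (Hy ⊖ Hx ⊖ q ⊗ d)) ≃ʳ-refl
           (G y) (H y) (G x) (H x) (φ x) (ψ x) (y -ʳ x)) ⟩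
    ∣ (G y -ʳ G x -ʳ φ x *ʳ (y -ʳ x)) +ʳ (H y -ʳ H x -ʳ ψ x *ʳ (y -ʳ x)) ∣ʳ
      ≲⟨ ∣+∣-mono (h x y x≤b y≤b) (h′ x y x≤b y≤b) ⟩
    C *ʳ (∣ y -ʳ x ∣ʳ *ʳ ∣ y -ʳ x ∣ʳ) +ʳ C′ *ʳ (∣ y -ʳ x ∣ʳ *ʳ ∣ y -ʳ x ∣ʳ)
      ≈⟨ *ʳ-distribʳ _ C C′ ⟨
    (C +ʳ C′) *ʳ (∣ y -ʳ x ∣ʳ *ʳ ∣ y -ʳ x ∣ʳ) ∎
  where open ≤ʳ-Reasoning

Derivative-*ˡ : ∀ {G φ} c → Derivative G φ → Derivative (λ x → c *ʳ G x) (λ x → c *ʳ φ x)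
Derivative-*ˡ {G} {φ} c DG b =
  let C , 0≤C , h = DG b
  in ∣ c ∣ʳ *ʳ C , *ʳ-nonneg (0≤∣x∣ c) 0≤C , λ x y x≤b y≤b → begin
    ∣ c *ʳ G y -ʳ c *ʳ G x -ʳ c *ʳ φ x *ʳ (y -ʳ x) ∣ʳ
      ≈⟨ ∣∣-cong (solveʳ 5 (λ c Gy Gx p d → c ⊗ Gy ⊖ c ⊗ Gx ⊖ c ⊗ p ⊗ d ⊜ c ⊗ (Gy ⊖ Gx ⊖ p ⊗ d)) ≃ʳ-refl
           c (G y) (G x) (φ x) (y -ʳ x)) ⟩
    ∣ c *ʳ (G y -ʳ G x -ʳ φ x *ʳ (y -ʳ x)) ∣ʳ
      ≲⟨ ∣*∣-mono ≤ʳ-refl (h x y x≤b y≤b) ⟩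
    ∣ c ∣ʳ *ʳ (C *ʳ (∣ y -ʳ x ∣ʳ *ʳ ∣ y -ʳ x ∣ʳ))
      ≈⟨ *ʳ-assoc ∣ c ∣ʳ C _ ⟨
    ∣ c ∣ʳ *ʳ C *ʳ (∣ y -ʳ x ∣ʳ *ʳ ∣ y -ʳ x ∣ʳ) ∎
  where open ≤ʳ-Reasoning

Derivative-x* : ∀ {G φ} → Bounded₁ φ → Derivative G φ →
  Derivative (λ x → x *ʳ G x) (λ x → G x +ʳ x *ʳ φ x)
Derivative-x* {G} {φ} bφ DG b =
  let C , 0≤C , h = DG b
      B , 0≤B , φ≤B = bφ b
  in ∣ b ∣ʳ *ʳ C +ʳ B , +ʳ-nonneg (*ʳ-nonneg (0≤∣x∣ b) 0≤C) 0≤B , λ x y x≤b y≤b → begin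
    ∣ y *ʳ G y -ʳ x *ʳ G x -ʳ (G x +ʳ x *ʳ φ x) *ʳ (y -ʳ x) ∣ʳ
      ≈⟨ ∣∣-cong (solveʳ 5 (λ x y Gx Gy p → y ⊗ Gy ⊖ x ⊗ Gx ⊖ (Gx ⊕ x ⊗ p) ⊗ (y ⊖ x) ⊜
           y ⊗ (Gy ⊖ Gx ⊖ p ⊗ (y ⊖ x)) ⊕ p ⊗ ((y ⊖ x) ⊗ (y ⊖ x))) ≃ʳ-refl x y (G x) (G y) (φ x)) ⟩
    ∣ y *ʳ (G y -ʳ G x -ʳ φ x *ʳ (y -ʳ x)) +ʳ φ x *ʳ ((y -ʳ x) *ʳ (y -ʳ x)) ∣ʳ
      ≲⟨ ∣+∣-mono (∣*∣-mono (≤ʳ-trans y≤b (x≤∣x∣ b)) (h x y x≤b y≤b))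
           (∣*∣-mono (φ≤B x x≤b) (proj₁ (∣x*y∣≃∣x∣*∣y∣ (y -ʳ x) (y -ʳ x)))) ⟩
    ∣ b ∣ʳ *ʳ (C *ʳ (∣ y -ʳ x ∣ʳ *ʳ ∣ y -ʳ x ∣ʳ)) +ʳ B *ʳ (∣ y -ʳ x ∣ʳ *ʳ ∣ y -ʳ x ∣ʳ)
      ≈⟨ solveʳ 4 (λ b C s B → b ⊗ (C ⊗ s) ⊕ B ⊗ s ⊜ (b ⊗ C ⊕ B) ⊗ s) ≃ʳ-refl ∣ b ∣ʳ C _ B ⟩
    (∣ b ∣ʳ *ʳ C +ʳ B) *ʳ (∣ y -ʳ x ∣ʳ *ʳ ∣ y -ʳ x ∣ʳ) ∎
  where open ≤ʳ-Reasoning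

Derivative⇒Lipschitz : ∀ {G φ} → Bounded₁ φ → Derivative G φ → Lipschitz₁ G
Derivative⇒Lipschitz {G} {φ} bφ DG b =
  let C , 0≤C , h = DG b
      B , 0≤B , φ≤B = bφ b
  in C *ʳ (∣ b ∣ʳ +ʳ ∣ b ∣ʳ) +ʳ B , +ʳ-nonneg (*ʳ-nonneg 0≤C (+ʳ-nonneg (0≤∣x∣ b) (0≤∣x∣ b))) 0≤B ,
    λ x y x≤b y≤b → begin
    ∣ G y -ʳ G x ∣ʳ
      ≈⟨ ∣∣-cong (solveʳ 4 (λ Gy Gx p d → Gy ⊖ Gx ⊜ (Gy ⊖ Gx ⊖ p ⊗ d) ⊕ p ⊗ d) ≃ʳ-refl (G y) (G x) (φ x) (y -ʳ x)) ⟩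
    ∣ (G y -ʳ G x -ʳ φ x *ʳ (y -ʳ x)) +ʳ φ x *ʳ (y -ʳ x) ∣ʳ
      ≲⟨ ∣+∣-mono (≤ʳ-trans (h x y x≤b y≤b) (*ʳ-monoˡ-≤ 0≤C (*ʳ-monoʳ-≤ (0≤∣x∣ (y -ʳ x))
           (∣y-x∣≤b+b (≤ʳ-trans x≤b (x≤∣x∣ b)) (≤ʳ-trans y≤b (x≤∣x∣ b))))))
           (∣*∣-mono (φ≤B x x≤b) ≤ʳ-refl) ⟩
    C *ʳ ((∣ b ∣ʳ +ʳ ∣ b ∣ʳ) *ʳ ∣ y -ʳ x ∣ʳ) +ʳ B *ʳ ∣ y -ʳ x ∣ʳ
      ≈⟨ solveʳ 4 (λ C b B d → C ⊗ (b ⊗ d) ⊕ B ⊗ d ⊜ (C ⊗ b ⊕ B) ⊗ d) ≃ʳ-refl C (∣ b ∣ʳ +ʳ ∣ b ∣ʳ) B ∣ y -ʳ x ∣ʳ ⟩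
    (C *ʳ (∣ b ∣ʳ +ʳ ∣ b ∣ʳ) +ʳ B) *ʳ ∣ y -ʳ x ∣ʳ ∎
  where open ≤ʳ-Reasoning

-- A function on Cauchy sequences need not respect equality of reals; a Lipschitz bound forces it
-- to, because the distance of equal reals is 0.
Lipschitz-cong : ∀ {G} → Lipschitz₁ G → ∀ {x y} → x ≃ʳ y → G x ≃ʳ G y
Lipschitz-cong {G} lG {x} {y} x≃y =
  let L , 0≤L , h = lG (∣ x ∣ʳ +ʳ ∣ y ∣ʳ)
  in ≃ʳ-sym (∣-∣≤0⇒≃ (begin
    ∣ G y -ʳ G x ∣ʳ
      ≲⟨ h x y (≤ʳ-trans (proj₁ (≃ʳ-sym (≃ʳ-trans (+ʳ-comm ∣ x ∣ʳ 0ʳ) (+ʳ-identityˡ ∣ x ∣ʳ)))) (+ʳ-mono-≤ ≤ʳ-refl (0≤∣x∣ y)))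
               (≤ʳ-trans (proj₂ (+ʳ-identityˡ ∣ y ∣ʳ)) (+ʳ-mono-≤ (0≤∣x∣ x) ≤ʳ-refl)) ⟩
    L *ʳ ∣ y -ʳ x ∣ʳ
      ≈⟨ *ʳ-congˡ L (∣∣-cong (≃ʳ-trans (+ʳ-cong (≃ʳ-sym x≃y) ≃ʳ-refl) (solveʳ 1 (λ x → x ⊖ x ⊜ κ 0ℚ) ≃ʳ-refl x))) ⟩
    L *ʳ ∣ 0ʳ ∣ʳ
      ≲⟨ *ʳ-monoˡ-≤ 0≤L (∣x∣≤x ≤ʳ-refl) ⟩
    L *ʳ 0ʳ
      ≈⟨ solveʳ 1 (λ L → L ⊗ κ 0ℚ ⊜ κ 0ℚ) ≃ʳ-refl L ⟩
    0ʳ ∎))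
  where open ≤ʳ-Reasoning

-- The increments of G telescope, and each differs from its summand by at most C δ times the width.
-- Respect for equality enters because the end points of a partition are only equal as reals to 0
-- and R.
IsIntegral₁-Derivative : ∀ {G φ R} → (∀ {x y} → x ≃ʳ y → G x ≃ʳ G y) → Derivative G φ →
  IsIntegral₁ φ R (G R -ʳ G 0ʳ)
IsIntegral₁-Derivative {G} {φ} {R} G-cong DG ε 0<ε =
  let C , 0≤C , h = DG R
      δ , 0<δ , CRδ≤ε = real-scale (C *ʳ R) ε 0<ε
  in δ , 0<δ , λ P mesh → let w = widthʳ P in begin
    ∣ sumʳ (λ j → φ (lower P j) *ʳ w j) -ʳ (G R -ʳ G 0ʳ) ∣ʳ
      ≲⟨ ∣-∣-resp (≃ʳ-refl {sumʳ (λ j → φ (lower P j) *ʳ w j)}) (≃ʳ-trans (telescope (λ i → G (point P i)))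
           (+ʳ-cong (G-cong (point-last P)) (-ʳ-cong (G-cong (point-first P)))))
           (sum-close {size P} (λ j → ≤ʳ-trans (proj₁ (flip (φ (lower P j) *ʳ w j) (G (upper P j) -ʳ G (lower P j))))
             (≤ʳ-trans (h (lower P j) (upper P j)
                 (∣∣≤-cell P j ≤ʳ-refl (lower≤upper P j)) (∣∣≤-cell P j (lower≤upper P j) ≤ʳ-refl))
               (*ʳ-monoˡ-≤ 0≤C (*ʳ-mono-≤ (0≤∣x∣ (w j)) (width-nonneg P j)
                 (≤ʳ-trans (∣x∣≤x (width-nonneg P j)) (mesh j)) (∣x∣≤x (width-nonneg P j))))))) ⟩
    sumʳ (λ j → C *ʳ (ι δ *ʳ w j))
      ≈⟨ ≃ʳ-trans (sum-* C (λ j → ι δ *ʳ w j)) (*ʳ-congˡ C (≃ʳ-trans (sum-* (ι δ) w) (*ʳ-congˡ (ι δ) (sum-width P)))) ⟩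
    C *ʳ (ι δ *ʳ R)
      ≈⟨ solveʳ 3 (λ C d R → C ⊗ (d ⊗ R) ⊜ C ⊗ R ⊗ d) ≃ʳ-refl C (ι δ) R ⟩
    C *ʳ R *ʳ ι δ
      ≲⟨ CRδ≤ε ⟩
    ι ε ∎
  where
  open ≤ʳ-Reasoning
  flip : ∀ x y → ∣ x -ʳ y ∣ʳ ≃ʳ ∣ y -ʳ x ∣ʳ
  flip x y = ≃ʳ-trans (∣∣-cong (solveʳ 2 (λ x y → x ⊖ y ⊜ ⊝ (y ⊖ x)) ≃ʳ-refl x y)) (∣-x∣≃∣x∣ (y -ʳ x))

Bounded₁-+ : ∀ {φ ψ} → Bounded₁ φ → Bounded₁ ψ → Bounded₁ (λ x → φ x +ʳ ψ x)
Bounded₁-+ bφ bψ b =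
  let B , 0≤B , h = bφ b
      B′ , 0≤B′ , h′ = bψ b
  in B +ʳ B′ , +ʳ-nonneg 0≤B 0≤B′ , λ x x≤b → ∣+∣-mono (h x x≤b) (h′ x x≤b)

Bounded₁-x* : ∀ {φ} → Bounded₁ φ → Bounded₁ (λ x → x *ʳ φ x)
Bounded₁-x* bφ b =
  let B , 0≤B , h = bφ b
  in ∣ b ∣ʳ *ʳ B , *ʳ-nonneg (0≤∣x∣ b) 0≤B , λ x x≤b → ∣*∣-mono (≤ʳ-trans x≤b (x≤∣x∣ b)) (h x x≤b)

Bounded₁-*ˡ : ∀ {φ} c → Bounded₁ φ → Bounded₁ (λ x → c *ʳ φ x)
Bounded₁-*ˡ c bφ b =
  let B , 0≤B , h = bφ b
  in ∣ c ∣ʳ *ʳ B , *ʳ-nonneg (0≤∣x∣ c) 0≤B , λ x x≤b → ∣*∣-mono ≤ʳ-refl (h x x≤b)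

-- The gamma integrals

gamma : ℕ → ℝ → ℝ
gamma zero    x = expʳ (-ʳ x)
gamma (suc a) x = x *ʳ gamma a x

gamma′ : ℕ → ℝ → ℝ
gamma′ zero    x = ι (-ℚ 1ℚ) *ʳ gamma zero x
gamma′ (suc a) x = gamma a x +ʳ x *ʳ gamma′ a x

-- The recursion is integration by parts, ∫ tᵃ⁺¹ e⁻ᵗ = (a + 1) ∫ tᵃ e⁻ᵗ - tᵃ⁺¹ e⁻ᵗ, with the
-- constant chosen so that the antiderivative vanishes at infinity.
gammaAntiderivative : ℕ → ℝ → ℝ
gammaAntiderivative zero    x = ι (-ℚ 1ℚ) *ʳ gamma zero x
gammaAntiderivative (suc a) x =
  ι (fromℕℚ (suc a)) *ʳ gammaAntiderivative a x +ʳ ι (-ℚ 1ℚ) *ʳ gamma (suc a) x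

gamma-bounded : ∀ a → Bounded₁ (gamma a)
gamma-bounded zero b =
  let b′ , 0<b′ , b≤b′ = rational-bound b
      K , 0≤K , h = expʳ-bounded (ℚ.<⇒≤ 0<b′)
  in ι K , 0≤ι 0≤K , λ x x≤b → h (-ʳ x) (≤ʳ-trans (proj₁ (∣-x∣≃∣x∣ x)) (≤ʳ-trans x≤b (≤ʳ-trans (x≤∣x∣ b) b≤b′)))
gamma-bounded (suc a) = Bounded₁-x* (gamma-bounded a)

gamma′-bounded : ∀ a → Bounded₁ (gamma′ a)
gamma′-bounded zero    = Bounded₁-*ˡ (ι (-ℚ 1ℚ)) (gamma-bounded zero)
gamma′-bounded (suc a) = Bounded₁-+ (gamma-bounded a) (Bounded₁-x* (gamma′-bounded a))

exp-neg-derivative : Derivative (gamma zero) (gamma′ zero)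
exp-neg-derivative b =
  let B , 0≤B , E≤B = gamma-bounded zero b
      b′ , 0<b′ , b≤b′ = rational-bound (b +ʳ b)
      K , 0≤K , h = expʳ-quadratic (ℚ.<⇒≤ 0<b′)
  in B *ʳ ι K , *ʳ-nonneg 0≤B (0≤ι 0≤K) , λ x y x≤b y≤b →
  let E = gamma zero in begin
    ∣ E y -ʳ E x -ʳ ι (-ℚ 1ℚ) *ʳ E x *ʳ (y -ʳ x) ∣ʳ
      ≈⟨ ∣∣-cong (+ʳ-cong (+ʳ-cong (≃ʳ-trans
           (expʳ-cong (solveʳ 2 (λ x y → ⊝ y ⊜ ⊝ x ⊕ ⊝ (y ⊖ x)) ≃ʳ-refl x y)) (expʳ-+ (-ʳ x) (-ʳ (y -ʳ x))))
           ≃ʳ-refl) ≃ʳ-refl) ⟩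
    ∣ E x *ʳ E (y -ʳ x) -ʳ E x -ʳ ι (-ℚ 1ℚ) *ʳ E x *ʳ (y -ʳ x) ∣ʳ
      ≈⟨ ∣∣-cong (solveʳ 3 (λ E e d → E ⊗ e ⊖ E ⊖ κ (-ℚ 1ℚ) ⊗ E ⊗ d ⊜ E ⊗ (e ⊖ κ 1ℚ ⊖ ⊝ d)) ≃ʳ-refl
           (E x) (E (y -ʳ x)) (y -ʳ x)) ⟩
    ∣ E x *ʳ (E (y -ʳ x) -ʳ 1ʳ -ʳ -ʳ (y -ʳ x)) ∣ʳ
      ≲⟨ ∣*∣-mono (E≤B x x≤b) (≤ʳ-trans (h (-ʳ (y -ʳ x))
           (≤ʳ-trans (proj₁ (∣-x∣≃∣x∣ (y -ʳ x))) (≤ʳ-trans (∣y-x∣≤b+b x≤b y≤b) (≤ʳ-trans (x≤∣x∣ (b +ʳ b)) b≤b′))))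
           (proj₁ (*ʳ-congˡ (ι K) (*ʳ-cong (∣-x∣≃∣x∣ (y -ʳ x)) (∣-x∣≃∣x∣ (y -ʳ x)))))) ⟩
    B *ʳ (ι K *ʳ (∣ y -ʳ x ∣ʳ *ʳ ∣ y -ʳ x ∣ʳ))
      ≈⟨ *ʳ-assoc B (ι K) _ ⟨
    B *ʳ ι K *ʳ (∣ y -ʳ x ∣ʳ *ʳ ∣ y -ʳ x ∣ʳ) ∎
  where open ≤ʳ-Reasoning

gamma-derivative : ∀ a → Derivative (gamma a) (gamma′ a)
gamma-derivative zero    = exp-neg-derivative
gamma-derivative (suc a) = Derivative-x* (gamma′-bounded a) (gamma-derivative a)

gamma-lipschitz : ∀ a → Lipschitz₁ (gamma a)
gamma-lipschitz a = Derivative⇒Lipschitz (gamma′-bounded a) (gamma-derivative a)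

ι-suc : ∀ n → ι (fromℕℚ (suc n)) ≃ʳ 1ʳ +ʳ ι (fromℕℚ n)
ι-suc n = subst (λ z → ι z ≃ʳ 1ʳ +ʳ ι (fromℕℚ n)) (sym (fromℕℚ-suc n)) (ι-+ 1ℚ (fromℕℚ n))

gamma′-suc : ∀ a x → gamma′ (suc a) x ≃ʳ ι (fromℕℚ (suc a)) *ʳ gamma a x -ʳ gamma (suc a) x
gamma′-suc zero x = solveʳ 2 (λ E x → E ⊕ x ⊗ (κ (-ℚ 1ℚ) ⊗ E) ⊜ κ (fromℕℚ 1) ⊗ E ⊖ x ⊗ E) ≃ʳ-refl (gamma zero x) x
gamma′-suc (suc a) x = begin-equality
  x *ʳ γ +ʳ x *ʳ gamma′ (suc a) x
    ≈⟨ +ʳ-cong ≃ʳ-refl (*ʳ-congˡ x (gamma′-suc a x)) ⟩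
  x *ʳ γ +ʳ x *ʳ (ι (fromℕℚ (suc a)) *ʳ γ -ʳ x *ʳ γ)
    ≈⟨ solveʳ 3 (λ x γ n → x ⊗ γ ⊕ x ⊗ (n ⊗ γ ⊖ x ⊗ γ) ⊜ (κ 1ℚ ⊕ n) ⊗ (x ⊗ γ) ⊖ x ⊗ (x ⊗ γ)) ≃ʳ-refl x γ (ι (fromℕℚ (suc a))) ⟩
  (1ʳ +ʳ ι (fromℕℚ (suc a))) *ʳ (x *ʳ γ) -ʳ x *ʳ (x *ʳ γ)
    ≈⟨ +ʳ-cong (*ʳ-cong (ι-suc (suc a)) ≃ʳ-refl) ≃ʳ-refl ⟨
  ι (fromℕℚ (suc (suc a))) *ʳ (x *ʳ γ) -ʳ x *ʳ (x *ʳ γ) ∎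
  where
  open ≤ʳ-Reasoning
  γ = gamma a x

gammaAntiderivative-derivative : ∀ a → Derivative (gammaAntiderivative a) (gamma a)
gammaAntiderivative-derivative zero = Derivative-congʳ
  (λ x → solveʳ 1 (λ E → κ (-ℚ 1ℚ) ⊗ (κ (-ℚ 1ℚ) ⊗ E) ⊜ E) ≃ʳ-refl (gamma zero x))
  (Derivative-*ˡ (ι (-ℚ 1ℚ)) (gamma-derivative zero))
gammaAntiderivative-derivative (suc a) = Derivative-congʳ
  (λ x → ≃ʳ-trans (+ʳ-cong ≃ʳ-refl (*ʳ-congˡ (ι (-ℚ 1ℚ)) (gamma′-suc a x)))
    (solveʳ 3 (λ n γ γ′ → n ⊗ γ ⊕ κ (-ℚ 1ℚ) ⊗ (n ⊗ γ ⊖ γ′) ⊜ γ′) ≃ʳ-refl (ι (fromℕℚ (suc a))) (gamma a x) (gamma (suc a) x)))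
  (Derivative-+ (Derivative-*ˡ (ι (fromℕℚ (suc a))) (gammaAntiderivative-derivative a))
    (Derivative-*ˡ (ι (-ℚ 1ℚ)) (gamma-derivative (suc a))))

gammaAntiderivative-cong : ∀ a {x y} → x ≃ʳ y → gammaAntiderivative a x ≃ʳ gammaAntiderivative a y
gammaAntiderivative-cong a =
  Lipschitz-cong (Derivative⇒Lipschitz (gamma-bounded a) (gammaAntiderivative-derivative a))

fromℕℚ-* : ∀ m n → fromℕℚ (m * n) ≡ fromℕℚ m *ℚ fromℕℚ n
fromℕℚ-* zero    n = sym (ℚ.*-zeroˡ (fromℕℚ n))
fromℕℚ-* (suc m) n = begin
  fromℕℚ (n + m * n)                ≡⟨ fromℕℚ-+ n (m * n) ⟩
  fromℕℚ n +ℚ fromℕℚ (m * n)        ≡⟨ cong (fromℕℚ n +ℚ_) (fromℕℚ-* m n) ⟩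
  fromℕℚ n +ℚ fromℕℚ m *ℚ fromℕℚ n  ≡⟨ solve 2 (λ m n → n :+ m :* n := (con 1ℚ :+ m) :* n) refl (fromℕℚ m) (fromℕℚ n) ⟩
  (1ℚ +ℚ fromℕℚ m) *ℚ fromℕℚ n      ≡⟨ cong (_*ℚ fromℕℚ n) (fromℕℚ-suc m) ⟨
  fromℕℚ (suc m) *ℚ fromℕℚ n        ∎
  where open ≡-Reasoning

gammaAntiderivative-0 : ∀ a → gammaAntiderivative a 0ʳ ≃ʳ -ʳ ι (fromℕℚ (a !))
gammaAntiderivative-0 zero = ≃ʳ-trans
  (*ʳ-congˡ _ (≃ʳ-trans (expʳ-cong (solveʳ 0 (⊝ κ 0ℚ ⊜ κ 0ℚ) ≃ʳ-refl)) expʳ-0))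
  (solveʳ 0 (κ (-ℚ 1ℚ) ⊗ κ 1ℚ ⊜ ⊝ κ 1ℚ) ≃ʳ-refl)
gammaAntiderivative-0 (suc a) = begin-equality
  ι (fromℕℚ (suc a)) *ʳ gammaAntiderivative a 0ʳ +ʳ ι (-ℚ 1ℚ) *ʳ (0ʳ *ʳ gamma a 0ʳ)
    ≈⟨ +ʳ-cong (*ʳ-congˡ _ (gammaAntiderivative-0 a)) ≃ʳ-refl ⟩
  ι (fromℕℚ (suc a)) *ʳ -ʳ ι (fromℕℚ (a !)) +ʳ ι (-ℚ 1ℚ) *ʳ (0ʳ *ʳ gamma a 0ʳ)
    ≈⟨ solveʳ 3 (λ n f γ → n ⊗ ⊝ f ⊕ κ (-ℚ 1ℚ) ⊗ (κ 0ℚ ⊗ γ) ⊜ ⊝ (n ⊗ f)) ≃ʳ-refl (ι (fromℕℚ (suc a))) (ι (fromℕℚ (a !))) (gamma a 0ʳ) ⟩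
  -ʳ (ι (fromℕℚ (suc a)) *ʳ ι (fromℕℚ (a !)))
    ≈⟨ -ʳ-cong (ι-* (fromℕℚ (suc a)) (fromℕℚ (a !))) ⟨
  -ʳ ι (fromℕℚ (suc a) *ℚ fromℕℚ (a !))
    ≡⟨ cong (λ z → -ʳ ι z) (fromℕℚ-* (suc a) (a !)) ⟨
  -ʳ ι (fromℕℚ (suc a !)) ∎
  where open ≤ʳ-Reasoning

-- Limits at infinity

TendsToʳ : (ℝ → ℝ) → ℝ → Set
TendsToʳ g L = ∀ ε → 0ℚ <ℚ ε → Σ[ M ∈ ℚ ] (∀ R → ι M ≤ʳ R → ∣ g R -ʳ L ∣ʳ ≤ʳ ι ε)

TendsToʳ-const : ∀ c → TendsToʳ (λ _ → c) c
TendsToʳ-const c ε 0<ε = 0ℚ , λ R _ → ≤ʳ-trans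
  (proj₁ (∣∣-cong (solveʳ 1 (λ x → x ⊖ x ⊜ κ 0ℚ) ≃ʳ-refl c)))
  (≤ʳ-trans (∣x∣≤x ≤ʳ-refl) (0≤ι (ℚ.<⇒≤ 0<ε)))

TendsToʳ-congʳ : ∀ {g L L′} → L ≃ʳ L′ → TendsToʳ g L → TendsToʳ g L′
TendsToʳ-congʳ e h ε 0<ε = let M , p = h ε 0<ε in M , λ R M≤R → ∣-∣-resp ≃ʳ-refl e (p R M≤R)

TendsToʳ-+ : ∀ {g h L M} → TendsToʳ g L → TendsToʳ h M → TendsToʳ (λ R → g R +ʳ h R) (L +ʳ M)
TendsToʳ-+ p q ε 0<ε =
  let M₁ , h₁ = p (½ *ℚ ε) (½ε>0 0<ε)
      M₂ , h₂ = q (½ *ℚ ε) (½ε>0 0<ε)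
  in M₁ ℚ.⊔ M₂ , λ R M≤R → ≤ʳ-trans
       (∣-∣-+ (h₁ R (≤ʳ-trans (ι-mono (ℚ.p≤p⊔q M₁ M₂)) M≤R)) (h₂ R (≤ʳ-trans (ι-mono (ℚ.p≤q⊔p M₁ M₂)) M≤R)))
       (subst (λ z → ι (½ *ℚ ε) +ʳ ι (½ *ℚ ε) ≤ʳ ι z) (½+½ ε) (proj₂ (ι-+ (½ *ℚ ε) (½ *ℚ ε))))

TendsToʳ-* : ∀ {g h L M} → TendsToʳ g L → TendsToʳ h M → TendsToʳ (λ R → g R *ʳ h R) (L *ʳ M)
TendsToʳ-* {g} {h} {L} {M} p q ε 0<ε =
  -- With a, b near L, M, the error ab - LM is (a - L)(b - M) + L(b - M) + M(a - L). The summand 1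
  -- covers the quadratic term, since η ≤ 1.
  let K = 1ʳ +ʳ ∣ L ∣ʳ +ʳ ∣ M ∣ʳ
      η′ , 0<η′ , Kη′≤ε = real-scale K ε 0<ε
      η , 0<η , η≤η′ , η≤1 = lower-bound 0<η′ 0<1
      M₁ , h₁ = p η 0<η
      M₂ , h₂ = q η 0<η
  in M₁ ℚ.⊔ M₂ , λ R M≤R →
    let g≈L = h₁ R (≤ʳ-trans (ι-mono (ℚ.p≤p⊔q M₁ M₂)) M≤R)
        h≈M = h₂ R (≤ʳ-trans (ι-mono (ℚ.p≤q⊔p M₁ M₂)) M≤R)
    in begin
    ∣ g R *ʳ h R -ʳ L *ʳ M ∣ʳ
      ≈⟨ ∣∣-cong (solveʳ 4 (λ a b c d → a ⊗ b ⊖ c ⊗ d ⊜ (a ⊖ c) ⊗ (b ⊖ d) ⊕ c ⊗ (b ⊖ d) ⊕ d ⊗ (a ⊖ c)) ≃ʳ-refl (g R) (h R) L M) ⟩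
    ∣ (g R -ʳ L) *ʳ (h R -ʳ M) +ʳ L *ʳ (h R -ʳ M) +ʳ M *ʳ (g R -ʳ L) ∣ʳ
      ≲⟨ ∣+∣-mono (∣+∣-mono (∣*∣-mono (≤ʳ-trans g≈L (ι-mono η≤1)) h≈M) (∣*∣-mono ≤ʳ-refl h≈M)) (∣*∣-mono ≤ʳ-refl g≈L) ⟩
    1ʳ *ʳ ι η +ʳ ∣ L ∣ʳ *ʳ ι η +ʳ ∣ M ∣ʳ *ʳ ι η
      ≈⟨ solveʳ 3 (λ L M η → κ 1ℚ ⊗ η ⊕ L ⊗ η ⊕ M ⊗ η ⊜ (κ 1ℚ ⊕ L ⊕ M) ⊗ η) ≃ʳ-refl ∣ L ∣ʳ ∣ M ∣ʳ (ι η) ⟩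
    K *ʳ ι η
      ≲⟨ *ʳ-monoˡ-≤ (+ʳ-nonneg (+ʳ-nonneg (0≤ι (ℚ.<⇒≤ 0<1)) (0≤∣x∣ L)) (0≤∣x∣ M)) (ι-mono η≤η′) ⟩
    K *ʳ ι η′
      ≲⟨ Kη′≤ε ⟩
    ι ε ∎
  where open ≤ʳ-Reasoning

gamma-nonneg : ∀ a {x} → 0ʳ ≤ʳ x → 0ʳ ≤ʳ gamma a x
gamma-nonneg zero    {x} 0≤x = expʳ-nonneg (-ʳ x)
gamma-nonneg (suc a) 0≤x = *ʳ-nonneg 0≤x (gamma-nonneg a 0≤x)

gamma-^ : ∀ a x → gamma a x ≃ʳ x ^ʳ a *ʳ expʳ (-ʳ x)
gamma-^ zero    x = ≃ʳ-sym (*ʳ-identityˡ _)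
gamma-^ (suc a) x = ≃ʳ-trans (*ʳ-congˡ x (gamma-^ a x)) (≃ʳ-sym (*ʳ-assoc x (x ^ʳ a) _))

fromℕℚ-!-1/! : ∀ n → fromℕℚ (n !) *ℚ 1/ n ! ≡ 1ℚ
fromℕℚ-!-1/! zero    = refl
fromℕℚ-!-1/! (suc n) = begin
  fromℕℚ (suc n * n !) *ℚ 1/ (suc n) !            ≡⟨ cong (_*ℚ 1/ (suc n) !) (fromℕℚ-* (suc n) (n !)) ⟩
  fromℕℚ (suc n) *ℚ fromℕℚ (n !) *ℚ 1/ (suc n) !  ≡⟨ solve 3 (λ s f g → s :* f :* g := f :* (s :* g)) refl (fromℕℚ (suc n)) (fromℕℚ (n !)) (1/ (suc n) !) ⟩
  fromℕℚ (n !) *ℚ (fromℕℚ (suc n) *ℚ 1/ (suc n) !) ≡⟨ cong (fromℕℚ (n !) *ℚ_) (1/!-suc n) ⟩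
  fromℕℚ (n !) *ℚ 1/ n !                          ≡⟨ fromℕℚ-!-1/! n ⟩
  1ℚ ∎
  where open ≡-Reasoning

-- A single term of the exponential series gives xᵃ/a! ≤ eˣ; multiplication by a! e⁻ˣ finishes.
gamma-≤-! : ∀ a {x} → 1ʳ ≤ʳ x → gamma a x ≤ʳ ι (fromℕℚ (a !))
gamma-≤-! a {x} 1≤x = begin
  gamma a x                                    ≈⟨ gamma-^ a x ⟩
  x ^ʳ a *ʳ e                                  ≈⟨ solveʳ 1 (λ z → z ⊜ z ⊗ κ 1ℚ) ≃ʳ-refl _ ⟩
  x ^ʳ a *ʳ e *ʳ 1ʳ                            ≡⟨ cong (λ z → x ^ʳ a *ʳ e *ʳ ι z) (fromℕℚ-!-1/! a) ⟨
  x ^ʳ a *ʳ e *ʳ ι (fromℕℚ (a !) *ℚ 1/ a !)    ≈⟨ *ʳ-congˡ _ (ι-* (fromℕℚ (a !)) (1/ a !)) ⟩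
  x ^ʳ a *ʳ e *ʳ (f *ʳ ι (1/ a !))             ≈⟨ solveʳ 4 (λ p e f r → p ⊗ e ⊗ (f ⊗ r) ⊜ f ⊗ ((p ⊗ r) ⊗ e)) ≃ʳ-refl (x ^ʳ a) e f (ι (1/ a !)) ⟩
  f *ʳ (x ^ʳ a *ʳ ι (1/ a !) *ʳ e)             ≲⟨ *ʳ-monoˡ-≤ (0≤ι (0≤fromℕℚ (a !))) (*ʳ-monoʳ-≤ (expʳ-nonneg (-ʳ x)) (expʳ-≥-term a 1≤x)) ⟩
  f *ʳ (expʳ x *ʳ e)                           ≈⟨ *ʳ-congˡ f (expʳ-inverse x) ⟩
  f *ʳ 1ʳ                                      ≈⟨ solveʳ 1 (λ z → z ⊗ κ 1ℚ ⊜ z) ≃ʳ-refl f ⟩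
  f ∎
  where
  open ≤ʳ-Reasoning
  e = expʳ (-ʳ x)
  f = ι (fromℕℚ (a !))

n!-pos : ∀ n → 0ℚ <ℚ fromℕℚ (n !)
n!-pos n = lem (n !) {{n !≢0}}
  where
  lem : ∀ b .{{_ : NonZero b}} → 0ℚ <ℚ fromℕℚ b
  lem (suc b) = fromℕℚ-pos b

-- The bound one degree higher, R · Rᵃ e⁻ᴿ ≤ (a + 1)!, provides the decay 1/R. Here δ is ε/(a + 1)!
-- and M its reciprocal; the threshold M + 1 also ensures R ≥ 1.
gamma-tendsTo-0 : ∀ a → TendsToʳ (gamma a) 0ʳ
gamma-tendsTo-0 a ε 0<ε =
  let N = fromℕℚ (suc a !)
      δ , 0<δ , Nδ≡ε = scale {ε} {N} 0<ε (n!-pos (suc a))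
      M , 0<M , δM≡1 = scale {1ℚ} {δ} 0<1 0<δ
  in M +ℚ 1ℚ , λ R M+1≤R →
    let M≤R = ≤ʳ-trans (ι-mono (≤-+ʳ (ℚ.<⇒≤ 0<1))) M+1≤R
        1≤R = ≤ʳ-trans (ι-mono (≤-+ˡ (ℚ.<⇒≤ 0<M))) M+1≤R
        0≤γ = gamma-nonneg a (≤ʳ-trans (0≤ι (ℚ.<⇒≤ 0<1)) 1≤R)
    in begin
    ∣ gamma a R -ʳ 0ʳ ∣ʳ               ≈⟨ ∣∣-cong (solveʳ 1 (λ z → z ⊖ κ 0ℚ ⊜ z ⊗ κ 1ℚ) ≃ʳ-refl (gamma a R)) ⟩
    ∣ gamma a R *ʳ 1ʳ ∣ʳ               ≡⟨ cong (λ z → ∣ gamma a R *ʳ ι z ∣ʳ) δM≡1 ⟨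
    ∣ gamma a R *ʳ ι (δ *ℚ M) ∣ʳ       ≲⟨ ∣*∣-mono (∣x∣≤x 0≤γ) (∣x∣≤x (0≤ι (*-nonneg (ℚ.<⇒≤ 0<δ) (ℚ.<⇒≤ 0<M)))) ⟩
    gamma a R *ʳ ι (δ *ℚ M)            ≈⟨ *ʳ-congˡ _ (ι-* δ M) ⟩
    gamma a R *ʳ (ι δ *ʳ ι M)          ≲⟨ *ʳ-monoˡ-≤ 0≤γ (*ʳ-monoˡ-≤ (0≤ι (ℚ.<⇒≤ 0<δ)) M≤R) ⟩
    gamma a R *ʳ (ι δ *ʳ R)            ≈⟨ solveʳ 3 (λ γ d R → γ ⊗ (d ⊗ R) ⊜ R ⊗ γ ⊗ d) ≃ʳ-refl (gamma a R) (ι δ) R ⟩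
    gamma (suc a) R *ʳ ι δ             ≲⟨ *ʳ-monoʳ-≤ (0≤ι (ℚ.<⇒≤ 0<δ)) (gamma-≤-! (suc a) 1≤R) ⟩
    ι N *ʳ ι δ                         ≈⟨ ι-* N δ ⟨
    ι (N *ℚ δ)                         ≡⟨ cong ι Nδ≡ε ⟩
    ι ε ∎
  where open ≤ʳ-Reasoning

gammaAntiderivative-tendsTo-0 : ∀ a → TendsToʳ (gammaAntiderivative a) 0ʳ
gammaAntiderivative-tendsTo-0 zero = TendsToʳ-congʳ
  (solveʳ 0 (κ (-ℚ 1ℚ) ⊗ κ 0ℚ ⊜ κ 0ℚ) ≃ʳ-refl)
  (TendsToʳ-* (TendsToʳ-const (ι (-ℚ 1ℚ))) (gamma-tendsTo-0 zero))
gammaAntiderivative-tendsTo-0 (suc a) = TendsToʳ-congʳ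
  (solveʳ 1 (λ n → n ⊗ κ 0ℚ ⊕ κ (-ℚ 1ℚ) ⊗ κ 0ℚ ⊜ κ 0ℚ) ≃ʳ-refl (ι (fromℕℚ (suc a))))
  (TendsToʳ-+ (TendsToʳ-* (TendsToʳ-const (ι (fromℕℚ (suc a)))) (gammaAntiderivative-tendsTo-0 a))
    (TendsToʳ-* (TendsToʳ-const (ι (-ℚ 1ℚ))) (gamma-tendsTo-0 (suc a))))

gammaIntegral : ℕ → ℝ → ℝ
gammaIntegral a R = gammaAntiderivative a R -ʳ gammaAntiderivative a 0ʳ

gammaIntegral-isIntegral : ∀ a R → IsIntegral₁ (gamma a) R (gammaIntegral a R)
gammaIntegral-isIntegral a R =
  IsIntegral₁-Derivative (gammaAntiderivative-cong a) (gammaAntiderivative-derivative a)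

gammaIntegral-tendsTo : ∀ a → TendsToʳ (gammaIntegral a) (ι (fromℕℚ (a !)))
gammaIntegral-tendsTo a = TendsToʳ-congʳ
  (≃ʳ-trans (+ʳ-cong ≃ʳ-refl (-ʳ-cong (gammaAntiderivative-0 a)))
    (solveʳ 1 (λ f → κ 0ℚ ⊖ ⊝ f ⊜ f) ≃ʳ-refl (ι (fromℕℚ (a !)))))
  (TendsToʳ-+ (gammaAntiderivative-tendsTo-0 a) (TendsToʳ-const (-ʳ gammaAntiderivative a 0ʳ)))

-- Integrals over the orthant

-- Boundedness travels with the integral because `IsIntegralʳ-⊠` asks for it when the next variable
-- is added.
record Integrable {k} (f : Vector ℝ k → ℝ) (L : ℝ) : Set where
  field
    integral   : ℝ → ℝ
    isIntegral : ∀ R → IsIntegralʳ f R (integral R)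
    tendsTo    : TendsToʳ integral L
    isBounded  : Bounded f

open Integrable

Integrable-cong : ∀ {k L L′} {f g : Vector ℝ k → ℝ} → (∀ x → f x ≃ʳ g x) → L ≃ʳ L′ →
  Integrable f L → Integrable g L′
Integrable-cong e L≃L′ F = record
  { integral   = integral F
  ; isIntegral = λ R → IsIntegralʳ-cong e (isIntegral F R)
  ; tendsTo    = TendsToʳ-congʳ L≃L′ (tendsTo F)
  ; isBounded  = λ b → let B , 0≤B , h = isBounded F b
                       in B , 0≤B , λ x x≤b → ≤ʳ-trans (proj₂ (∣∣-cong (e x))) (h x x≤b)
  }

Integrable-+ : ∀ {k L M} {f g : Vector ℝ k → ℝ} → Integrable f L → Integrable g M →
  Integrable (λ x → f x +ʳ g x) (L +ʳ M)
Integrable-+ {f = f} {g} F G = record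
  { integral   = λ R → integral F R +ʳ integral G R
  ; isIntegral = λ R → IsIntegralʳ-+ {f = f} {g} (isIntegral F R) (isIntegral G R)
  ; tendsTo    = TendsToʳ-+ (tendsTo F) (tendsTo G)
  ; isBounded  = λ b → let B , 0≤B , h = isBounded F b
                           B′ , 0≤B′ , h′ = isBounded G b
                       in B +ʳ B′ , +ʳ-nonneg 0≤B 0≤B′ , λ x x≤b → ∣+∣-mono (h x x≤b) (h′ x x≤b)
  }

Integrable-0 : ∀ {c} {f : Vector ℝ 0 → ℝ} → (∀ x → f x ≃ʳ c) → Integrable f c
Integrable-0 {c} f≃c = record
  { integral   = λ _ → c
  ; isIntegral = λ R → IsIntegralʳ-0 f≃c
  ; tendsTo    = TendsToʳ-const c
  ; isBounded  = λ b → ∣ c ∣ʳ , 0≤∣x∣ c , λ x _ → proj₁ (∣∣-cong (f≃c x))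
  }

Integrable-gamma⊠ : ∀ {k L} {g : Vector ℝ k → ℝ} a → Integrable g L →
  Integrable (gamma a ⊠ g) (ι (fromℕℚ (a !)) *ʳ L)
Integrable-gamma⊠ {g = g} a G = record
  { integral   = λ R → gammaIntegral a R *ʳ integral G R
  ; isIntegral = λ R → IsIntegralʳ-⊠ (gamma-bounded a) (gamma-lipschitz a) (isBounded G)
                         (gammaIntegral-isIntegral a R) (isIntegral G R)
  ; tendsTo    = TendsToʳ-* (gammaIntegral-tendsTo a) (tendsTo G)
  ; isBounded  = λ b → let B , 0≤B , h = gamma-bounded a b
                           B′ , 0≤B′ , h′ = isBounded G b
                       in B *ʳ B′ , *ʳ-nonneg 0≤B 0≤B′ ,
                          λ x x≤b → ∣*∣-mono (h (x zero) (x≤b zero)) (h′ _ (λ i → x≤b (suc i)))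
  }

-- Moments of e₁ and e₂

-- The functional f ↦ Λ ⊗ ∫ f e⁻ᵗ dt applied to
-- (E₂ + t E₁)ᵐ (E₁ + t)ⁿ E₂ⁱ E₁ʲ tᵃ, where Λ i j stands for the value at E₂ⁱ E₁ʲ.
mixedMoment : (ℕ → ℕ → ℚ) → ℕ → ℕ → ℕ → ℕ → ℕ → ℚ
mixedMoment Λ zero    zero    i j a = fromℕℚ (a !) *ℚ Λ i j
mixedMoment Λ zero    (suc n) i j a = mixedMoment Λ zero n i (suc j) a +ℚ mixedMoment Λ zero n i j (suc a)
mixedMoment Λ (suc m) n       i j a = mixedMoment Λ m n (suc i) j a +ℚ mixedMoment Λ m n i (suc j) (suc a)

-- In dimension 0 the orthant is one point, where both symmetric polynomials vanish, so only the
-- zeroth powers contribute.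
moment : ℕ → ℕ → ℕ → ℚ
moment zero    zero    zero    = 1ℚ
moment zero    zero    (suc n) = 0ℚ
moment zero    (suc m) n       = 0ℚ
moment (suc k) m       n       = mixedMoment (moment k) m n 0 0 0

e₁ʳ e₂ʳ : ∀ {k} → Vector ℝ k → ℝ
e₁ʳ x = sumʳ x
e₂ʳ x = sumʳ λ i → sumʳ λ j → if does (i Fin.<? j) then x i *ʳ x j else 0ʳ

e₂ʳ-suc : ∀ {k} (x : Vector ℝ (suc k)) →
  e₂ʳ x ≃ʳ e₂ʳ (λ i → x (suc i)) +ʳ x zero *ʳ e₁ʳ (λ i → x (suc i))
e₂ʳ-suc {k} x = begin-equality
  -- The displayed zeros are the entries of the first column, where i < j fails; the rest of the
  -- first row gives x₀ e₁.
  (0ʳ +ʳ sumʳ (λ j → x zero *ʳ x (suc j))) +ʳ sumʳ (λ i → 0ʳ +ʳ row i)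
    ≈⟨ +ʳ-cong (≃ʳ-trans (+ʳ-identityˡ _) (sum-* (x zero) (λ j → x (suc j))))
               (sum-cong {k} {λ i → 0ʳ +ʳ row i} {row} (λ i → +ʳ-identityˡ (row i))) ⟩
  x zero *ʳ e₁ʳ (λ i → x (suc i)) +ʳ sumʳ row
    ≈⟨ +ʳ-comm _ _ ⟩
  sumʳ row +ʳ x zero *ʳ e₁ʳ (λ i → x (suc i)) ∎
  where
  open ≤ʳ-Reasoning
  row : Vector ℝ k
  row i = sumʳ λ j → if does (i Fin.<? j) then x (suc i) *ʳ x (suc j) else 0ʳ

integrand : ∀ k → ℕ → ℕ → Vector ℝ k → ℝ
integrand k m n x = e₂ʳ x ^ʳ m *ʳ e₁ʳ x ^ʳ n *ʳ expʳ (-ʳ e₁ʳ x)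

mixedIntegrand : ∀ k → ℕ → ℕ → ℕ → ℕ → ℕ → Vector ℝ (suc k) → ℝ
mixedIntegrand k m n i j a x = e₂ʳ x ^ʳ m *ʳ e₁ʳ x ^ʳ n *ʳ (gamma a ⊠ integrand k i j) x

mixedIntegrand-e₂ : ∀ k m n i j a x → mixedIntegrand k m n (suc i) j a x +ʳ mixedIntegrand k m n i (suc j) (suc a) x
  ≃ʳ mixedIntegrand k (suc m) n i j a x
mixedIntegrand-e₂ k m n i j a x = ≃ʳ-trans
  (solveʳ 9 (λ M N γ t p q P Q E →
     M ⊗ N ⊗ (γ ⊗ (p ⊗ P ⊗ Q ⊗ E)) ⊕ M ⊗ N ⊗ ((t ⊗ γ) ⊗ (P ⊗ (q ⊗ Q) ⊗ E)) ⊜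
     (p ⊕ t ⊗ q) ⊗ M ⊗ N ⊗ (γ ⊗ (P ⊗ Q ⊗ E))) ≃ʳ-refl
     (e₂ʳ x ^ʳ m) (e₁ʳ x ^ʳ n) (gamma a (x zero)) (x zero) (e₂ʳ y) (e₁ʳ y) (e₂ʳ y ^ʳ i) (e₁ʳ y ^ʳ j) (expʳ (-ʳ e₁ʳ y)))
  (*ʳ-cong (*ʳ-cong (*ʳ-cong (≃ʳ-sym (e₂ʳ-suc x)) ≃ʳ-refl) ≃ʳ-refl) ≃ʳ-refl)
  where
  y : Vector ℝ k
  y i = x (suc i)

mixedIntegrand-e₁ : ∀ k n i j a x → mixedIntegrand k 0 n i (suc j) a x +ʳ mixedIntegrand k 0 n i j (suc a) x
  ≃ʳ mixedIntegrand k 0 (suc n) i j a x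
mixedIntegrand-e₁ k n i j a x =
  solveʳ 7 (λ N γ t q P Q E →
     κ 1ℚ ⊗ N ⊗ (γ ⊗ (P ⊗ (q ⊗ Q) ⊗ E)) ⊕ κ 1ℚ ⊗ N ⊗ ((t ⊗ γ) ⊗ (P ⊗ Q ⊗ E)) ⊜
     κ 1ℚ ⊗ ((t ⊕ q) ⊗ N) ⊗ (γ ⊗ (P ⊗ Q ⊗ E))) ≃ʳ-refl
     (e₁ʳ x ^ʳ n) (gamma a (x zero)) (x zero) (e₁ʳ y) (e₂ʳ y ^ʳ i) (e₁ʳ y ^ʳ j) (expʳ (-ʳ e₁ʳ y))
  where
  y : Vector ℝ k
  y i = x (suc i)

-- Each factor e₂ or e₁ of all variables is a sum of two monomials in t and the symmetric functions
-- of the others. Linearity therefore reduces to no such factors, where the integrand is a pure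
-- product.
mixedIntegrand-integrable : ∀ {k} → (∀ m n → Integrable (integrand k m n) (ι (moment k m n))) →
  ∀ m n i j a → Integrable (mixedIntegrand k m n i j a) (ι (mixedMoment (moment k) m n i j a))
mixedIntegrand-integrable {k} H zero zero i j a = Integrable-cong
  (λ x → solveʳ 1 (λ z → z ⊜ κ 1ℚ ⊗ κ 1ℚ ⊗ z) ≃ʳ-refl ((gamma a ⊠ integrand k i j) x))
  (≃ʳ-sym (ι-* (fromℕℚ (a !)) (moment k i j)))
  (Integrable-gamma⊠ a (H i j))
mixedIntegrand-integrable {k} H zero (suc n) i j a = Integrable-cong
  (mixedIntegrand-e₁ k n i j a) (≃ʳ-sym (ι-+ _ _))
  (Integrable-+ (mixedIntegrand-integrable H zero n i (suc j) a) (mixedIntegrand-integrable H zero n i j (suc a)))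
mixedIntegrand-integrable {k} H (suc m) n i j a = Integrable-cong
  (mixedIntegrand-e₂ k m n i j a) (≃ʳ-sym (ι-+ _ _))
  (Integrable-+ (mixedIntegrand-integrable H m n (suc i) j a) (mixedIntegrand-integrable H m n i (suc j) (suc a)))

integrand-integrable : ∀ k m n → Integrable (integrand k m n) (ι (moment k m n))
integrand-integrable zero zero zero = Integrable-0 λ x → ≃ʳ-trans
  (*ʳ-congˡ _ (≃ʳ-trans (expʳ-cong (solveʳ 0 (⊝ κ 0ℚ ⊜ κ 0ℚ) ≃ʳ-refl)) expʳ-0))
  (solveʳ 0 (κ 1ℚ ⊗ κ 1ℚ ⊗ κ 1ℚ ⊜ κ 1ℚ) ≃ʳ-refl)
integrand-integrable zero zero (suc n) = Integrable-0 λ x →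
  solveʳ 2 (λ N E → κ 1ℚ ⊗ (κ 0ℚ ⊗ N) ⊗ E ⊜ κ 0ℚ) ≃ʳ-refl (0ʳ ^ʳ n) (expʳ (-ʳ 0ʳ))
integrand-integrable zero (suc m) n = Integrable-0 λ x →
  solveʳ 3 (λ M N E → (κ 0ℚ ⊗ M) ⊗ N ⊗ E ⊜ κ 0ℚ) ≃ʳ-refl (0ʳ ^ʳ m) (0ʳ ^ʳ n) (expʳ (-ʳ 0ʳ))
-- With i = j = a = 0 the product part is e⁻ᵗ times the exponential in the other variables; the
-- functional equation merges the two.
integrand-integrable (suc k) m n = Integrable-cong
  (λ x → let s = e₁ʳ {k} (λ i → x (suc i)) in ≃ʳ-trans
    (solveʳ 4 (λ M N e E → M ⊗ N ⊗ (e ⊗ (κ 1ℚ ⊗ κ 1ℚ ⊗ E)) ⊜ M ⊗ N ⊗ (e ⊗ E)) ≃ʳ-refl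
      (e₂ʳ x ^ʳ m) (e₁ʳ x ^ʳ n) (expʳ (-ʳ x zero)) (expʳ (-ʳ s)))
    (*ʳ-congˡ _ (≃ʳ-trans (≃ʳ-sym (expʳ-+ (-ʳ x zero) (-ʳ s))) (expʳ-cong (-ʳ-+ (x zero) s)))))
  ≃ʳ-refl
  (mixedIntegrand-integrable (integrand-integrable k) m n 0 0 0)

-- Transfer from the opaque operations to the original ones

opaque
  unfolding _≤ʳ_ _+ʳ_ _*ʳ_ -ʳ_ ∣_∣ʳ expʳ ι

  ≤ʳ≡≤ℝ : _≤ʳ_ ≡ _≤ℝ_
  ≤ʳ≡≤ℝ = refl

  +ʳ≡+ℝ : _+ʳ_ ≡ _+ℝ_
  +ʳ≡+ℝ = refl

  *ʳ≡*ℝ : _*ʳ_ ≡ _*ℝ_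
  *ʳ≡*ℝ = refl

  -ʳ≡-ℝ : -ʳ_ ≡ -ℝ_
  -ʳ≡-ℝ = refl

  ∣∣ʳ≡∣∣ℝ : ∣_∣ʳ ≡ ∣_∣ℝ
  ∣∣ʳ≡∣∣ℝ = refl

  expʳ≡exp : expʳ ≡ exp
  expʳ≡exp = refl

  ι≡fromℚ : ι ≡ fromℚ
  ι≡fromℚ = refl

-- Equality is spelled out through the order, so that the opaque and the original semiring are both
-- instances of one expression.
rawSemiring : (ℝ → ℝ → Set) → (ℝ → ℝ → ℝ) → (ℝ → ℝ → ℝ) → (ℚ → ℝ) → RawSemiring 0ℓ 0ℓ
rawSemiring _≤₁_ _+₁_ _*₁_ ι₁ = record
  { _≈_ = λ x y → (x ≤₁ y) × (y ≤₁ x) ; _+_ = _+₁_ ; _*_ = _*₁_ ; 0# = ι₁ 0ℚ ; 1# = ι₁ 1ℚ }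

-- Replacing all operations simultaneously lets each comparison begin as `refl` between opaque
-- terms, with nothing unfolded.
transfer : (P : (ℝ → ℝ → Set) → (ℝ → ℝ → ℝ) → (ℝ → ℝ → ℝ) → (ℝ → ℝ) → (ℚ → ℝ) → Set) →
  P _≤ʳ_ _+ʳ_ _*ʳ_ -ʳ_ ι → P _≤ℝ_ _+ℝ_ _*ℝ_ -ℝ_ fromℚ
transfer P = lemma ≤ʳ≡≤ℝ +ʳ≡+ℝ *ʳ≡*ℝ -ʳ≡-ℝ ι≡fromℚ
  where
  lemma : ∀ {r f g h i} → _≤ʳ_ ≡ r → _+ʳ_ ≡ f → _*ʳ_ ≡ g → -ʳ_ ≡ h → ι ≡ i →
    P _≤ʳ_ _+ʳ_ _*ʳ_ -ʳ_ ι → P r f g h i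
  lemma refl refl refl refl refl p = p

sumʳ≡sumℝ : ∀ {n} (v : Vector ℝ n) → sumʳ v ≡ sumℝ v
sumʳ≡sumℝ v = transfer (λ _≤₁_ _+₁_ _*₁_ _ ι₁ →
  sumʳ v ≡ RawSemiringOps.sum (rawSemiring _≤₁_ _+₁_ _*₁_ ι₁) v) refl

^ʳ≡^ℝ : ∀ {x y} → x ≡ y → ∀ m → x ^ʳ m ≡ y ^ℝ m
^ʳ≡^ℝ {x} refl m = transfer (λ _≤₁_ _+₁_ _*₁_ _ ι₁ →
  x ^ʳ m ≡ RawSemiringOps._^_ (rawSemiring _≤₁_ _+₁_ _*₁_ ι₁) x m) refl

e₂ʳ≡e₂ : ∀ {k} (x : Vector ℝ k) → e₂ʳ x ≡ e₂ x
e₂ʳ≡e₂ x = transfer (λ _≤₁_ _+₁_ _*₁_ _ ι₁ → e₂ʳ x ≡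
  (RawSemiringOps.sum (rawSemiring _≤₁_ _+₁_ _*₁_ ι₁) λ i →
   RawSemiringOps.sum (rawSemiring _≤₁_ _+₁_ _*₁_ ι₁) λ j →
    if does (i Fin.<? j) then x i *₁ x j else ι₁ 0ℚ)) refl

volumeʳ≡volume : ∀ {k a b} (P : Grid k a b) c → volumeʳ P c ≡ volume P c
volumeʳ≡volume P c = transfer (λ _≤₁_ _+₁_ _*₁_ neg ι₁ → volumeʳ P c ≡
  RawSemiringOps.product (rawSemiring _≤₁_ _+₁_ _*₁_ ι₁) (λ i → upper (P i) (c i) +₁ neg (lower (P i) (c i)))) refl

-- The summands are identical cell by cell, but as functions they are only pointwise equal, so
-- without extensionality the sums are compared as reals.
sumCells≃sumCellsʳ : ∀ {k} (n : Fin k → ℕ) {F G} → (∀ c → F c ≡ G c) → sumCellsʳ n F ≃ʳ sumCells n G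
sumCells≃sumCellsʳ {zero}  n F≡G = subst (λ z → z ≃ʳ _) (sym (F≡G _)) ≃ʳ-refl
sumCells≃sumCellsʳ {suc k} n {F} {G} F≡G = subst (sumCellsʳ n F ≃ʳ_)
  (sumʳ≡sumℝ (λ j → sumCells (λ i → n (suc i)) (λ c → G (Fin.∀-cons j c))))
  (sum-cong {n zero} (λ j → sumCells≃sumCellsʳ (λ i → n (suc i)) (λ c → F≡G (Fin.∀-cons j c))))

riemannSum≃riemannSumʳ : ∀ {k a b} f (P : Grid k a b) tag → riemannSumʳ f P tag ≃ʳ riemannSum f P tag
riemannSum≃riemannSumʳ f P tag = sumCells≃sumCellsʳ (λ i → size (P i))
  {λ c → f (tag c) *ʳ volumeʳ P c} {λ c → f (tag c) *ℝ volume P c}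
  (λ c → trans (cong (f (tag c) *ʳ_) (volumeʳ≡volume P c)) (cong (λ g → g (f (tag c)) (volume P c)) *ʳ≡*ℝ))

≤ʳ⇒≤ℝ : ∀ {x y} → x ≤ʳ y → x ≤ℝ y
≤ʳ⇒≤ℝ {x} {y} = subst (λ r → r x y) ≤ʳ≡≤ℝ

≤ℝ⇒≤ʳ : ∀ {x y} → x ≤ℝ y → x ≤ʳ y
≤ℝ⇒≤ʳ {x} {y} = subst (λ r → r x y) (sym ≤ʳ≡≤ℝ)

-ʳ≡-ℝ₂ : ∀ x y → x -ʳ y ≡ x -ℝ y
-ʳ≡-ℝ₂ x y = transfer (λ _ _+₁_ _ neg _ → x -ʳ y ≡ x +₁ neg y) refl

ι≡fromℚ₁ : ∀ q → ι q ≡ fromℚ q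
ι≡fromℚ₁ q = cong (λ i → i q) ι≡fromℚ

≤ℝ⇒≤ʳ-ι : ∀ {x y q} → x ≡ y → y ≤ℝ fromℚ q → x ≤ʳ ι q
≤ℝ⇒≤ʳ-ι {x} {y} {q} x≡y h = subst₂ _≤ʳ_ (sym x≡y) (sym (ι≡fromℚ₁ q)) (≤ℝ⇒≤ʳ {y} {fromℚ q} h)

∣-∣≤ʳ⇒≤ℝ : ∀ x y q → ∣ x -ʳ y ∣ʳ ≤ʳ ι q → ∣ x -ℝ y ∣ℝ ≤ℝ fromℚ q
∣-∣≤ʳ⇒≤ℝ x y q h = ≤ʳ⇒≤ℝ {∣ x -ℝ y ∣ℝ} {fromℚ q} (subst₂ _≤ʳ_
  (trans (cong ∣_∣ʳ (-ʳ≡-ℝ₂ x y)) (cong (λ f → f (x -ℝ y)) ∣∣ʳ≡∣∣ℝ)) (ι≡fromℚ₁ q) h)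

0ʳ≡0ℝ : 0ʳ ≡ 0ℝ
0ʳ≡0ℝ = ι≡fromℚ₁ 0ℚ

-- The left end point occurs in the type of grids. As a variable `z` it can be identified with `0ʳ`
-- by matching, which leaves the grids and their cells untouched.
isIntegralOverCube : ∀ {k z} (f : Vector ℝ k → ℝ) R I → 0ʳ ≡ z → IsIntegralʳ f R I → IsIntegralOverCube f z R I
isIntegralOverCube f R I refl h ε 0<ε =
  proj₁ (h ε 0<ε) , proj₁ (proj₂ (h ε 0<ε)) , λ P mesh tag tagged →
    ∣-∣≤ʳ⇒≤ℝ (riemannSum f P tag) I ε
      (∣-∣-resp {riemannSumʳ f P tag} {I} {riemannSum f P tag} {I} {ι ε} (riemannSum≃riemannSumʳ f P tag) (≃ʳ-refl {I})
        (proj₂ (proj₂ (h ε 0<ε)) P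
          (λ i j → ≤ℝ⇒≤ʳ-ι {widthʳ (P i) j} {width (P i) j} (-ʳ≡-ℝ₂ (upper (P i) j) (lower (P i) j)) (mesh i j)) tag
          (λ c i → ≤ℝ⇒≤ʳ {lower (P i) (c i)} {tag c i} (proj₁ (tagged c i)) ,
                   ≤ℝ⇒≤ʳ {tag c i} {upper (P i) (c i)} (proj₂ (tagged c i)))))

tendsToℝ : ∀ (g : ℝ → ℝ) q → TendsToʳ g (ι q) → TendsTo g (fromℚ q)
tendsToℝ g q h ε 0<ε = proj₁ (h ε 0<ε) , λ R M≤R →
  subst (λ z → ∣ g R -ℝ z ∣ℝ ≤ℝ fromℚ ε) (ι≡fromℚ₁ q)
    (∣-∣≤ʳ⇒≤ℝ (g R) (ι q) ε (proj₂ (h ε 0<ε) R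
      (subst (_≤ʳ R) (sym (ι≡fromℚ₁ (proj₁ (h ε 0<ε)))) (≤ℝ⇒≤ʳ {fromℚ (proj₁ (h ε 0<ε))} {R} M≤R))))

isIntegralOverOrthant : ∀ {k q} {f : Vector ℝ k → ℝ} → Integrable f (ι q) → IsIntegralOverOrthant f (fromℚ q)
isIntegralOverOrthant {q = q} {f} F =
  integral F , (λ R _ → isIntegralOverCube f R (integral F R) 0ʳ≡0ℝ (isIntegral F R)) , tendsToℝ (integral F) q (tendsTo F)

exp-neg≡ : ∀ {x y} → x ≡ y → expʳ (-ʳ x) ≡ exp (-ℝ y)
exp-neg≡ {x} refl = trans (cong (λ f → expʳ (f x)) -ʳ≡-ℝ) (cong (λ f → f (-ℝ x)) expʳ≡exp)

e₁ʳ≡e₁ : ∀ {k} (x : Vector ℝ k) → e₁ʳ x ≡ e₁ x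
e₁ʳ≡e₁ = sumʳ≡sumℝ

-- Agda unfolds products in ℝ unless both sides are syntactically equal, which
-- matching on refl ensures.
integrand-cong : ∀ {k} m n (x : Vector ℝ k) {a b c} → a ≡ e₂ x ^ℝ m → b ≡ e₁ x ^ℝ n → c ≡ exp (-ℝ e₁ x) →
  a *ℝ b *ℝ c ≡ e₂ x ^ℝ m *ℝ e₁ x ^ℝ n *ℝ exp (-ℝ e₁ x)
integrand-cong m n x refl refl refl = refl

integrand-congʳ : ∀ {k} m n (x : Vector ℝ k) a b c → a ≡ e₂ x ^ℝ m → b ≡ e₁ x ^ℝ n → c ≡ exp (-ℝ e₁ x) →
  a *ʳ b *ʳ c ≡ e₂ x ^ℝ m *ℝ e₁ x ^ℝ n *ℝ exp (-ℝ e₁ x)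
integrand-congʳ m n x a b c p q r =
  trans (cong (λ f → f (f a b) c) *ʳ≡*ℝ) (integrand-cong m n x {a} {b} {c} p q r)

integrand≡ : ∀ k m n (x : Vector ℝ k) → integrand k m n x ≡ e₂ x ^ℝ m *ℝ e₁ x ^ℝ n *ℝ exp (-ℝ e₁ x)
integrand≡ k m n x = integrand-congʳ m n x (e₂ʳ x ^ʳ m) (e₁ʳ x ^ʳ n) (expʳ (-ʳ e₁ʳ x))
  (^ʳ≡^ℝ (e₂ʳ≡e₂ x) m) (^ʳ≡^ℝ (e₁ʳ≡e₁ x) n) (exp-neg≡ (e₁ʳ≡e₁ x))

orthant-integral : ∀ k m n → IsIntegralOverOrthant {k}
  (λ x → e₂ x ^ℝ m *ℝ e₁ x ^ℝ n *ℝ exp (-ℝ e₁ x)) (fromℚ (moment k m n))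
orthant-integral k m n = isIntegralOverOrthant (Integrable-cong
  (λ x → subst (integrand k m n x ≃ʳ_) (integrand≡ k m n x) ≃ʳ-refl) ≃ʳ-refl (integrand-integrable k m n))

-- Recurrences for the moments

-- By definition a factor E₁ + t is expanded only after all factors E₂ + t E₁; the two kinds of
-- expansion commute, so it can be split off at any m.
mixedMoment-e₁ : ∀ Λ m n i j a → mixedMoment Λ m (suc n) i j a ≡
  mixedMoment Λ m n i (suc j) a +ℚ mixedMoment Λ m n i j (suc a)
mixedMoment-e₁ Λ zero    n i j a = refl
mixedMoment-e₁ Λ (suc m) n i j a = trans
  (cong₂ _+ℚ_ (mixedMoment-e₁ Λ m n (suc i) j a) (mixedMoment-e₁ Λ m n i (suc j) (suc a)))
  (solve 4 (λ x y z w → (x :+ y) :+ (z :+ w) := (x :+ z) :+ (y :+ w)) refl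
    (mixedMoment Λ m n (suc i) (suc j) a) (mixedMoment Λ m n (suc i) j (suc a))
    (mixedMoment Λ m n i (suc (suc j)) (suc a)) (mixedMoment Λ m n i (suc j) (suc (suc a))))

-- Euler's identity: E₁ acts on ∫ f e^(-e₁) for f homogeneous of degree d as d + k.
Euler : ℕ → (ℕ → ℕ → ℚ) → Set
Euler k Λ = ∀ i j → Λ i (suc j) ≡ fromℕℚ (2 * i + j + k) *ℚ Λ i j

-- The left side inserts one more factor E₁ + t. Expansion preserves the degree in both branches, so
-- the same d serves throughout; at the bottom Euler's identity for Λ meets (a + 1)! = (a + 1) a!.
mixedMoment-euler : ∀ {k Λ} → Euler k Λ → ∀ m n i j a d → 2 * m + n + (2 * i + j) + a + suc k ≡ d →
  mixedMoment Λ m n i (suc j) a +ℚ mixedMoment Λ m n i j (suc a) ≡ fromℕℚ d *ℚ mixedMoment Λ m n i j a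
mixedMoment-euler {k} {Λ} euler zero zero i j a d refl = begin
  f *ℚ Λ i (suc j) +ℚ fromℕℚ (suc a * a !) *ℚ Λ i j
    ≡⟨ cong₂ (λ x y → f *ℚ x +ℚ y *ℚ Λ i j) (euler i j) (fromℕℚ-* (suc a) (a !)) ⟩
  f *ℚ (fromℕℚ (2 * i + j + k) *ℚ Λ i j) +ℚ fromℕℚ (suc a) *ℚ f *ℚ Λ i j
    ≡⟨ solve 4 (λ f e l s → f :* (e :* l) :+ s :* f :* l := (e :+ s) :* (f :* l)) refl
         f (fromℕℚ (2 * i + j + k)) (Λ i j) (fromℕℚ (suc a)) ⟩
  (fromℕℚ (2 * i + j + k) +ℚ fromℕℚ (suc a)) *ℚ (f *ℚ Λ i j)
    ≡⟨ cong (_*ℚ (f *ℚ Λ i j)) (trans (sym (fromℕℚ-+ (2 * i + j + k) (suc a))) (cong fromℕℚ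
         (ℕ-solve 3 (λ s k a → (s ∔ k) ∔ (ℕ-con 1 ∔ a) ≗ (ℕ-con 0 ∔ s) ∔ a ∔ (ℕ-con 1 ∔ k)) refl (2 * i + j) k a))) ⟩
  fromℕℚ (2 * i + j + a + suc k) *ℚ (f *ℚ Λ i j) ∎
  where
  open ≡-Reasoning
  f = fromℕℚ (a !)
mixedMoment-euler {k} {Λ} euler zero (suc n) i j a d refl = trans
  (cong₂ _+ℚ_
    (mixedMoment-euler euler zero n i (suc j) a d
      (ℕ-solve 5 (λ n i j a k → n ∔ (i ∔ (ℕ-con 1 ∔ j)) ∔ a ∔ k ≗ (ℕ-con 1 ∔ n) ∔ (i ∔ j) ∔ a ∔ k) refl n (2 * i) j a (suc k)))
    (mixedMoment-euler euler zero n i j (suc a) d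
      (ℕ-solve 5 (λ n i j a k → n ∔ (i ∔ j) ∔ (ℕ-con 1 ∔ a) ∔ k ≗ (ℕ-con 1 ∔ n) ∔ (i ∔ j) ∔ a ∔ k) refl n (2 * i) j a (suc k))))
  (sym (ℚ.*-distribˡ-+ (fromℕℚ d) _ _))
mixedMoment-euler {k} {Λ} euler (suc m) n i j a d refl = begin
  (W (suc i) (suc j) a +ℚ W i (suc (suc j)) (suc a)) +ℚ (W (suc i) j (suc a) +ℚ W i (suc j) (suc (suc a)))
    ≡⟨ solve 4 (λ x y z w → (x :+ y) :+ (z :+ w) := (x :+ z) :+ (y :+ w)) refl
         (W (suc i) (suc j) a) (W i (suc (suc j)) (suc a)) (W (suc i) j (suc a)) (W i (suc j) (suc (suc a))) ⟩
  (W (suc i) (suc j) a +ℚ W (suc i) j (suc a)) +ℚ (W i (suc (suc j)) (suc a) +ℚ W i (suc j) (suc (suc a)))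
    ≡⟨ cong₂ _+ℚ_
         (mixedMoment-euler euler m n (suc i) j a d
           (ℕ-solve 6 (λ m n i j a k → ℕ-con 2 ∙ m ∔ n ∔ (ℕ-con 2 ∙ (ℕ-con 1 ∔ i) ∔ j) ∔ a ∔ k ≗
              ℕ-con 2 ∙ (ℕ-con 1 ∔ m) ∔ n ∔ (ℕ-con 2 ∙ i ∔ j) ∔ a ∔ k) refl m n i j a (suc k)))
         (mixedMoment-euler euler m n i (suc j) (suc a) d
           (ℕ-solve 6 (λ m n i j a k → ℕ-con 2 ∙ m ∔ n ∔ (ℕ-con 2 ∙ i ∔ (ℕ-con 1 ∔ j)) ∔ (ℕ-con 1 ∔ a) ∔ k ≗
              ℕ-con 2 ∙ (ℕ-con 1 ∔ m) ∔ n ∔ (ℕ-con 2 ∙ i ∔ j) ∔ a ∔ k) refl m n i j a (suc k))) ⟩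
  fromℕℚ d *ℚ W (suc i) j a +ℚ fromℕℚ d *ℚ W i (suc j) (suc a)
    ≡⟨ ℚ.*-distribˡ-+ (fromℕℚ d) (W (suc i) j a) (W i (suc j) (suc a)) ⟨
  fromℕℚ d *ℚ (W (suc i) j a +ℚ W i (suc j) (suc a)) ∎
  where
  open ≡-Reasoning
  W = mixedMoment Λ m n

moment-zero-suc : ∀ i j → moment zero i (suc j) ≡ 0ℚ
moment-zero-suc zero    j = refl
moment-zero-suc (suc i) j = refl

moment-euler : ∀ k → Euler k (moment k)
moment-euler zero zero    zero    = refl
moment-euler zero zero    (suc j) = sym (ℚ.*-zeroʳ (fromℕℚ (suc j + 0)))
moment-euler zero (suc i) j       = sym (ℚ.*-zeroʳ (fromℕℚ (2 * suc i + j + 0)))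
moment-euler (suc k) m n = trans (mixedMoment-e₁ (moment k) m n 0 0 0)
  (mixedMoment-euler (moment-euler k) m n 0 0 0 (2 * m + n + suc k)
    (cong (_+ suc k) (trans (ℕ.+-identityʳ (2 * m + n + 0)) (ℕ.+-identityʳ (2 * m + n)))))

-- If f n stands for xⁿ, then derive f n stands for its derivative n xⁿ⁻¹.
derive : (ℕ → ℚ) → ℕ → ℚ
derive f zero    = 0ℚ
derive f (suc n) = fromℕℚ (suc n) *ℚ f n

-- The Leibniz rule for x · xⁿ.
derive-suc : ∀ f n → derive f (suc n) ≡ derive (λ n → f (suc n)) n +ℚ f n
derive-suc f zero    = solve 1 (λ x → con 1ℚ :* x := con 0ℚ :+ x) refl (f 0)
derive-suc f (suc n) = trans (cong (_*ℚ f (suc n)) (fromℕℚ-suc (suc n)))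
  (solve 2 (λ s x → (con 1ℚ :+ s) :* x := s :* x :+ x) refl (fromℕℚ (suc n)) (f (suc n)))

derive-+ : ∀ f g n → derive (λ n → f n +ℚ g n) n ≡ derive f n +ℚ derive g n
derive-+ f g zero    = refl
derive-+ f g (suc n) = ℚ.*-distribˡ-+ (fromℕℚ (suc n)) (f n) (g n)

derive-* : ∀ c f n → derive (λ n → c *ℚ f n) n ≡ c *ℚ derive f n
derive-* c f zero    = sym (ℚ.*-zeroʳ c)
derive-* c f (suc n) = solve 3 (λ s c x → s :* (c :* x) := c :* (s :* x)) refl (fromℕℚ (suc n)) c (f n)

-- The value of x tᵃ at t = 0, that is, the contribution of the face t = 0 to the boundary terms.
atZero : ℕ → ℚ → ℚ
atZero zero    x = x
atZero (suc a) x = 0ℚ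

-- Integration by parts for ∂₁ + ⋯ + ∂ₖ, which maps E₁ to k and E₂ to (k-1) E₁;
-- the boundary terms are integrals over the orthant of dimension k-1.
module _ (K : ℚ) (Λ Λ′ : ℕ → ℕ → ℚ) where

  ByParts : Set
  ByParts = ∀ i j → (K -ℚ 1ℚ) *ℚ derive (λ i → Λ i (suc j)) i +ℚ K *ℚ derive (λ j → Λ i j) j ≡
    K *ℚ Λ i j -ℚ K *ℚ Λ′ i j

  private
    W = mixedMoment Λ
    W′ = mixedMoment Λ′

  -- The derivation sends t to 1, hence E₂ + t E₁ to K (E₁ + t) and E₁ + t to K + 1; the left side
  -- is the Leibniz rule over the five exponents. On the right, K + 1 comes from differentiating the
  -- exponential, `W′` from the K old faces and `atZero` from the new face t = 0.
  mixedMoment-byParts : ByParts → ∀ m n i j a →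
    K *ℚ derive (λ m → W m (suc n) i j a) m +ℚ (K +ℚ 1ℚ) *ℚ derive (λ n → W m n i j a) n
      +ℚ (K -ℚ 1ℚ) *ℚ derive (λ i → W m n i (suc j) a) i +ℚ K *ℚ derive (λ j → W m n i j a) j
      +ℚ derive (λ a → W m n i j a) a
    ≡ (K +ℚ 1ℚ) *ℚ W m n i j a -ℚ K *ℚ W′ m n i j a -ℚ atZero a (Λ (m + i) (n + j))
  mixedMoment-byParts byParts zero zero i j a = begin
    K *ℚ 0ℚ +ℚ (K +ℚ 1ℚ) *ℚ 0ℚ +ℚ (K -ℚ 1ℚ) *ℚ derive (λ i → f *ℚ Λ i (suc j)) i
      +ℚ K *ℚ derive (λ j → f *ℚ Λ i j) j +ℚ Da
      ≡⟨ cong₂ (λ x y → K *ℚ 0ℚ +ℚ (K +ℚ 1ℚ) *ℚ 0ℚ +ℚ (K -ℚ 1ℚ) *ℚ x +ℚ K *ℚ y +ℚ Da)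
           (derive-* f (λ i → Λ i (suc j)) i) (derive-* f (Λ i) j) ⟩
    K *ℚ 0ℚ +ℚ (K +ℚ 1ℚ) *ℚ 0ℚ +ℚ (K -ℚ 1ℚ) *ℚ (f *ℚ Di) +ℚ K *ℚ (f *ℚ Dj) +ℚ Da
      ≡⟨ solve 5 (λ K f Di Dj Da → K :* con 0ℚ :+ (K :+ con 1ℚ) :* con 0ℚ :+ (K :- con 1ℚ) :* (f :* Di) :+ K :* (f :* Dj) :+ Da :=
           f :* ((K :- con 1ℚ) :* Di :+ K :* Dj) :+ Da) refl K f Di Dj Da ⟩
    f *ℚ ((K -ℚ 1ℚ) *ℚ Di +ℚ K *ℚ Dj) +ℚ Da
      ≡⟨ cong₂ (λ x y → f *ℚ x +ℚ y) (byParts i j) (factorial-derive a) ⟩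
    f *ℚ (K *ℚ Λ i j -ℚ K *ℚ Λ′ i j) +ℚ (f *ℚ Λ i j -ℚ atZero a (Λ i j))
      ≡⟨ solve 5 (λ K f l l′ z → f :* (K :* l :- K :* l′) :+ (f :* l :- z) := (K :+ con 1ℚ) :* (f :* l) :- K :* (f :* l′) :- z)
           refl K f (Λ i j) (Λ′ i j) (atZero a (Λ i j)) ⟩
    (K +ℚ 1ℚ) *ℚ (f *ℚ Λ i j) -ℚ K *ℚ (f *ℚ Λ′ i j) -ℚ atZero a (Λ i j) ∎
    where
    open ≡-Reasoning
    f = fromℕℚ (a !)
    Di = derive (λ i → Λ i (suc j)) i
    Dj = derive (Λ i) j
    Da = derive (λ a → fromℕℚ (a !) *ℚ Λ i j) a
    factorial-derive : ∀ a → derive (λ a → fromℕℚ (a !) *ℚ Λ i j) a ≡ fromℕℚ (a !) *ℚ Λ i j -ℚ atZero a (Λ i j)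
    factorial-derive zero    = solve 1 (λ l → con 0ℚ := con 1ℚ :* l :- l) refl (Λ i j)
    factorial-derive (suc a) = trans (sym (ℚ.*-assoc (fromℕℚ (suc a)) (fromℕℚ (a !)) (Λ i j)))
      (trans (cong (_*ℚ Λ i j) (sym (fromℕℚ-* (suc a) (a !))))
        (solve 1 (λ x → x := x :- con 0ℚ) refl (fromℕℚ (suc a * a !) *ℚ Λ i j)))
  mixedMoment-byParts byParts zero (suc n) i j a = begin
    K *ℚ 0ℚ +ℚ (K +ℚ 1ℚ) *ℚ derive (λ n → W 0 n i j a) (suc n)
      +ℚ (K -ℚ 1ℚ) *ℚ derive (λ i → W 0 n i (suc (suc j)) a +ℚ W 0 n i (suc j) (suc a)) i
      +ℚ K *ℚ derive (λ j → W 0 n i (suc j) a +ℚ W 0 n i j (suc a)) j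
      +ℚ derive (λ a → W 0 n i (suc j) a +ℚ W 0 n i j (suc a)) a
      ≡⟨ cong₂ _+ℚ_ (cong₂ _+ℚ_ (cong₂ (λ x y → K *ℚ 0ℚ +ℚ (K +ℚ 1ℚ) *ℚ x +ℚ (K -ℚ 1ℚ) *ℚ y)
           (trans (derive-suc (λ n → W 0 n i j a) n) (cong (_+ℚ w) (derive-+ (λ n → W 0 n i (suc j) a) (λ n → W 0 n i j (suc a)) n)))
           (derive-+ (λ i → W 0 n i (suc (suc j)) a) (λ i → W 0 n i (suc j) (suc a)) i))
           (cong (K *ℚ_) (derive-+ (λ j → W 0 n i (suc j) a) (λ j → W 0 n i j (suc a)) j)))
           (derive-+ (λ a → W 0 n i (suc j) a) (λ a → W 0 n i j (suc a)) a) ⟩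
    K *ℚ 0ℚ +ℚ (K +ℚ 1ℚ) *ℚ (n₁ +ℚ n₂ +ℚ w) +ℚ (K -ℚ 1ℚ) *ℚ (i₁ +ℚ i₂) +ℚ K *ℚ (j₁ +ℚ j₂) +ℚ (a₁ +ℚ a₂)
      -- `(K +ℚ 1ℚ) *ℚ w` is the derivative of the factor E₁ + t being split off: K w completes the
      -- Leibniz rule for E₁ʲ⁺¹ in one branch, w that for tᵃ⁺¹ in the other.
      ≡⟨ solve 10 (λ K n₁ n₂ w i₁ i₂ j₁ j₂ a₁ a₂ →
           K :* con 0ℚ :+ (K :+ con 1ℚ) :* (n₁ :+ n₂ :+ w) :+ (K :- con 1ℚ) :* (i₁ :+ i₂) :+ K :* (j₁ :+ j₂) :+ (a₁ :+ a₂) :=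
           (K :* con 0ℚ :+ (K :+ con 1ℚ) :* n₁ :+ (K :- con 1ℚ) :* i₁ :+ K :* (j₁ :+ w) :+ a₁) :+
           (K :* con 0ℚ :+ (K :+ con 1ℚ) :* n₂ :+ (K :- con 1ℚ) :* i₂ :+ K :* j₂ :+ (a₂ :+ w)))
           refl K n₁ n₂ w i₁ i₂ j₁ j₂ a₁ a₂ ⟩
    (K *ℚ 0ℚ +ℚ (K +ℚ 1ℚ) *ℚ n₁ +ℚ (K -ℚ 1ℚ) *ℚ i₁ +ℚ K *ℚ (j₁ +ℚ w) +ℚ a₁) +ℚ
    (K *ℚ 0ℚ +ℚ (K +ℚ 1ℚ) *ℚ n₂ +ℚ (K -ℚ 1ℚ) *ℚ i₂ +ℚ K *ℚ j₂ +ℚ (a₂ +ℚ w))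
      ≡⟨ cong₂ (λ x y → (K *ℚ 0ℚ +ℚ (K +ℚ 1ℚ) *ℚ n₁ +ℚ (K -ℚ 1ℚ) *ℚ i₁ +ℚ K *ℚ x +ℚ a₁) +ℚ
                        (K *ℚ 0ℚ +ℚ (K +ℚ 1ℚ) *ℚ n₂ +ℚ (K -ℚ 1ℚ) *ℚ i₂ +ℚ K *ℚ j₂ +ℚ y))
           (derive-suc (λ j → W 0 n i j a) j) (derive-suc (λ a → W 0 n i j a) a) ⟨
    (K *ℚ 0ℚ +ℚ (K +ℚ 1ℚ) *ℚ n₁ +ℚ (K -ℚ 1ℚ) *ℚ i₁ +ℚ K *ℚ derive (λ j → W 0 n i j a) (suc j) +ℚ a₁) +ℚ
    (K *ℚ 0ℚ +ℚ (K +ℚ 1ℚ) *ℚ n₂ +ℚ (K -ℚ 1ℚ) *ℚ i₂ +ℚ K *ℚ j₂ +ℚ derive (λ a → W 0 n i j a) (suc a))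
      ≡⟨ cong₂ _+ℚ_ (mixedMoment-byParts byParts zero n i (suc j) a) (mixedMoment-byParts byParts zero n i j (suc a)) ⟩
    ((K +ℚ 1ℚ) *ℚ x₁ -ℚ K *ℚ y₁ -ℚ atZero a (Λ i (n + suc j))) +ℚ ((K +ℚ 1ℚ) *ℚ x₂ -ℚ K *ℚ y₂ -ℚ 0ℚ)
      ≡⟨ cong (λ z → ((K +ℚ 1ℚ) *ℚ x₁ -ℚ K *ℚ y₁ -ℚ atZero a (Λ i z)) +ℚ ((K +ℚ 1ℚ) *ℚ x₂ -ℚ K *ℚ y₂ -ℚ 0ℚ)) (ℕ.+-suc n j) ⟩
    ((K +ℚ 1ℚ) *ℚ x₁ -ℚ K *ℚ y₁ -ℚ z) +ℚ ((K +ℚ 1ℚ) *ℚ x₂ -ℚ K *ℚ y₂ -ℚ 0ℚ)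
      ≡⟨ combine x₁ x₂ y₁ y₂ z ⟩
    (K +ℚ 1ℚ) *ℚ (x₁ +ℚ x₂) -ℚ K *ℚ (y₁ +ℚ y₂) -ℚ z ∎
    where
    open ≡-Reasoning
    w = W 0 n i j a
    n₁ = derive (λ n → W 0 n i (suc j) a) n
    n₂ = derive (λ n → W 0 n i j (suc a)) n
    i₁ = derive (λ i → W 0 n i (suc (suc j)) a) i
    i₂ = derive (λ i → W 0 n i (suc j) (suc a)) i
    j₁ = derive (λ j → W 0 n i (suc j) a) j
    j₂ = derive (λ j → W 0 n i j (suc a)) j
    a₁ = derive (λ a → W 0 n i (suc j) a) a
    a₂ = derive (λ a → W 0 n i j (suc a)) a
    x₁ = W 0 n i (suc j) a
    x₂ = W 0 n i j (suc a)
    y₁ = W′ 0 n i (suc j) a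
    y₂ = W′ 0 n i j (suc a)
    z = atZero a (Λ i (suc n + j))
    combine : ∀ x₁ x₂ y₁ y₂ z → ((K +ℚ 1ℚ) *ℚ x₁ -ℚ K *ℚ y₁ -ℚ z) +ℚ ((K +ℚ 1ℚ) *ℚ x₂ -ℚ K *ℚ y₂ -ℚ 0ℚ) ≡
      (K +ℚ 1ℚ) *ℚ (x₁ +ℚ x₂) -ℚ K *ℚ (y₁ +ℚ y₂) -ℚ z
    combine = solve 6 (λ K x₁ x₂ y₁ y₂ z →
      ((K :+ con 1ℚ) :* x₁ :- K :* y₁ :- z) :+ ((K :+ con 1ℚ) :* x₂ :- K :* y₂ :- con 0ℚ) :=
      (K :+ con 1ℚ) :* (x₁ :+ x₂) :- K :* (y₁ :+ y₂) :- z) refl K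
  mixedMoment-byParts byParts (suc m) n i j a = begin
    K *ℚ derive (λ m → W m (suc n) i j a) (suc m)
      +ℚ (K +ℚ 1ℚ) *ℚ derive (λ n → W m n (suc i) j a +ℚ W m n i (suc j) (suc a)) n
      +ℚ (K -ℚ 1ℚ) *ℚ derive (λ i → W m n (suc i) (suc j) a +ℚ W m n i (suc (suc j)) (suc a)) i
      +ℚ K *ℚ derive (λ j → W m n (suc i) j a +ℚ W m n i (suc j) (suc a)) j
      +ℚ derive (λ a → W m n (suc i) j a +ℚ W m n i (suc j) (suc a)) a
      ≡⟨ cong₂ _+ℚ_ (cong₂ _+ℚ_ (cong₂ _+ℚ_ (cong₂ (λ x y → K *ℚ x +ℚ (K +ℚ 1ℚ) *ℚ y)
           (trans (derive-suc (λ m → W m (suc n) i j a) m)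
             (cong₂ _+ℚ_ (derive-+ (λ m → W m (suc n) (suc i) j a) (λ m → W m (suc n) i (suc j) (suc a)) m)
                         (mixedMoment-e₁ Λ m n i j a)))
           (derive-+ (λ n → W m n (suc i) j a) (λ n → W m n i (suc j) (suc a)) n))
           (cong ((K -ℚ 1ℚ) *ℚ_) (derive-+ (λ i → W m n (suc i) (suc j) a) (λ i → W m n i (suc (suc j)) (suc a)) i)))
           (cong (K *ℚ_) (derive-+ (λ j → W m n (suc i) j a) (λ j → W m n i (suc j) (suc a)) j)))
           (derive-+ (λ a → W m n (suc i) j a) (λ a → W m n i (suc j) (suc a)) a) ⟩
    K *ℚ (m₁ +ℚ m₂ +ℚ (w₁ +ℚ w₂)) +ℚ (K +ℚ 1ℚ) *ℚ (n₁ +ℚ n₂) +ℚ (K -ℚ 1ℚ) *ℚ (i₁ +ℚ i₂) +ℚ K *ℚ (j₁ +ℚ j₂) +ℚ (a₁ +ℚ a₂)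
      -- The derivative K (w₁ + w₂) of the factor E₂ + t E₁ is distributed: (K - 1) w₁ belongs to
      -- E₂, while w₁ and K w₂ come from t and E₁ in t E₁.
      ≡⟨ solve 13 (λ K m₁ m₂ w₁ w₂ n₁ n₂ i₁ i₂ j₁ j₂ a₁ a₂ →
           K :* (m₁ :+ m₂ :+ (w₁ :+ w₂)) :+ (K :+ con 1ℚ) :* (n₁ :+ n₂) :+ (K :- con 1ℚ) :* (i₁ :+ i₂) :+ K :* (j₁ :+ j₂) :+ (a₁ :+ a₂) :=
           (K :* m₁ :+ (K :+ con 1ℚ) :* n₁ :+ (K :- con 1ℚ) :* (i₁ :+ w₁) :+ K :* j₁ :+ a₁) :+
           (K :* m₂ :+ (K :+ con 1ℚ) :* n₂ :+ (K :- con 1ℚ) :* i₂ :+ K :* (j₂ :+ w₂) :+ (a₂ :+ w₁)))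
           refl K m₁ m₂ w₁ w₂ n₁ n₂ i₁ i₂ j₁ j₂ a₁ a₂ ⟩
    (K *ℚ m₁ +ℚ (K +ℚ 1ℚ) *ℚ n₁ +ℚ (K -ℚ 1ℚ) *ℚ (i₁ +ℚ w₁) +ℚ K *ℚ j₁ +ℚ a₁) +ℚ
    (K *ℚ m₂ +ℚ (K +ℚ 1ℚ) *ℚ n₂ +ℚ (K -ℚ 1ℚ) *ℚ i₂ +ℚ K *ℚ (j₂ +ℚ w₂) +ℚ (a₂ +ℚ w₁))
      ≡⟨ cong₂ (λ x y → (K *ℚ m₁ +ℚ (K +ℚ 1ℚ) *ℚ n₁ +ℚ (K -ℚ 1ℚ) *ℚ x +ℚ K *ℚ j₁ +ℚ a₁) +ℚ y)
           (derive-suc (λ i → W m n i (suc j) a) i)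
           (cong₂ (λ x y → K *ℚ m₂ +ℚ (K +ℚ 1ℚ) *ℚ n₂ +ℚ (K -ℚ 1ℚ) *ℚ i₂ +ℚ K *ℚ x +ℚ y)
             (derive-suc (λ j → W m n i j (suc a)) j) (derive-suc (λ a → W m n i (suc j) a) a)) ⟨
    (K *ℚ m₁ +ℚ (K +ℚ 1ℚ) *ℚ n₁ +ℚ (K -ℚ 1ℚ) *ℚ derive (λ i → W m n i (suc j) a) (suc i) +ℚ K *ℚ j₁ +ℚ a₁) +ℚ
    (K *ℚ m₂ +ℚ (K +ℚ 1ℚ) *ℚ n₂ +ℚ (K -ℚ 1ℚ) *ℚ i₂ +ℚ K *ℚ derive (λ j → W m n i j (suc a)) (suc j)
      +ℚ derive (λ a → W m n i (suc j) a) (suc a))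
      ≡⟨ cong₂ _+ℚ_ (mixedMoment-byParts byParts m n (suc i) j a) (mixedMoment-byParts byParts m n i (suc j) (suc a)) ⟩
    ((K +ℚ 1ℚ) *ℚ x₁ -ℚ K *ℚ y₁ -ℚ atZero a (Λ (m + suc i) (n + j))) +ℚ ((K +ℚ 1ℚ) *ℚ x₂ -ℚ K *ℚ y₂ -ℚ 0ℚ)
      ≡⟨ cong (λ z → ((K +ℚ 1ℚ) *ℚ x₁ -ℚ K *ℚ y₁ -ℚ atZero a (Λ z (n + j))) +ℚ ((K +ℚ 1ℚ) *ℚ x₂ -ℚ K *ℚ y₂ -ℚ 0ℚ)) (ℕ.+-suc m i) ⟩
    ((K +ℚ 1ℚ) *ℚ x₁ -ℚ K *ℚ y₁ -ℚ z) +ℚ ((K +ℚ 1ℚ) *ℚ x₂ -ℚ K *ℚ y₂ -ℚ 0ℚ)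
      ≡⟨ solve 6 (λ K x₁ x₂ y₁ y₂ z →
           ((K :+ con 1ℚ) :* x₁ :- K :* y₁ :- z) :+ ((K :+ con 1ℚ) :* x₂ :- K :* y₂ :- con 0ℚ) :=
           (K :+ con 1ℚ) :* (x₁ :+ x₂) :- K :* (y₁ :+ y₂) :- z) refl K x₁ x₂ y₁ y₂ z ⟩
    (K +ℚ 1ℚ) *ℚ (x₁ +ℚ x₂) -ℚ K *ℚ (y₁ +ℚ y₂) -ℚ z ∎
    where
    open ≡-Reasoning
    w₁ = W m n i (suc j) a
    w₂ = W m n i j (suc a)
    m₁ = derive (λ m → W m (suc n) (suc i) j a) m
    m₂ = derive (λ m → W m (suc n) i (suc j) (suc a)) m
    n₁ = derive (λ n → W m n (suc i) j a) n
    n₂ = derive (λ n → W m n i (suc j) (suc a)) n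
    i₁ = derive (λ i → W m n (suc i) (suc j) a) i
    i₂ = derive (λ i → W m n i (suc (suc j)) (suc a)) i
    j₁ = derive (λ j → W m n (suc i) j a) j
    j₂ = derive (λ j → W m n i (suc j) (suc a)) j
    a₁ = derive (λ a → W m n (suc i) j a) a
    a₂ = derive (λ a → W m n i (suc j) (suc a)) a
    x₁ = W m n (suc i) j a
    x₂ = W m n i (suc j) (suc a)
    y₁ = W′ m n (suc i) j a
    y₂ = W′ m n i (suc j) (suc a)
    z = atZero a (Λ (suc m + i) (n + j))

-- In `mixedMoment-byParts` with i = j = a = 0 only the derivatives in m and n survive, and the face
-- t = 0 adds one boundary term to the k inherited ones.
moment-byParts : ∀ k → ByParts (fromℕℚ k) (moment k) (moment (ℕ.pred k))
moment-byParts zero i j = trans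
  (cong (λ x → (0ℚ -ℚ 1ℚ) *ℚ x +ℚ 0ℚ *ℚ derive (moment 0 i) j) (vanish i))
  (solve 2 (λ x y → (con 0ℚ :- con 1ℚ) :* con 0ℚ :+ con 0ℚ :* x := con 0ℚ :* y :- con 0ℚ :* y) refl
    (derive (moment 0 i) j) (moment 0 i j))
  where
  vanish : ∀ i → derive (λ i → moment 0 i (suc j)) i ≡ 0ℚ
  vanish zero    = refl
  vanish (suc i) = trans (cong (fromℕℚ (suc i) *ℚ_) (moment-zero-suc i j)) (ℚ.*-zeroʳ (fromℕℚ (suc i)))
moment-byParts (suc k) m n = begin
  (fromℕℚ (suc k) -ℚ 1ℚ) *ℚ Dm +ℚ fromℕℚ (suc k) *ℚ Dn
    ≡⟨ cong (λ x → (x -ℚ 1ℚ) *ℚ Dm +ℚ x *ℚ Dn) (fromℕℚ-suc k) ⟩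
  (1ℚ +ℚ K -ℚ 1ℚ) *ℚ Dm +ℚ (1ℚ +ℚ K) *ℚ Dn
    ≡⟨ solve 3 (λ K Dm Dn → (con 1ℚ :+ K :- con 1ℚ) :* Dm :+ (con 1ℚ :+ K) :* Dn :=
         K :* Dm :+ (K :+ con 1ℚ) :* Dn :+ (K :- con 1ℚ) :* con 0ℚ :+ K :* con 0ℚ :+ con 0ℚ) refl K Dm Dn ⟩
  K *ℚ Dm +ℚ (K +ℚ 1ℚ) *ℚ Dn +ℚ (K -ℚ 1ℚ) *ℚ 0ℚ +ℚ K *ℚ 0ℚ +ℚ 0ℚ
    ≡⟨ mixedMoment-byParts K (moment k) (moment (ℕ.pred k)) (moment-byParts k) m n 0 0 0 ⟩
  (K +ℚ 1ℚ) *ℚ moment (suc k) m n -ℚ K *ℚ mixedMoment (moment (ℕ.pred k)) m n 0 0 0 -ℚ moment k (m + 0) (n + 0)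
    ≡⟨ cong₂ (λ x y → (K +ℚ 1ℚ) *ℚ moment (suc k) m n -ℚ x -ℚ y) (previous k)
         (cong₂ (moment k) (ℕ.+-identityʳ m) (ℕ.+-identityʳ n)) ⟩
  (K +ℚ 1ℚ) *ℚ moment (suc k) m n -ℚ K *ℚ moment k m n -ℚ moment k m n
    ≡⟨ solve 3 (λ K x y → (K :+ con 1ℚ) :* x :- K :* y :- y := (con 1ℚ :+ K) :* x :- (con 1ℚ :+ K) :* y) refl
         K (moment (suc k) m n) (moment k m n) ⟩
  (1ℚ +ℚ K) *ℚ moment (suc k) m n -ℚ (1ℚ +ℚ K) *ℚ moment k m n
    ≡⟨ cong (λ x → x *ℚ moment (suc k) m n -ℚ x *ℚ moment k m n) (fromℕℚ-suc k) ⟨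
  fromℕℚ (suc k) *ℚ moment (suc k) m n -ℚ fromℕℚ (suc k) *ℚ moment k m n ∎
  where
  open ≡-Reasoning
  K = fromℕℚ k
  Dm = derive (λ m → moment (suc k) m (suc n)) m
  Dn = derive (λ n → moment (suc k) m n) n
  -- For k = 0 the truncated predecessor names the wrong dimension, but the factor k is then 0.
  previous : ∀ k → fromℕℚ k *ℚ mixedMoment (moment (ℕ.pred k)) m n 0 0 0 ≡ fromℕℚ k *ℚ moment k m n
  previous zero    = trans (ℚ.*-zeroˡ (mixedMoment (moment 0) m n 0 0 0)) (sym (ℚ.*-zeroˡ (moment 0 m n)))
  previous (suc k) = refl

-- Integration by parts at n = 0 leaves one derivative term, a moment with a single factor E₁;
-- Euler's identity removes that factor.
moment-recurrence : ∀ k m → fromℕℚ (suc k) *ℚ moment (suc k) (suc m) 0 ≡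
  fromℕℚ k *ℚ (fromℕℚ (suc m) *ℚ (fromℕℚ (2 * m + suc k) *ℚ moment (suc k) m 0)) +ℚ
  fromℕℚ (suc k) *ℚ moment k (suc m) 0
moment-recurrence k m = begin
  s *ℚ x
    ≡⟨ solve 3 (λ s x y → s :* x := (s :* x :- s :* y) :+ s :* y) refl s x y ⟩
  (s *ℚ x -ℚ s *ℚ y) +ℚ s *ℚ y
    ≡⟨ cong (_+ℚ s *ℚ y) (moment-byParts (suc k) (suc m) 0) ⟨
  ((s -ℚ 1ℚ) *ℚ (fromℕℚ (suc m) *ℚ moment (suc k) m 1) +ℚ s *ℚ 0ℚ) +ℚ s *ℚ y
    ≡⟨ cong₂ (λ u v → ((u -ℚ 1ℚ) *ℚ (fromℕℚ (suc m) *ℚ v) +ℚ s *ℚ 0ℚ) +ℚ s *ℚ y) (fromℕℚ-suc k)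
         (trans (moment-euler (suc k) m 0) (cong (λ z → fromℕℚ (z + suc k) *ℚ moment (suc k) m 0) (ℕ.+-identityʳ (2 * m)))) ⟩
  ((1ℚ +ℚ fromℕℚ k -ℚ 1ℚ) *ℚ (fromℕℚ (suc m) *ℚ e) +ℚ s *ℚ 0ℚ) +ℚ s *ℚ y
    ≡⟨ solve 5 (λ K M e s y → ((con 1ℚ :+ K :- con 1ℚ) :* (M :* e) :+ s :* con 0ℚ) :+ s :* y := K :* (M :* e) :+ s :* y) refl
         (fromℕℚ k) (fromℕℚ (suc m)) e s y ⟩
  fromℕℚ k *ℚ (fromℕℚ (suc m) *ℚ e) +ℚ s *ℚ y ∎
  where
  open ≡-Reasoning
  s = fromℕℚ (suc k)
  x = moment (suc k) (suc m) 0
  y = moment k (suc m) 0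
  e = fromℕℚ (2 * m + suc k) *ℚ moment (suc k) m 0

-- For constant integrand every derivative vanishes, so integration by parts equates consecutive
-- dimensions.
moment-0-0 : ∀ k → moment k 0 0 ≡ 1ℚ
moment-0-0 zero    = refl
moment-0-0 (suc k) = trans (*-cancelˡ-suc k (begin
  s *ℚ x                          ≡⟨ solve 3 (λ s x y → s :* x := (s :* x :- s :* y) :+ s :* y) refl s x y ⟩
  (s *ℚ x -ℚ s *ℚ y) +ℚ s *ℚ y    ≡⟨ cong (_+ℚ s *ℚ y) (moment-byParts (suc k) 0 0) ⟨
  ((s -ℚ 1ℚ) *ℚ 0ℚ +ℚ s *ℚ 0ℚ) +ℚ s *ℚ y ≡⟨ solve 2 (λ s y → ((s :- con 1ℚ) :* con 0ℚ :+ s :* con 0ℚ) :+ s :* y := s :* y) refl s y ⟩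
  s *ℚ y ∎)) (moment-0-0 k)
  where
  open ≡-Reasoning
  s = fromℕℚ (suc k)
  x = moment (suc k) 0 0
  y = moment k 0 0

-- The closed form

fromℕℚ-*-/ : ∀ a b .{{_ : NonZero b}} → fromℕℚ b *ℚ (+ a / b) ≡ fromℕℚ a
fromℕℚ-*-/ a (suc b) = trans (sym (fromℚᵘ-homo-* (ℚᵘ.mkℚᵘ (+ suc b) 0) (ℚᵘ.mkℚᵘ (+ a) b)))
  (ℚ.fromℚᵘ-cong {ℚᵘ.mkℚᵘ (+ suc b) 0 ℚᵘ.* ℚᵘ.mkℚᵘ (+ a) b} {ℚᵘ.mkℚᵘ (+ a) 0} (ℚᵘ.*≡*
    (trans (ℤ.*-identityʳ (+ suc b ℤ.* + a)) (trans (ℤ.*-comm (+ suc b) (+ a))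
      (cong (λ z → + a ℤ.* + suc z) (sym (ℕ.+-identityʳ b)))))))

*-cancelˡ-fromℕℚ : ∀ b .{{_ : NonZero b}} {p q} → fromℕℚ b *ℚ p ≡ fromℕℚ b *ℚ q → p ≡ q
*-cancelˡ-fromℕℚ (suc b) = *-cancelˡ-suc b

^ℚ-distrib-* : ∀ p q n → (p *ℚ q) ^ℚ n ≡ p ^ℚ n *ℚ q ^ℚ n
^ℚ-distrib-* p q zero    = refl
^ℚ-distrib-* p q (suc n) = trans (cong (p *ℚ q *ℚ_) (^ℚ-distrib-* p q n))
  (solve 4 (λ p q x y → p :* q :* (x :* y) := (p :* x) :* (q :* y)) refl p q (p ^ℚ n) (q ^ℚ n))

fromℕℚ-^ : ∀ a n → fromℕℚ (a ℕ.^ n) ≡ fromℕℚ a ^ℚ n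
fromℕℚ-^ a zero    = refl
fromℕℚ-^ a (suc n) = trans (fromℕℚ-* a (a ℕ.^ n)) (cong (fromℕℚ a *ℚ_) (fromℕℚ-^ a n))

fromℕℚ-^-double : ∀ a n → fromℕℚ (a ℕ.^ (2 * n)) ≡ (fromℕℚ a *ℚ fromℕℚ a) ^ℚ n
fromℕℚ-^-double a n = begin
  fromℕℚ (a ℕ.^ (2 * n))           ≡⟨ cong fromℕℚ (ℕ.^-*-assoc a 2 n) ⟨
  fromℕℚ ((a ℕ.^ 2) ℕ.^ n)         ≡⟨ fromℕℚ-^ (a ℕ.^ 2) n ⟩
  fromℕℚ (a ℕ.^ 2) ^ℚ n            ≡⟨ cong (λ z → fromℕℚ (a * z) ^ℚ n) (ℕ.*-identityʳ a) ⟩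
  fromℕℚ (a * a) ^ℚ n              ≡⟨ cong (_^ℚ n) (fromℕℚ-* a a) ⟩
  (fromℕℚ a *ℚ fromℕℚ a) ^ℚ n      ∎
  where open ≡-Reasoning

productℚ-last : ∀ m (f : ℕ → ℚ) →
  productℚ {suc m} (λ i → f (toℕ i)) ≡ productℚ {m} (λ i → f (toℕ i)) *ℚ f m
productℚ-last zero    f = ℚ.*-comm (f 0) 1ℚ
productℚ-last (suc m) f = trans (cong (f 0 *ℚ_) (productℚ-last m (λ i → f (suc i))))
  (sym (ℚ.*-assoc (f 0) (productℚ {m} (λ i → f (suc (toℕ i)))) (f (suc m))))

rising-suc : ∀ y m → rising y (suc m) ≡ rising y m *ℚ (y +ℚ fromℕℚ m)
rising-suc y m = productℚ-last m (λ i → y +ℚ fromℕℚ i)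

scaleFactor : ∀ k .{{_ : NonZero k}} → ℚ
scaleFactor k = + (2 * (k ∸ 1)) / k

*-÷-cancel : ∀ p q .{{_ : ℚ.NonZero q}} → q *ℚ (p ÷ q) ≡ p
*-÷-cancel p q = trans (solve 3 (λ q p r → q :* (p :* r) := p :* (q :* r)) refl q p (ℚ.1/ q))
  (trans (cong (p *ℚ_) (ℚ.*-inverseʳ q)) (ℚ.*-identityʳ p))

-- This is where the coefficient in the recurrence for `T` originates: `ratio` is the quotient of
-- the normalising factors in dimensions k - 1 and k, where k = j + 2.
ratio-scale : ∀ j m → rising (+ (2 + j) / 2) m *ℚ scaleFactor (2 + j) ^ℚ m *ℚ ratio j m ≡
  rising (+ suc j / 2) m *ℚ scaleFactor (suc j) ^ℚ m
ratio-scale j m = *-cancelˡ-fromℕℚ Y {{Y≢0}} (begin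
  y *ℚ (r *ℚ p ^ℚ m *ℚ (z *ℚ d))
    ≡⟨ solve 5 (λ y r p z d → y :* (r :* p :* (z :* d)) := (r :* d) :* (p :* (y :* z))) refl y r (p ^ℚ m) z d ⟩
  (r *ℚ d) *ℚ (p ^ℚ m *ℚ (y *ℚ z))
    ≡⟨ cong₂ (λ u v → u *ℚ (p ^ℚ m *ℚ v)) (*-÷-cancel r′ r {{rising-nonZero (2 + j) m}}) (fromℕℚ-*-/ X Y {{Y≢0}}) ⟩
  r′ *ℚ (p ^ℚ m *ℚ fromℕℚ X)
    ≡⟨ cong (λ v → r′ *ℚ (p ^ℚ m *ℚ v)) (trans (fromℕℚ-^ ((2 + j) * j) m) (cong (_^ℚ m) (fromℕℚ-* (2 + j) j))) ⟩
  r′ *ℚ (p ^ℚ m *ℚ (K *ℚ J) ^ℚ m)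
    ≡⟨ cong (r′ *ℚ_) (^ℚ-distrib-* p (K *ℚ J) m) ⟨
  r′ *ℚ (p *ℚ (K *ℚ J)) ^ℚ m
    ≡⟨ cong (λ v → r′ *ℚ v ^ℚ m) base ⟩
  r′ *ℚ ((s *ℚ s) *ℚ p′) ^ℚ m
    ≡⟨ cong (r′ *ℚ_) (^ℚ-distrib-* (s *ℚ s) p′ m) ⟩
  r′ *ℚ ((s *ℚ s) ^ℚ m *ℚ p′ ^ℚ m)
    ≡⟨ cong (λ v → r′ *ℚ (v *ℚ p′ ^ℚ m)) (fromℕℚ-^-double (suc j) m) ⟨
  r′ *ℚ (y *ℚ p′ ^ℚ m)
    ≡⟨ solve 3 (λ r y p → r :* (y :* p) := y :* (r :* p)) refl r′ y (p′ ^ℚ m) ⟩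
  y *ℚ (r′ *ℚ p′ ^ℚ m) ∎)
  where
  open ≡-Reasoning
  X = ((2 + j) * j) ℕ.^ m
  Y = suc j ℕ.^ (2 * m)
  Y≢0 = ℕ.m^n≢0 (suc j) (2 * m)
  y = fromℕℚ Y
  z = (+ X / Y) {{Y≢0}}
  r = rising (+ (2 + j) / 2) m
  r′ = rising (+ suc j / 2) m
  d = (r′ ÷ r) {{rising-nonZero (2 + j) m}}
  p = scaleFactor (2 + j)
  p′ = scaleFactor (suc j)
  K = fromℕℚ (2 + j)
  J = fromℕℚ j
  s = fromℕℚ (suc j)
  -- Both sides equal 2 (k - 1)(k - 2).
  base : p *ℚ (K *ℚ J) ≡ (s *ℚ s) *ℚ p′
  base = begin
    p *ℚ (K *ℚ J)            ≡⟨ solve 3 (λ p K J → p :* (K :* J) := (K :* p) :* J) refl p K J ⟩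
    (K *ℚ p) *ℚ J            ≡⟨ cong (_*ℚ J) (trans (fromℕℚ-*-/ (2 * suc j) (2 + j)) (fromℕℚ-* 2 (suc j))) ⟩
    fromℕℚ 2 *ℚ s *ℚ J       ≡⟨ solve 3 (λ t s J → t :* s :* J := s :* (t :* J)) refl (fromℕℚ 2) s J ⟩
    s *ℚ (fromℕℚ 2 *ℚ J)     ≡⟨ cong (s *ℚ_) (trans (fromℕℚ-*-/ (2 * j) (suc j)) (fromℕℚ-* 2 j)) ⟨
    s *ℚ (s *ℚ p′)           ≡⟨ ℚ.*-assoc s s p′ ⟨
    (s *ℚ s) *ℚ p′           ∎

-- The right-hand side of the theorem at n = 0, where the quotient of the two large factorials is 1.
closedForm : ∀ k .{{_ : NonZero k}} → ℕ → ℚ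
closedForm k m = fromℕℚ (m !) *ℚ (rising (+ k / 2) m *ℚ scaleFactor k ^ℚ m) *ℚ T k m

closedForm-recurrence : ∀ j m → fromℕℚ (2 + j) *ℚ closedForm (2 + j) (suc m) ≡
  fromℕℚ (suc j) *ℚ (fromℕℚ (suc m) *ℚ (fromℕℚ (2 * m + (2 + j)) *ℚ closedForm (2 + j) m)) +ℚ
  fromℕℚ (2 + j) *ℚ closedForm (suc j) (suc m)
closedForm-recurrence j m = begin
  K *ℚ (F *ℚ (R *ℚ P) *ℚ (t +ℚ ρ *ℚ t′))
    ≡⟨ solve 7 (λ K F R P t ρ t′ → K :* (F :* (R :* P) :* (t :+ ρ :* t′)) :=
         K :* (F :* (R :* P) :* t) :+ K :* (F :* (R :* P :* ρ) :* t′)) refl K F R P t ρ t′ ⟩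
  K *ℚ (F *ℚ (R *ℚ P) *ℚ t) +ℚ K *ℚ (F *ℚ (R *ℚ P *ℚ ρ) *ℚ t′)
    ≡⟨ cong₂ (λ u v → u +ℚ K *ℚ (F *ℚ v *ℚ t′)) diagonal (ratio-scale j (suc m)) ⟩
  s *ℚ (M *ℚ (E *ℚ (f *ℚ (r *ℚ p ^ℚ m) *ℚ t))) +ℚ K *ℚ closedForm (suc j) (suc m) ∎
  where
  open ≡-Reasoning
  h = + (2 + j) / 2
  p = scaleFactor (2 + j)
  K = fromℕℚ (2 + j)
  s = fromℕℚ (suc j)
  M = fromℕℚ (suc m)
  E = fromℕℚ (2 * m + (2 + j))
  F = fromℕℚ (suc m !)
  f = fromℕℚ (m !)
  R = rising h (suc m)
  r = rising h m
  P = p ^ℚ suc m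
  t = T (2 + j) m
  t′ = T (suc j) (suc m)
  ρ = ratio j (suc m)
  two = fromℕℚ 2
  -- Passing from m to m + 1 multiplies the normalising factor by (m + 1)(k/2 + m) · 2(k - 1)/k;
  -- times k this is (k - 1)(m + 1)(2m + k), the coefficient in the recurrence of the moments.
  diagonal : K *ℚ (F *ℚ (R *ℚ P) *ℚ t) ≡ s *ℚ (M *ℚ (E *ℚ (f *ℚ (r *ℚ p ^ℚ m) *ℚ t)))
  diagonal = begin
    K *ℚ (F *ℚ (R *ℚ (p *ℚ p ^ℚ m)) *ℚ t)
      ≡⟨ cong₂ (λ u v → K *ℚ (u *ℚ (v *ℚ (p *ℚ p ^ℚ m)) *ℚ t)) (fromℕℚ-* (suc m) (m !)) (rising-suc h m) ⟩
    K *ℚ (M *ℚ f *ℚ (r *ℚ (h +ℚ m̂) *ℚ (p *ℚ p ^ℚ m)) *ℚ t)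
      ≡⟨ solve 9 (λ K M f r h m p q t → K :* (M :* f :* (r :* (h :+ m) :* (p :* q)) :* t) :=
           (K :* p) :* (h :+ m) :* (M :* (f :* (r :* q) :* t))) refl K M f r h m̂ p (p ^ℚ m) t ⟩
    (K *ℚ p) *ℚ (h +ℚ m̂) *ℚ (M *ℚ (f *ℚ (r *ℚ p ^ℚ m) *ℚ t))
      ≡⟨ cong (λ u → u *ℚ (h +ℚ m̂) *ℚ (M *ℚ (f *ℚ (r *ℚ p ^ℚ m) *ℚ t)))
           (trans (fromℕℚ-*-/ (2 * suc j) (2 + j)) (fromℕℚ-* 2 (suc j))) ⟩
    two *ℚ s *ℚ (h +ℚ m̂) *ℚ (M *ℚ (f *ℚ (r *ℚ p ^ℚ m) *ℚ t))
      ≡⟨ solve 6 (λ two s h m M c → two :* s :* (h :+ m) :* (M :* c) := s :* (M :* ((two :* m :+ two :* h) :* c))) refl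
           two s h m̂ M (f *ℚ (r *ℚ p ^ℚ m) *ℚ t) ⟩
    s *ℚ (M *ℚ ((two *ℚ m̂ +ℚ two *ℚ h) *ℚ (f *ℚ (r *ℚ p ^ℚ m) *ℚ t)))
      ≡⟨ cong (λ u → s *ℚ (M *ℚ (u *ℚ (f *ℚ (r *ℚ p ^ℚ m) *ℚ t))))
           (trans (cong₂ _+ℚ_ (sym (fromℕℚ-* 2 m)) (fromℕℚ-*-/ (2 + j) 2)) (sym (fromℕℚ-+ (2 * m) (2 + j)))) ⟩
    s *ℚ (M *ℚ (E *ℚ (f *ℚ (r *ℚ p ^ℚ m) *ℚ t))) ∎
    where m̂ = fromℕℚ m

-- The convention T₁(0) = 0 does not match the moment 1. The recurrence at m + 1 refers to the lower
-- dimension only at m + 1, so dimension 1 enters with positive exponent, where e₂ = 0 makes the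
-- moment vanish as well.
moment-closedForm-suc : ∀ j m → moment (suc j) (suc m) 0 ≡ closedForm (suc j) (suc m)
moment-closedForm : ∀ j m → moment (2 + j) m 0 ≡ closedForm (2 + j) m

moment-closedForm-suc zero m = trans
  (*-cancelˡ-suc 0 (trans (moment-recurrence 0 m)
    (solve 1 (λ x → con 0ℚ :* x :+ con 1ℚ :* con 0ℚ := con 1ℚ :* con 0ℚ) refl
      (fromℕℚ (suc m) *ℚ (fromℕℚ (2 * m + 1) *ℚ moment 1 m 0)))))
  (sym (ℚ.*-zeroʳ (fromℕℚ (suc m !) *ℚ (rising (+ 1 / 2) (suc m) *ℚ scaleFactor 1 ^ℚ suc m))))
moment-closedForm-suc (suc j) m = moment-closedForm j (suc m)

moment-closedForm j zero    = moment-0-0 (2 + j)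
moment-closedForm j (suc m) = *-cancelˡ-suc (suc j) (begin
  fromℕℚ (2 + j) *ℚ moment (2 + j) (suc m) 0
    ≡⟨ moment-recurrence (suc j) m ⟩
  fromℕℚ (suc j) *ℚ (fromℕℚ (suc m) *ℚ (fromℕℚ (2 * m + (2 + j)) *ℚ moment (2 + j) m 0)) +ℚ
  fromℕℚ (2 + j) *ℚ moment (suc j) (suc m) 0
    ≡⟨ cong₂ (λ u v → fromℕℚ (suc j) *ℚ (fromℕℚ (suc m) *ℚ (fromℕℚ (2 * m + (2 + j)) *ℚ u)) +ℚ fromℕℚ (2 + j) *ℚ v)
         (moment-closedForm j m) (moment-closedForm-suc j m) ⟩
  fromℕℚ (suc j) *ℚ (fromℕℚ (suc m) *ℚ (fromℕℚ (2 * m + (2 + j)) *ℚ closedForm (2 + j) m)) +ℚ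
  fromℕℚ (2 + j) *ℚ closedForm (suc j) (suc m)
    ≡⟨ closedForm-recurrence j m ⟨
  fromℕℚ (2 + j) *ℚ closedForm (2 + j) (suc m) ∎)
  where open ≡-Reasoning

-- Euler's identity applied n times; the factors (2m + k + 1) ⋯ (2m + n + k) are written as a
-- quotient of factorials with the denominator cleared.
moment-! : ∀ k m n → fromℕℚ ((2 * m + k) !) *ℚ moment (suc k) m n ≡ fromℕℚ ((2 * m + n + k) !) *ℚ moment (suc k) m 0
moment-! k m zero = cong (λ z → fromℕℚ ((z + k) !) *ℚ moment (suc k) m 0) (sym (ℕ.+-identityʳ (2 * m)))
moment-! k m (suc n) = begin
  b *ℚ moment (suc k) m (suc n)
    ≡⟨ cong (b *ℚ_) (trans (moment-euler (suc k) m n) (cong (λ z → fromℕℚ z *ℚ x) (ℕ.+-suc (2 * m + n) k))) ⟩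
  b *ℚ (e *ℚ x)
    ≡⟨ solve 3 (λ b e x → b :* (e :* x) := e :* (b :* x)) refl b e x ⟩
  e *ℚ (b *ℚ x)
    ≡⟨ cong (e *ℚ_) (moment-! k m n) ⟩
  e *ℚ (fromℕℚ ((2 * m + n + k) !) *ℚ y)
    ≡⟨ ℚ.*-assoc e (fromℕℚ ((2 * m + n + k) !)) y ⟨
  e *ℚ fromℕℚ ((2 * m + n + k) !) *ℚ y
    ≡⟨ cong (_*ℚ y) (fromℕℚ-* (suc (2 * m + n + k)) ((2 * m + n + k) !)) ⟨
  fromℕℚ (suc (2 * m + n + k) !) *ℚ y
    ≡⟨ cong (λ z → fromℕℚ ((z + k) !) *ℚ y) (ℕ.+-suc (2 * m) n) ⟨
  fromℕℚ ((2 * m + suc n + k) !) *ℚ y ∎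
  where
  open ≡-Reasoning
  b = fromℕℚ ((2 * m + k) !)
  e = fromℕℚ (suc (2 * m + n + k))
  x = moment (suc k) m n
  y = moment (suc k) m 0

moment-0-closedForm : ∀ k m → ¬ (suc k ≡ 1 × m ≡ 0) → moment (suc k) m 0 ≡ closedForm (suc k) m
moment-0-closedForm zero    zero    h = ⊥-elim (h (refl , refl))
moment-0-closedForm zero    (suc m) h = moment-closedForm-suc zero m
moment-0-closedForm (suc k) m       h = moment-closedForm k m

-- `A` and `B` are variables so that the truncated subtractions in the theorem are met by equations
-- between naturals instead of rewriting inside a fraction.
moment-formula : ∀ k m n → ¬ (suc k ≡ 1 × m ≡ 0) → ∀ A B .{{_ : NonZero (B !)}} → 2 * m + n + k ≡ A → 2 * m + k ≡ B →
  moment (suc k) m n ≡ (+ (m ! * A !) / B !) *ℚ rising (+ suc k / 2) m *ℚ scaleFactor (suc k) ^ℚ m *ℚ T (suc k) m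
moment-formula k m n h A B refl refl = *-cancelˡ-fromℕℚ (B !) (begin
  fromℕℚ (B !) *ℚ moment (suc k) m n
    ≡⟨ moment-! k m n ⟩
  fromℕℚ (A !) *ℚ moment (suc k) m 0
    ≡⟨ cong (fromℕℚ (A !) *ℚ_) (moment-0-closedForm k m h) ⟩
  fromℕℚ (A !) *ℚ (f *ℚ (r *ℚ p) *ℚ t)
    ≡⟨ solve 5 (λ a f r p t → a :* (f :* (r :* p) :* t) := (f :* a) :* r :* p :* t) refl (fromℕℚ (A !)) f r p t ⟩
  (f *ℚ fromℕℚ (A !)) *ℚ r *ℚ p *ℚ t
    ≡⟨ cong (λ u → u *ℚ r *ℚ p *ℚ t) (trans (fromℕℚ-*-/ (m ! * A !) (B !)) (fromℕℚ-* (m !) (A !))) ⟨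
  (fromℕℚ (B !) *ℚ q) *ℚ r *ℚ p *ℚ t
    ≡⟨ solve 5 (λ b q r p t → b :* q :* r :* p :* t := b :* (q :* r :* p :* t)) refl (fromℕℚ (B !)) q r p t ⟩
  fromℕℚ (B !) *ℚ (q *ℚ r *ℚ p *ℚ t) ∎)
  where
  open ≡-Reasoning
  q = + (m ! * A !) / B !
  f = fromℕℚ (m !)
  r = rising (+ suc k / 2) m
  p = scaleFactor (suc k) ^ℚ m
  t = T (suc k) m

moment-≡ : (k m n : ℕ) .{{_ : NonZero k}} → ¬ (k ≡ 1 × m ≡ 0) → moment k m n ≡
    (+ (m ! * (2 * m + n + k ∸ 1) !) / ((2 * m + k ∸ 1) !)) {{(2 * m + k ∸ 1) !≢0}}
    *ℚ rising (+ k / 2) m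
    *ℚ (+ (2 * (k ∸ 1)) / k) ^ℚ m
    *ℚ T k m
moment-≡ zero    m n h = ⊥-elim (ℕ.≢-nonZero⁻¹ 0 refl)
moment-≡ (suc k) m n h = moment-formula k m n h (2 * m + n + suc k ∸ 1) (2 * m + suc k ∸ 1) {{(2 * m + suc k ∸ 1) !≢0}}
  (cong (_∸ 1) (sym (ℕ.+-suc (2 * m + n) k))) (cong (_∸ 1) (sym (ℕ.+-suc (2 * m) k)))

orthant-integral-≡ : ∀ k m n q → moment k m n ≡ q → IsIntegralOverOrthant {k}
  (λ x → e₂ x ^ℝ m *ℝ e₁ x ^ℝ n *ℝ exp (-ℝ e₁ x)) (fromℚ q)
orthant-integral-≡ k m n q refl = orthant-integral k m n

mainTheorem1 : (k m n : ℕ) .{{_ : NonZero k}} → ¬ (k ≡ 1 × m ≡ 0) →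
    IsIntegralOverOrthant {k}
    (λ x → e₂ x ^ℝ m *ℝ e₁ x ^ℝ n *ℝ exp (-ℝ e₁ x))
    (fromℚ
    ((+ (m ! * (2 * m + n + k ∸ 1) !) / ((2 * m + k ∸ 1) !)) {{(2 * m + k ∸ 1) !≢0}}
    *ℚ rising (+ k / 2) m
    *ℚ (+ (2 * (k ∸ 1)) / k) ^ℚ m
    *ℚ T k m))
mainTheorem1 k m n h = orthant-integral-≡ k m n _ (moment-≡ k m n h)
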